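{- Let $p\ge2$ be an integer. For every $m\ge1$, Welter's game $\mathrm{Welter}_m$ is $p$-calm. In particular, if $\tilde\Gamma$ is a $p$-saturation of $\mathrm{Welter}_{m^1}+\cdots+\mathrm{Welter}_{m^k}$ and $\mathbb A=(A^1,\dots,A^k)$ is a position of $\tilde\Gamma$, then \[ \mathrm{sg}_{\tilde\Gamma}(\mathbb A)=\psi_p(A^1)\oplus_p\cdots\oplus_p\psi_p(A^k). \]
   Context: An impartial game is a digraph (positions, moves) with finite maximum walk length from each vertex; $B$ is a descendant of $A$ if there is a path from $A$ to $B$, proper if $B\neq A$. $\mathrm{sg}_\Gamma(A)=\operatorname{mex}\{\mathrm{sg}_\Gamma(B):(A,B)\text{ an edge}\}$. The subtraction game $\Gamma(\mathcal P,\mathcal C)$ ($\mathcal P\subseteq\mathbb N^m$, $\mathcal C\subseteq\mathbb N^m\setminus\{0\}$) has positions $\mathcal P$ and edges $\{(A,B)\in\mathcal P^2:A-B\in\mathcal C\}$. Welter's game is $\mathrm{Welter}_m=\Gamma(\mathcal P,\mathcal W_m)$ where $\mathcal P=\{A\in\mathbb N^m: a^i\ne a^j\text{ for } i<j\}$ and $\mathcal W_m$ is the set of vectors in $\mathbb N^m$ with exactly one nonzero component. The disjunctive sum of subtraction games on $\mathbb N^{m^i}$ is the subtraction game on the product of position sets (in $\mathbb N^{m^1+\cdots+m^k}$) whose moves subtract an allowed vector of one summand in its block of coordinates. $\operatorname{ord}_p$ is the $p$-adic order ($\infty$ at $0$), $\operatorname{mord}_p(C)=\min_i\operatorname{ord}_p(c^i)$,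 $\mathcal S_m^p=\{C\in\mathbb N^m\setminus\{0\}:\operatorname{ord}_p(\sum_ic^i)=\operatorname{mord}_p(C)\}$. A $p$-saturation of $\Gamma(\mathcal P,\mathcal C)$ is a subtraction game $\Gamma(\mathcal P,\tilde{\mathcal C})$ with the same Sprague-Grundy function as $\Gamma(\mathcal P,\mathcal C\cup\mathcal S_m^p)$. $\Gamma(\mathcal P,\mathcal C)$ with $\mathcal C\subseteq\mathcal S_m^p$ is $p$-calm if for every position $A$ and proper descendant $B$, $\mathrm{sg}_{\tilde\Gamma}(A)-\mathrm{sg}_{\tilde\Gamma}(B)\equiv\sum_i(a^i-b^i)\pmod{p^{\operatorname{mord}_p(A-B)+1}}$ for a $p$-saturation $\tilde\Gamma$. $\oplus_p$ is base-$p$ addition without carrying. For a position $A$ of $\mathrm{Welter}_m$, \[ \psi_p(A)=a^1\oplus_p\cdots\oplus_p a^m\oplus_p\Bigl(\bigoplus_{i<j}{}_{p}\;\bigl(p^{\operatorname{ord}_p(a^i-a^j)+1}-1\bigr)\Bigr), \] where the big sum is the $p$-Nim-sum over all pairs $i<j$. It is known (from earlier work) that $\psi_p$ is the Sprague-Grundy function of any $p$-saturation of $\mathrm{Welter}_m$. -}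

module Defs where

open import Level using (0ℓ)
open import Data.Nat using (ℕ; zero; suc; _+_; _*_; _∸_; _^_; _≤_; _<_; ∣_-_∣)
open import Data.Nat.DivMod using (_/_; _%_)
open import Data.Nat.Divisibility using (_∣_)
open import Data.Bool using (Bool; true; false; if_then_else_)
open import Data.Nat using (_≡ᵇ_)
open import Data.Fin as Fin using (Fin)
open import Data.Vec using (Vec; []; _∷_; lookup; zipWith; replicate; toList; _++_)
import Data.Vec as Vec
open import Data.List as List using (List; []; _∷_; foldr; map)
open import Data.Nat.ListAction using () renaming (sum to sumL)
open import Data.Unit using (⊤; tt)
open import Data.Empty using (⊥)
open import Data.Product using (Σ; Σ-syntax; _×_; _,_)
open import Data.Sum using (_⊎_)
open import Relation.Nullary using (¬_)
open import Relation.Binary.PropositionalEquality using (_≡_; _≢_)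
open import Relation.Binary.Construct.Closure.ReflexiveTransitive using (Star)
import Data.Integer as ℤ
import Data.Integer.Divisibility as ℤd

Pred : ℕ → Set₁
Pred m = Vec ℕ m → Set

_∪_ : ∀ {m} → Pred m → Pred m → Pred m
(C ∪ D) X = C X ⊎ D X

MovesNonzero : ∀ {m} → Pred m → Set
MovesNonzero {m} C = ∀ D → C D → D ≢ replicate m 0

Edge : ∀ {m} → Pred m → Pred m → Vec ℕ m → Vec ℕ m → Set
Edge P C A B = P A × P B × Σ[ D ∈ Vec ℕ _ ] (C D × A ≡ zipWith _+_ B D)

-- g is the Sprague-Grundy function of Γ(P,C) (on positions P):
-- g(A) = mex { g(B) : (A,B) an edge }, unfolded.
IsSG : ∀ {m} → Pred m → Pred m → (Vec ℕ m → ℕ) → Set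
IsSG P C g = ∀ A → P A →
  (∀ B → Edge P C A B → g B ≢ g A) ×
  (∀ n → n < g A → Σ[ B ∈ Vec ℕ _ ] (Edge P C A B × g B ≡ n))

OrdIs : ℕ → ℕ → ℕ → Set
OrdIs p x k = (p ^ k ∣ x) × ¬ (p ^ suc k ∣ x)

-- mord_p(C) = min_i ord_p(c^i) = k  (ord_p 0 = ∞; forces C ≠ 0)
MOrdIs : ∀ {m} → ℕ → Vec ℕ m → ℕ → Set
MOrdIs p C k = (∀ i → p ^ k ∣ lookup C i) × Σ[ i ∈ Fin _ ] ¬ (p ^ suc k ∣ lookup C i)

S : (p m : ℕ) → Pred m
S p m C = Σ[ k ∈ ℕ ] (MOrdIs p C k × OrdIs p (Vec.sum C) k)

IsPSaturation : ∀ {m} → ℕ → Pred m → Pred m → Pred m → Set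
IsPSaturation {m} p P C C̃ =
  MovesNonzero C̃ ×
  (∀ g → (IsSG P C̃ g → IsSG P (C ∪ S p m) g) × (IsSG P (C ∪ S p m) g → IsSG P C̃ g))

IsPCalm : ∀ {m} → ℕ → Pred m → Pred m → Set₁
IsPCalm {m} p P C =
  (∀ D → C D → S p m D) ×
  (∀ C̃ → IsPSaturation p P C C̃ → ∀ g → IsSG P C̃ g →
    ∀ A B → P A → Star (Edge P C) A B → A ≢ B →
    ∀ k → MOrdIs p (zipWith _∸_ A B) k →
    (ℤ.+ (p ^ suc k)) ℤd.∣
      ((ℤ.+ g A ℤ.- ℤ.+ g B) ℤ.- (ℤ.+ Vec.sum A ℤ.- ℤ.+ Vec.sum B)))

WelterPos : (m : ℕ) → Pred m
WelterPos m A = ∀ (i j : Fin m) → i Fin.< j → lookup A i ≢ lookup A j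

WelterMove : (m : ℕ) → Pred m
WelterMove m D = Σ[ i ∈ Fin m ] (lookup D i ≢ 0 × (∀ j → j ≢ i → lookup D j ≡ 0))

-- p-Nim-sum (digitwise addition mod p, no carry); meaningful for p ≥ 2.
-- The fuel x + y is sufficient for p ≥ 2.

nimAux : ℕ → ℕ → ℕ → ℕ → ℕ
nimAux zero p x y = 0
nimAux (suc p') zero x y = 0
nimAux (suc p') (suc f) x y =
  ((x % suc p' + y % suc p') % suc p') + suc p' * nimAux (suc p') f (x / suc p') (y / suc p')

_⊕[_]_ : ℕ → ℕ → ℕ → ℕ
x ⊕[ p ] y = nimAux p (x + y) x y

nimSum : ℕ → List ℕ → ℕ
nimSum p = foldr (λ x y → x ⊕[ p ] y) 0

-- p-adic order as a function on positive naturals (fuel n suffices).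
ordAux : ℕ → ℕ → ℕ → ℕ
ordAux zero f n = 0
ordAux (suc p') zero n = 0
ordAux (suc p') (suc f) n =
  if n ≡ᵇ 0 then 0
  else if (n % suc p') ≡ᵇ 0 then suc (ordAux (suc p') f (n / suc p')) else 0

ord : ℕ → ℕ → ℕ
ord p n = ordAux p n n

pairTerms : ℕ → List ℕ → List ℕ
pairTerms p [] = []
pairTerms p (a ∷ as) = map (λ b → p ^ suc (ord p ∣ a - b ∣) ∸ 1) as List.++ pairTerms p as

ψ : ∀ {m} → ℕ → Vec ℕ m → ℕ
ψ p A = nimSum p (toList A List.++ pairTerms p (toList A))

Blocks : List ℕ → Set
Blocks [] = ⊤
Blocks (m ∷ ms) = Vec ℕ m × Blocks ms

flatten : ∀ ms → Blocks ms → Vec ℕ (sumL ms)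
flatten [] tt = []
flatten (m ∷ ms) (d , ds) = d ++ flatten ms ds

AllBlocks : (P : (m : ℕ) → Pred m) → ∀ ms → Blocks ms → Set
AllBlocks P [] tt = ⊤
AllBlocks P (m ∷ ms) (d , ds) = P m d × AllBlocks P ms ds

OneBlock : (C : (m : ℕ) → Pred m) → ∀ ms → Blocks ms → Set
OneBlock C [] tt = ⊥
OneBlock C (m ∷ ms) (d , ds) =
  (C m d × flatten ms ds ≡ replicate _ 0) ⊎ (d ≡ replicate m 0 × OneBlock C ms ds)

SumPos : (P : (m : ℕ) → Pred m) → (ms : List ℕ) → Pred (sumL ms)
SumPos P ms X = Σ[ bs ∈ Blocks ms ] (flatten ms bs ≡ X × AllBlocks P ms bs)

SumMoves : (C : (m : ℕ) → Pred m) → (ms : List ℕ) → Pred (sumL ms)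
SumMoves C ms X = Σ[ bs ∈ Blocks ms ] (flatten ms bs ≡ X × OneBlock C ms bs)

ψBlocks : ℕ → ∀ ms → Blocks ms → List ℕ
ψBlocks p [] tt = []
ψBlocks p (m ∷ ms) (d , ds) = ψ p d ∷ ψBlocks p ms ds

{-# OPTIONS --safe #-}
module Submission where

-- Read in base p, an entry a of the c-th component is a token of colour c and value a, and splitting each
-- colour by the residues mod p moves on to the next digit.  Digit L of ψ depends only on
--   (sum of values) − (number of monochromatic pairs)
-- after L splittings, mod p; without "mod p" this is the size of a p-quotient, and its part not coming from
-- the next digit is an energy, the size of the p-cores.  Calmness is immediate from this description, and it
-- shows that a move in S changes ψ.
-- To reach n < ψ(A) by a move in S one may pass to the first digit where n and ψ(A) differ; there every
-- descent to a position of value n is a move in S, so it is enough to find any B ≤ A with ψ(B) = n.  In fact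
-- B can be found perfect: no carries occur, i.e. the size itself is n.  This goes by induction on digits.
-- Once the quotients are perfect, the cores are shrunk by swapping two adjacent runners with d more tokens on
-- the higher one.  The swap is realised by moving exactly d tokens, because the energies of perfect forests
-- are less than p and therefore the runners of two nodes nearly agree.  A borrow is a single such move.

open import Defs
open import Data.Nat as ℕ using (ℕ; zero; suc; pred; _+_; _*_; _∸_; _^_; _≤_; _<_; z≤n; s≤s; NonZero; ∣_-_∣)
import Data.Nat.Properties as ℕₚ
open import Data.Nat.DivMod hiding (result)
open import Data.Nat.Divisibility as Div using (_∣_; _∣?_; divides)
open import Data.Nat.ListAction using (sum)
open import Data.Nat.ListAction.Properties using (sum-++)
import Data.Nat.Tactic.RingSolver as ℕR
open import Data.Fin as Fin using (Fin; zero; suc)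
import Data.Integer as ℤ
import Data.Integer.Divisibility as ℤd
import Data.Integer.Properties as ℤₚ
import Data.Integer.Tactic.RingSolver as ℤR
open import Data.List as List using (List; []; _∷_; length)
import Data.List.Properties as Listₚ
open import Data.Product using (∃; ∃-syntax; _×_; _,_; proj₁; proj₂)
open import Data.Sum using (_⊎_; inj₁; inj₂; [_,_]′)
open import Data.Unit using (tt)
open import Data.Vec as Vec using (Vec; []; _∷_; lookup; zipWith; replicate)
import Data.Vec.Properties as Vecₚ
open import Data.Vec.Relation.Unary.AllPairs using ([]; _∷_)
import Data.Vec.Relation.Unary.AllPairs.Properties as AllPairsₚ
open import Data.Vec.Relation.Unary.Unique.Propositional using (Unique)
import Data.Vec.Relation.Unary.Unique.Propositional.Properties as Uniqueₚ
open import Function using (_∘_; id)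
open import Relation.Binary.Construct.Closure.ReflexiveTransitive using (Star; ε; _◅_)
open import Relation.Binary.Definitions using (tri<; tri≈; tri>)
open import Relation.Binary.PropositionalEquality
open import Relation.Nullary using (¬_; Dec; yes; no; contradiction)

-- Sums and core energies

-- Congruences fix the energies only modulo `p`. Perfection makes the energies of a level add up to
-- a digit, so they stay below `p`, and this rigidity is what lets a swap move tokens in one
-- direction only. The harder obstacle is a borrow. Where `n` ends in zeros the energies vanish and
-- no core can shrink: the quotient has to lose one box while the core energy rises from 0 to
-- `p - 1`. Zero energy makes the runners of a colour equally full, up to a difference of one that
-- padding removes, so they are `p` colours with equal counts on the next level. While their own
-- runners agree too, the comparison goes down one digit; along a tuple with energy at the first
-- nonzero digit it must fail there, since `p` equal energies with sum below `p` vanish. In a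
-- perfect forest, two equally full colours with different runners admit the move of one token,
-- which lowers the size by one there and on every level above. The step from runner `p - 1` to
-- runner 0 becomes an ordinary one because a beta-set may be shifted by one and given a new 0
-- without a change of its partition.

module Energy where

  open ℤ using (ℤ; +_; -[1+_])

  ∑ : ℕ → (ℕ → ℕ) → ℕ
  ∑ zero f = 0
  ∑ (suc n) f = ∑ n f + f n

  ∑-cong : ∀ n {f g : ℕ → ℕ} → (∀ i → i < n → f i ≡ g i) → ∑ n f ≡ ∑ n g
  ∑-cong zero eq = refl
  ∑-cong (suc n) eq = cong₂ _+_ (∑-cong n (λ i i<n → eq i (ℕₚ.m<n⇒m<1+n i<n))) (eq n ℕₚ.≤-refl)

  ∑-+ : ∀ n (f g : ℕ → ℕ) → ∑ n (λ i → f i + g i) ≡ ∑ n f + ∑ n g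
  ∑-+ zero f g = refl
  ∑-+ (suc n) f g = trans (cong (_+ (f n + g n)) (∑-+ n f g)) (interchange (∑ n f) (∑ n g) (f n) (g n))
    where
    interchange : ∀ a b c d → (a + b) + (c + d) ≡ (a + c) + (b + d)
    interchange = ℕR.solve-∀

  ∑-* : ∀ n k (f : ℕ → ℕ) → ∑ n (λ i → k * f i) ≡ k * ∑ n f
  ∑-* zero k f = sym (ℕₚ.*-zeroʳ k)
  ∑-* (suc n) k f = trans (cong (_+ k * f n) (∑-* n k f)) (sym (ℕₚ.*-distribˡ-+ k (∑ n f) (f n)))

  ∑-const : ∀ n k → ∑ n (λ _ → k) ≡ n * k
  ∑-const zero k = refl
  ∑-const (suc n) k = trans (cong (_+ k) (∑-const n k)) (ℕₚ.+-comm (n * k) k)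

  ∑-mono : ∀ n {f g : ℕ → ℕ} → (∀ i → i < n → f i ≤ g i) → ∑ n f ≤ ∑ n g
  ∑-mono zero le = z≤n
  ∑-mono (suc n) le = ℕₚ.+-mono-≤ (∑-mono n (λ i i<n → le i (ℕₚ.m<n⇒m<1+n i<n))) (le n ℕₚ.≤-refl)

  ∑-split : ∀ a b (f : ℕ → ℕ) → ∑ (a + b) f ≡ ∑ a f + ∑ b (λ i → f (a + i))
  ∑-split a zero f rewrite ℕₚ.+-identityʳ a = sym (ℕₚ.+-identityʳ _)
  ∑-split a (suc b) f rewrite ℕₚ.+-suc a b | ∑-split a b f = ℕₚ.+-assoc (∑ a f) _ _

  ∑-block : ∀ Q p (f : ℕ → ℕ) → ∑ (Q * p) f ≡ ∑ Q (λ w → ∑ p (λ s → f (w * p + s)))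
  ∑-block zero p f = refl
  ∑-block (suc Q) p f = begin
    ∑ (p + Q * p) f                                ≡⟨ cong (λ k → ∑ k f) (ℕₚ.+-comm p (Q * p)) ⟩
    ∑ (Q * p + p) f                                ≡⟨ ∑-split (Q * p) p f ⟩
    ∑ (Q * p) f + ∑ p (λ s → f (Q * p + s))        ≡⟨ cong (_+ ∑ p (λ s → f (Q * p + s))) (∑-block Q p f) ⟩
    ∑ Q (λ w → ∑ p (λ s → f (w * p + s))) + ∑ p (λ s → f (Q * p + s)) ∎
    where open ≡-Reasoning

  ∑-swap : ∀ n k (f : ℕ → ℕ → ℕ) → ∑ n (λ i → ∑ k (f i)) ≡ ∑ k (λ j → ∑ n (λ i → f i j))
  ∑-swap zero k f = sym (trans (∑-const k 0) (ℕₚ.*-zeroʳ k))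
  ∑-swap (suc n) k f = trans (cong (_+ ∑ k (f n)) (∑-swap n k f))
                             (sym (∑-+ k (λ j → ∑ n (λ i → f i j)) (f n)))

  -- Each side carries the other function's value at `x`, which expresses the change of one term
  -- without truncated subtraction.
  ∑-update : ∀ n x {f g : ℕ → ℕ} → x < n → (∀ z → z ≢ x → f z ≡ g z) → ∑ n f + g x ≡ ∑ n g + f x
  ∑-update (suc n) x {f} {g} x<1+n off with x ℕ.≟ n
  ... | yes refl = trans (cong (λ k → k + f n + g n) (∑-cong n λ i i<n → off i (ℕₚ.<⇒≢ i<n)))
                         (swap (∑ n g) (f n) (g n))
    where
    swap : ∀ a b c → a + b + c ≡ a + c + b
    swap = ℕR.solve-∀
  ... | no x≢n = begin
    ∑ n f + f n + g x  ≡⟨ swap (∑ n f) (f n) (g x) ⟩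
    ∑ n f + g x + f n  ≡⟨ cong₂ _+_ (∑-update n x (ℕₚ.≤∧≢⇒< (ℕₚ.≤-pred x<1+n) x≢n) off) (off n (x≢n ∘ sym)) ⟩
    ∑ n g + f x + g n  ≡⟨ swap (∑ n g) (f x) (g n) ⟩
    ∑ n g + g n + f x  ∎
    where
    open ≡-Reasoning
    swap : ∀ a b c → a + b + c ≡ a + c + b
    swap = ℕR.solve-∀

  term≤∑ : ∀ n x (f : ℕ → ℕ) → x < n → f x ≤ ∑ n f
  term≤∑ (suc n) x f x<1+n with x ℕ.≟ n
  ... | yes refl = ℕₚ.m≤n+m (f n) (∑ n f)
  ... | no x≢n = ℕₚ.≤-trans (term≤∑ n x f (ℕₚ.≤∧≢⇒< (ℕₚ.≤-pred x<1+n) x≢n)) (ℕₚ.m≤m+n _ _)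

  two-terms≤∑ : ∀ n x y (f : ℕ → ℕ) → x < n → y < n → x ≢ y → f x + f y ≤ ∑ n f
  two-terms≤∑ (suc n) x y f x< y< x≢y with x ℕ.≟ n | y ℕ.≟ n
  ... | yes refl | yes refl = contradiction refl x≢y
  ... | yes refl | no y≢n = subst (_≤ ∑ n f + f n) (ℕₚ.+-comm (f y) (f n))
    (ℕₚ.+-monoˡ-≤ (f n) (term≤∑ n y f (ℕₚ.≤∧≢⇒< (ℕₚ.≤-pred y<) y≢n)))
  ... | no x≢n | yes refl = ℕₚ.+-monoˡ-≤ (f n) (term≤∑ n x f (ℕₚ.≤∧≢⇒< (ℕₚ.≤-pred x<) x≢n))
  ... | no x≢n | no y≢n = ℕₚ.≤-trans
    (two-terms≤∑ n x y f (ℕₚ.≤∧≢⇒< (ℕₚ.≤-pred x<) x≢n) (ℕₚ.≤∧≢⇒< (ℕₚ.≤-pred y<) y≢n) x≢y) (ℕₚ.m≤m+n _ _)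

  ∑≢0⇒term≢0 : ∀ n (f : ℕ → ℕ) → ∑ n f ≢ 0 → ∃[ i ] (i < n × f i ≢ 0)
  ∑≢0⇒term≢0 zero f ≢0 = contradiction refl ≢0
  ∑≢0⇒term≢0 (suc n) f ≢0 with f n ℕ.≟ 0
  ... | no fn≢0 = n , ℕₚ.≤-refl , fn≢0
  ... | yes fn≡0 with ∑≢0⇒term≢0 n f (λ eq → ≢0 (cong₂ _+_ eq fn≡0))
  ...   | i , i<n , fi≢0 = i , ℕₚ.m<n⇒m<1+n i<n , fi≢0

  search< : ∀ n (f g : ℕ → ℕ) → (∃[ i ] (i < n × f i < g i)) ⊎ (∀ i → i < n → g i ≤ f i)
  search< zero f g = inj₂ λ _ ()
  search< (suc n) f g with f n ℕ.<? g n
  ... | yes lt = inj₁ (n , ℕₚ.≤-refl , lt)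
  ... | no ¬lt with search< n f g
  ...   | inj₁ (i , i<n , lt) = inj₁ (i , ℕₚ.m<n⇒m<1+n i<n , lt)
  ...   | inj₂ le = inj₂ go
    where
    go : ∀ i → i < suc n → g i ≤ f i
    go i i<1+n with i ℕ.≟ n
    ... | yes refl = ℕₚ.≮⇒≥ ¬lt
    ... | no i≢n = le i (ℕₚ.≤∧≢⇒< (ℕₚ.≤-pred i<1+n) i≢n)

  ∑-strict : ∀ n {f g : ℕ → ℕ} j → j < n → (∀ i → i < n → f i ≤ g i) → f j < g j → ∑ n f < ∑ n g
  ∑-strict (suc n) {f} {g} j j< le lt with j ℕ.≟ n
  ... | yes refl = ℕₚ.+-mono-≤-< (∑-mono n (λ i i<n → le i (ℕₚ.m<n⇒m<1+n i<n))) lt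
  ... | no j≢n = ℕₚ.+-mono-<-≤
    (∑-strict n j (ℕₚ.≤∧≢⇒< (ℕₚ.≤-pred j<) j≢n) (λ i i<n → le i (ℕₚ.m<n⇒m<1+n i<n)) lt) (le n ℕₚ.≤-refl)

  ∑ᶻ : ℕ → (ℕ → ℤ) → ℤ
  ∑ᶻ zero f = + 0
  ∑ᶻ (suc n) f = ∑ᶻ n f ℤ.+ f n

  ∑ᶻ-pos : ∀ n (f : ℕ → ℕ) → ∑ᶻ n (λ i → + f i) ≡ + ∑ n f
  ∑ᶻ-pos zero f = refl
  ∑ᶻ-pos (suc n) f = cong (ℤ._+ + f n) (∑ᶻ-pos n f)

  ∑ᶻ-cong : ∀ n {f g : ℕ → ℤ} → (∀ i → i < n → f i ≡ g i) → ∑ᶻ n f ≡ ∑ᶻ n g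
  ∑ᶻ-cong zero eq = refl
  ∑ᶻ-cong (suc n) eq = cong₂ ℤ._+_ (∑ᶻ-cong n (λ i i<n → eq i (ℕₚ.m<n⇒m<1+n i<n))) (eq n ℕₚ.≤-refl)

  ∑ᶻ-update : ∀ n x {f g : ℕ → ℤ} → x < n → (∀ z → z ≢ x → f z ≡ g z) → ∑ᶻ n f ≡ ∑ᶻ n g ℤ.+ (f x ℤ.- g x)
  ∑ᶻ-update (suc n) x {f} {g} x<1+n off with x ℕ.≟ n
  ... | yes refl = trans (cong (ℤ._+ f n) (∑ᶻ-cong n λ i i<n → off i (ℕₚ.<⇒≢ i<n)))
                         (insert (∑ᶻ n g) (f n) (g n))
    where
    insert : ∀ a b c → a ℤ.+ b ≡ a ℤ.+ c ℤ.+ (b ℤ.- c)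
    insert = ℤR.solve-∀
  ... | no x≢n = trans (cong₂ ℤ._+_ (∑ᶻ-update n x (ℕₚ.≤∧≢⇒< (ℕₚ.≤-pred x<1+n) x≢n) off) (off n (x≢n ∘ sym)))
                       (swap (∑ᶻ n g) (f x ℤ.- g x) (g n))
    where
    swap : ∀ a b c → a ℤ.+ b ℤ.+ c ≡ a ℤ.+ c ℤ.+ b
    swap = ℤR.solve-∀

  -- Triangular numbers and the size of a core

  tri : ℕ → ℕ
  tri zero = 0
  tri (suc n) = suc n + tri n

  -- This is z(z+1)/2 for negative z as well. In particular it vanishes at -1 as well as at 0: a
  -- runner may hold one token less than a lower runner at no cost.
  T : ℤ → ℕ
  T (+ n) = tri n
  T -[1+ n ] = tri n

  2tri : ∀ n → 2 * tri n ≡ n * suc n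
  2tri zero = refl
  2tri (suc n) = trans (ℕₚ.*-distribˡ-+ 2 (suc n) (tri n)) (trans (cong (λ k → 2 * suc n + k) (2tri n)) (lem n))
    where
    lem : ∀ n → 2 * suc n + n * suc n ≡ suc n * suc (suc n)
    lem = ℕR.solve-∀

  2T : ∀ z → + 2 ℤ.* + T z ≡ z ℤ.* (z ℤ.+ + 1)
  2T (+ n) = begin
    + 2 ℤ.* + tri n       ≡⟨ ℤₚ.pos-* 2 (tri n) ⟨
    + (2 * tri n)         ≡⟨ cong +_ (2tri n) ⟩
    + (n * suc n)         ≡⟨ cong (λ k → + (n * k)) (ℕₚ.+-comm 1 n) ⟩
    + (n * (n + 1))       ≡⟨ ℤₚ.pos-* n (n + 1) ⟩
    + n ℤ.* (+ n ℤ.+ + 1) ∎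
    where open ≡-Reasoning
  2T -[1+ n ] = begin
    + 2 ℤ.* + tri n       ≡⟨ ℤₚ.pos-* 2 (tri n) ⟨
    + (2 * tri n)         ≡⟨ cong +_ (2tri n) ⟩
    + (n * suc n)         ≡⟨ ℤₚ.pos-* n (suc n) ⟩
    + n ℤ.* + suc n       ≡⟨ cong (+ n ℤ.*_) (ℤₚ.pos-+ 1 n) ⟩
    + n ℤ.* (+ 1 ℤ.+ + n) ≡⟨ lem (+ n) ⟩
    ℤ.- (+ 1 ℤ.+ + n) ℤ.* (ℤ.- (+ 1 ℤ.+ + n) ℤ.+ + 1)  ≡⟨⟩
    -[1+ n ] ℤ.* (-[1+ n ] ℤ.+ + 1) ∎
    where
    open ≡-Reasoning
    lem : ∀ k → k ℤ.* (+ 1 ℤ.+ k) ≡ ℤ.- (+ 1 ℤ.+ k) ℤ.* (ℤ.- (+ 1 ℤ.+ k) ℤ.+ + 1)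
    lem = ℤR.solve-∀

  -- For counts `m s` of beads pushed down on the runners of an abacus this is the size of the core.
  -- Boxes correspond to a bead and a lower vacant position, and `T (m s - m r)` counts those
  -- between the runners `r < s`.
  energy : ℕ → (ℕ → ℤ) → ℕ
  energy n m = ∑ n λ s → ∑ s λ r → T (m s ℤ.- m r)

  private
    A B C : ℕ → (ℕ → ℤ) → ℤ
    A n m = ∑ᶻ n m
    B n m = ∑ᶻ n (λ s → m s ℤ.* m s)
    C n m = ∑ᶻ n (λ s → + s ℤ.* m s)

    row : ∀ n z m → + 2 ℤ.* + ∑ n (λ r → T (z ℤ.- m r)) ≡
          + n ℤ.* (z ℤ.* z) ℤ.- + 2 ℤ.* z ℤ.* A n m ℤ.+ B n m ℤ.+ + n ℤ.* z ℤ.- A n m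
    row zero z m = lem z
      where
      lem : ∀ z → + 0 ≡ + 0 ℤ.* (z ℤ.* z) ℤ.- + 2 ℤ.* z ℤ.* + 0 ℤ.+ + 0 ℤ.+ + 0 ℤ.* z ℤ.- + 0
      lem = ℤR.solve-∀
    row (suc n) z m = begin
      + 2 ℤ.* (+ R ℤ.+ + T (z ℤ.- m n))          ≡⟨ ℤₚ.*-distribˡ-+ (+ 2) (+ R) _ ⟩
      + 2 ℤ.* + R ℤ.+ + 2 ℤ.* + T (z ℤ.- m n)    ≡⟨ cong₂ ℤ._+_ (row n z m) (2T (z ℤ.- m n)) ⟩
      _                                          ≡⟨ lem (+ n) z (m n) (A n m) (B n m) ⟩
      _                                          ∎
      where
      open ≡-Reasoning
      R = ∑ n (λ r → T (z ℤ.- m r))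
      lem : ∀ n z x a b →
        (n ℤ.* (z ℤ.* z) ℤ.- + 2 ℤ.* z ℤ.* a ℤ.+ b ℤ.+ n ℤ.* z ℤ.- a) ℤ.+ (z ℤ.- x) ℤ.* (z ℤ.- x ℤ.+ + 1) ≡
        (+ 1 ℤ.+ n) ℤ.* (z ℤ.* z) ℤ.- + 2 ℤ.* z ℤ.* (a ℤ.+ x) ℤ.+ (b ℤ.+ x ℤ.* x) ℤ.+ (+ 1 ℤ.+ n) ℤ.* z ℤ.- (a ℤ.+ x)
      lem = ℤR.solve-∀

  -- Expanding the squares leaves only the sums of `m s`, of its square and of `s * m s`. Sums of
  -- squared counts are what counting pairs of tokens produces, so this form makes energies
  -- comparable with `pairs`.
  energy-quadratic : ∀ n m → + 2 ℤ.* + energy n m ≡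
    + n ℤ.* B n m ℤ.+ A n m ℤ.+ + 2 ℤ.* C n m ℤ.- A n m ℤ.* A n m ℤ.- + n ℤ.* A n m
  energy-quadratic zero m = refl
  energy-quadratic (suc n) m = begin
    + 2 ℤ.* (+ energy n m ℤ.+ + R)        ≡⟨ ℤₚ.*-distribˡ-+ (+ 2) (+ energy n m) _ ⟩
    + 2 ℤ.* + energy n m ℤ.+ + 2 ℤ.* + R  ≡⟨ cong₂ ℤ._+_ (energy-quadratic n m) (row n (m n) m) ⟩
    _                                     ≡⟨ lem (+ n) (m n) (A n m) (B n m) (C n m) ⟩
    _                                     ∎
    where
    open ≡-Reasoning
    R = ∑ n (λ r → T (m n ℤ.- m r))
    lem : ∀ n x a b c →
      (n ℤ.* b ℤ.+ a ℤ.+ + 2 ℤ.* c ℤ.- a ℤ.* a ℤ.- n ℤ.* a) ℤ.+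
      (n ℤ.* (x ℤ.* x) ℤ.- + 2 ℤ.* x ℤ.* a ℤ.+ b ℤ.+ n ℤ.* x ℤ.- a) ≡
      (+ 1 ℤ.+ n) ℤ.* (b ℤ.+ x ℤ.* x) ℤ.+ (a ℤ.+ x) ℤ.+ + 2 ℤ.* (c ℤ.+ n ℤ.* x) ℤ.-
        (a ℤ.+ x) ℤ.* (a ℤ.+ x) ℤ.- (+ 1 ℤ.+ n) ℤ.* (a ℤ.+ x)
    lem = ℤR.solve-∀


  ∑-update₂ : ∀ n x y {f g : ℕ → ℕ} → x < n → y < n → x ≢ y → (∀ z → z ≢ x → z ≢ y → f z ≡ g z) →
    ∑ n f + (g x + g y) ≡ ∑ n g + (f x + f y)
  ∑-update₂ n x y {f} {g} x<n y<n x≢y off = begin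
    ∑ n f + (g x + g y)  ≡⟨ ℕₚ.+-assoc (∑ n f) _ _ ⟨
    ∑ n f + g x + g y    ≡⟨ cong (λ k → ∑ n f + k + g y) h-x ⟨
    ∑ n f + h x + g y    ≡⟨ cong (_+ g y) (∑-update n x x<n f≗h) ⟩
    ∑ n h + f x + g y    ≡⟨ swap (∑ n h) (f x) (g y) ⟩
    ∑ n h + g y + f x    ≡⟨ cong (_+ f x) (∑-update n y y<n h≗g) ⟩
    ∑ n g + h y + f x    ≡⟨ cong (λ k → ∑ n g + k + f x) (f≗h y (x≢y ∘ sym)) ⟨
    ∑ n g + f y + f x    ≡⟨ reorder (∑ n g) (f x) (f y) ⟩
    ∑ n g + (f x + f y)  ∎
    where
    open ≡-Reasoning
    swap : ∀ a b c → a + b + c ≡ a + c + b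
    swap = ℕR.solve-∀
    reorder : ∀ a b c → a + c + b ≡ a + (b + c)
    reorder = ℕR.solve-∀
    h : ℕ → ℕ
    h z with z ℕ.≟ x
    ... | yes _ = g z
    ... | no _ = f z
    h-x : h x ≡ g x
    h-x with x ℕ.≟ x
    ... | yes _ = refl
    ... | no x≢x = contradiction refl x≢x
    f≗h : ∀ z → z ≢ x → f z ≡ h z
    f≗h z z≢x with z ℕ.≟ x
    ... | yes z≡x = contradiction z≡x z≢x
    ... | no _ = refl
    h≗g : ∀ z → z ≢ y → h z ≡ g z
    h≗g z z≢y with z ℕ.≟ x
    ... | yes _ = refl
    ... | no z≢x = off z z≢x z≢y

  -- `f` is set to 0 at `x n` before the induction is used; by distinctness this does not affect the
  -- other chosen terms.
  ∑-injective : ∀ n Q (x f : ℕ → ℕ) → (∀ s → s < n → x s < Q) → (∀ r s → r < s → s < n → x r ≢ x s) →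
    ∑ n (f ∘ x) ≤ ∑ Q f
  ∑-injective zero Q x f _ _ = z≤n
  ∑-injective (suc n) Q x f x<Q distinct = begin
    ∑ n (f ∘ x) + f (x n)   ≡⟨ cong (_+ f (x n)) (∑-cong n λ s s<n → sym (off (x s) (distinct s n s<n ℕₚ.≤-refl))) ⟩
    ∑ n (g ∘ x) + f (x n)   ≤⟨ ℕₚ.+-monoˡ-≤ (f (x n)) (∑-injective n Q x g (λ s s<n → x<Q s (ℕₚ.m<n⇒m<1+n s<n))
                                 (λ r s r<s s<n → distinct r s r<s (ℕₚ.m<n⇒m<1+n s<n))) ⟩
    ∑ Q g + f (x n)         ≡⟨ ∑-update Q (x n) (x<Q n ℕₚ.≤-refl) (λ z → off z) ⟩
    ∑ Q f + g (x n)         ≡⟨ cong (λ k → ∑ Q f + k) at ⟩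
    ∑ Q f + 0               ≡⟨ ℕₚ.+-identityʳ (∑ Q f) ⟩
    ∑ Q f                   ∎
    where
    open ℕₚ.≤-Reasoning
    g : ℕ → ℕ
    g z with z ℕ.≟ x n
    ... | yes _ = 0
    ... | no _ = f z
    at : g (x n) ≡ 0
    at with x n ℕ.≟ x n
    ... | yes _ = refl
    ... | no xn≢xn = contradiction refl xn≢xn
    off : ∀ z → z ≢ x n → g z ≡ f z
    off z z≢xn with z ℕ.≟ x n
    ... | yes z≡xn = contradiction z≡xn z≢xn
    ... | no _ = refl

  bump : ℕ → ℤ → (ℕ → ℤ) → ℕ → ℤ
  bump r e m z with z ℕ.≟ r
  ... | yes _ = m z ℤ.+ e
  ... | no _ = m z

  bump-at : ∀ r e m → bump r e m r ≡ m r ℤ.+ e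
  bump-at r e m with r ℕ.≟ r
  ... | yes _ = refl
  ... | no r≢r = contradiction refl r≢r

  bump-off : ∀ r e m z → z ≢ r → bump r e m z ≡ m z
  bump-off r e m z z≢r with z ℕ.≟ r
  ... | yes z≡r = contradiction z≡r z≢r
  ... | no _ = refl

  -- In `energy-quadratic` the sum of the counts stays, the sum of squares grows by 2(m s - m r +
  -- 1), and the weighted sum grows by s - r.
  energy-transfer : ∀ p m r s → r ≢ s → r < p → s < p →
    + energy p (bump s (+ 1) (bump r (ℤ.- + 1) m)) ≡
    + energy p m ℤ.+ (+ s ℤ.- + r) ℤ.+ + p ℤ.* (m s ℤ.- m r ℤ.+ + 1)
  energy-transfer p m r s r≢s r<p s<p = ℤₚ.*-cancelˡ-≡ (+ 2) _ _ (begin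
    + 2 ℤ.* + energy p m₂
      ≡⟨ energy-quadratic p m₂ ⟩
    quad (∑ᶻ p m₂) (∑ᶻ p (λ z → m₂ z ℤ.* m₂ z)) (∑ᶻ p (λ z → + z ℤ.* m₂ z))
      ≡⟨ quad-cong linear squares weighted ⟩
    quad a (b ℤ.+ (x₁ ℤ.* x₁ ℤ.- x ℤ.* x) ℤ.+ (y₁ ℤ.* y₁ ℤ.- y ℤ.* y))
           (c ℤ.+ (+ r ℤ.* x₁ ℤ.- + r ℤ.* x) ℤ.+ (+ s ℤ.* y₁ ℤ.- + s ℤ.* y))
      ≡⟨ final (+ p) a b c (+ r) (+ s) x y ⟩
    quad a b c ℤ.+ + 2 ℤ.* (+ s ℤ.- + r ℤ.+ + p ℤ.* (y ℤ.- x ℤ.+ + 1))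
      ≡⟨ cong (ℤ._+ + 2 ℤ.* (+ s ℤ.- + r ℤ.+ + p ℤ.* (y ℤ.- x ℤ.+ + 1))) (energy-quadratic p m) ⟨
    + 2 ℤ.* + energy p m ℤ.+ + 2 ℤ.* (+ s ℤ.- + r ℤ.+ + p ℤ.* (y ℤ.- x ℤ.+ + 1))
      ≡⟨ assemble (+ energy p m) (+ s ℤ.- + r) (+ p ℤ.* (y ℤ.- x ℤ.+ + 1)) ⟩
    _ ∎)
    where
    open ≡-Reasoning
    m₁ = bump r (ℤ.- + 1) m
    m₂ = bump s (+ 1) m₁
    a = ∑ᶻ p m
    b = ∑ᶻ p (λ z → m z ℤ.* m z)
    c = ∑ᶻ p (λ z → + z ℤ.* m z)
    x = m r
    y = m s
    x₁ = x ℤ.+ ℤ.- + 1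
    y₁ = y ℤ.+ + 1
    quad : ℤ → ℤ → ℤ → ℤ
    quad a b c = + p ℤ.* b ℤ.+ a ℤ.+ + 2 ℤ.* c ℤ.- a ℤ.* a ℤ.- + p ℤ.* a
    quad-cong : ∀ {a a′ b b′ c c′} → a ≡ a′ → b ≡ b′ → c ≡ c′ → quad a b c ≡ quad a′ b′ c′
    quad-cong refl refl refl = refl
    at-r : m₁ r ≡ x₁
    at-r = bump-at r _ m
    before-s : m₁ s ≡ y
    before-s = bump-off r _ m s (r≢s ∘ sym)
    at-s : m₂ s ≡ y₁
    at-s = trans (bump-at s _ m₁) (cong (ℤ._+ + 1) before-s)
    both : (F : ℕ → ℤ → ℤ) → ∑ᶻ p (λ z → F z (m₂ z)) ≡
      ∑ᶻ p (λ z → F z (m z)) ℤ.+ (F r x₁ ℤ.- F r x) ℤ.+ (F s y₁ ℤ.- F s y)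
    both F = trans
      (∑ᶻ-update p s s<p (λ z z≢s → cong (F z) (bump-off s _ m₁ z z≢s)))
      (cong₂ ℤ._+_
        (trans (∑ᶻ-update p r r<p (λ z z≢r → cong (F z) (bump-off r _ m z z≢r)))
               (cong (λ k → ∑ᶻ p (λ z → F z (m z)) ℤ.+ (F r k ℤ.- F r x)) at-r))
        (cong₂ (λ k l → F s k ℤ.- F s l) at-s before-s))
    cancel : ∀ a x y → a ℤ.+ ((x ℤ.+ ℤ.- + 1) ℤ.- x) ℤ.+ ((y ℤ.+ + 1) ℤ.- y) ≡ a
    cancel = ℤR.solve-∀
    linear : ∑ᶻ p m₂ ≡ a
    linear = trans (both (λ _ k → k)) (cancel a x y)
    squares = both (λ _ k → k ℤ.* k)
    weighted = both (λ z k → + z ℤ.* k)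
    final : ∀ p a b c r s x y →
      p ℤ.* (b ℤ.+ ((x ℤ.+ ℤ.- + 1) ℤ.* (x ℤ.+ ℤ.- + 1) ℤ.- x ℤ.* x) ℤ.+ ((y ℤ.+ + 1) ℤ.* (y ℤ.+ + 1) ℤ.- y ℤ.* y))
        ℤ.+ a ℤ.+ + 2 ℤ.* (c ℤ.+ (r ℤ.* (x ℤ.+ ℤ.- + 1) ℤ.- r ℤ.* x) ℤ.+ (s ℤ.* (y ℤ.+ + 1) ℤ.- s ℤ.* y))
        ℤ.- a ℤ.* a ℤ.- p ℤ.* a ≡
      (p ℤ.* b ℤ.+ a ℤ.+ + 2 ℤ.* c ℤ.- a ℤ.* a ℤ.- p ℤ.* a) ℤ.+ + 2 ℤ.* (s ℤ.- r ℤ.+ p ℤ.* (y ℤ.- x ℤ.+ + 1))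
    final = ℤR.solve-∀
    assemble : ∀ e u v → + 2 ℤ.* e ℤ.+ + 2 ℤ.* (u ℤ.+ v) ≡ + 2 ℤ.* (e ℤ.+ u ℤ.+ v)
    assemble = ℤR.solve-∀

  energyℕ : ℕ → (ℕ → ℕ) → ℕ
  energyℕ p m = energy p (λ s → + m s)

  -- Moving one token from `suc r` to `r` changes the energy by -1 - p d, and what remains is still
  -- nonnegative.
  energy-ascent : ∀ p m r d → suc r < p → m (suc r) ≡ m r + suc d → 1 + p * d ≤ energyℕ p m
  energy-ascent p m r d 1+r<p ascent = ℤₚ.drop‿+≤+ (ℤₚ.≤-trans (ℤₚ.i≤j+i (+ (1 + p * d)) (+ e)) (ℤₚ.≤-reflexive (begin
    + e ℤ.+ + (1 + p * d)
      ≡⟨ cong (λ k → + e ℤ.+ (+ 1 ℤ.+ k)) (ℤₚ.pos-* p d) ⟩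
    + e ℤ.+ (+ 1 ℤ.+ + p ℤ.* + d)
      ≡⟨ cong (ℤ._+ (+ 1 ℤ.+ + p ℤ.* + d)) (energy-transfer p _ (suc r) r (λ ()) 1+r<p (ℕₚ.<-trans (ℕₚ.n<1+n r) 1+r<p)) ⟩
    + energyℕ p m ℤ.+ (+ r ℤ.- + suc r) ℤ.+ + p ℤ.* (+ m r ℤ.- + m (suc r) ℤ.+ + 1) ℤ.+ (+ 1 ℤ.+ + p ℤ.* + d)
      ≡⟨ cong (λ k → + energyℕ p m ℤ.+ (+ r ℤ.- + suc r) ℤ.+ + p ℤ.* (+ m r ℤ.- + k ℤ.+ + 1) ℤ.+ (+ 1 ℤ.+ + p ℤ.* + d)) ascent ⟩
    + energyℕ p m ℤ.+ (+ r ℤ.- (+ 1 ℤ.+ + r)) ℤ.+ + p ℤ.* (+ m r ℤ.- (+ m r ℤ.+ (+ 1 ℤ.+ + d)) ℤ.+ + 1) ℤ.+ (+ 1 ℤ.+ + p ℤ.* + d)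
      ≡⟨ lem (+ energyℕ p m) (+ r) (+ m r) (+ d) (+ p) ⟩
    + energyℕ p m ∎)))
    where
    open ≡-Reasoning
    e = energy p (bump r (+ 1) (bump (suc r) (ℤ.- + 1) (λ s → + m s)))
    lem : ∀ e r x d p →
      e ℤ.+ (r ℤ.- (+ 1 ℤ.+ r)) ℤ.+ p ℤ.* (x ℤ.- (x ℤ.+ (+ 1 ℤ.+ d)) ℤ.+ + 1) ℤ.+ (+ 1 ℤ.+ p ℤ.* d) ≡ e
    lem = ℤR.solve-∀

  -- Passing one unit from r to s in α and one from s to r in β lowers the total energy by at least p.
  energy-spread : ∀ p α β r s → r < p → s < p → α s + β r + 3 ≤ α r + β s → p ≤ energyℕ p α + energyℕ p β
  energy-spread p α β r s r<p s<p spread = ℤₚ.drop‿+≤+ (ℤₚ.≤-trans (ℤ.+≤+ (ℕₚ.m≤n+m p (e + e′ + p * k))) (ℤₚ.≤-reflexive (begin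
    + (e + e′ + p * k + p)
      ≡⟨ cong (λ x → + e ℤ.+ + e′ ℤ.+ x ℤ.+ + p) (ℤₚ.pos-* p k) ⟩
    + e ℤ.+ + e′ ℤ.+ + p ℤ.* + k ℤ.+ + p
      ≡⟨ cong₂ (λ x y → x ℤ.+ y ℤ.+ + p ℤ.* + k ℤ.+ + p)
           (energy-transfer p _ r s r≢s r<p s<p) (energy-transfer p _ s r (r≢s ∘ sym) s<p r<p) ⟩
    (+ energyℕ p α ℤ.+ (+ s ℤ.- + r) ℤ.+ + p ℤ.* (+ α s ℤ.- + α r ℤ.+ + 1)) ℤ.+
    (+ energyℕ p β ℤ.+ (+ r ℤ.- + s) ℤ.+ + p ℤ.* (+ β r ℤ.- + β s ℤ.+ + 1)) ℤ.+ + p ℤ.* + k ℤ.+ + p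
      ≡⟨ regroup (+ energyℕ p α) (+ energyℕ p β) (+ r) (+ s) (+ α r) (+ α s) (+ β r) (+ β s) (+ k) (+ p) ⟩
    + energyℕ p α ℤ.+ + energyℕ p β ℤ.+ + p ℤ.* ((+ α s ℤ.+ + β r ℤ.+ + 3 ℤ.+ + k) ℤ.- (+ α r ℤ.+ + β s))
      ≡⟨ cong (λ x → + energyℕ p α ℤ.+ + energyℕ p β ℤ.+ + p ℤ.* (+ x ℤ.- (+ α r ℤ.+ + β s))) (ℕₚ.m+[n∸m]≡n spread) ⟩
    + energyℕ p α ℤ.+ + energyℕ p β ℤ.+ + p ℤ.* ((+ α r ℤ.+ + β s) ℤ.- (+ α r ℤ.+ + β s))
      ≡⟨ vanish (+ energyℕ p α ℤ.+ + energyℕ p β) (+ p) (+ α r ℤ.+ + β s) ⟩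
    + (energyℕ p α + energyℕ p β) ∎)))
    where
    open ≡-Reasoning
    k = (α r + β s) ∸ (α s + β r + 3)
    e = energy p (bump s (+ 1) (bump r (ℤ.- + 1) (λ z → + α z)))
    e′ = energy p (bump r (+ 1) (bump s (ℤ.- + 1) (λ z → + β z)))
    r≢s : r ≢ s
    r≢s refl = ℕₚ.m+1+n≰m (α r + β r) spread
    regroup : ∀ ea eb r s x x′ y y′ k p →
      (ea ℤ.+ (s ℤ.- r) ℤ.+ p ℤ.* (x′ ℤ.- x ℤ.+ + 1)) ℤ.+ (eb ℤ.+ (r ℤ.- s) ℤ.+ p ℤ.* (y ℤ.- y′ ℤ.+ + 1)) ℤ.+ p ℤ.* k ℤ.+ p ≡
      ea ℤ.+ eb ℤ.+ p ℤ.* ((x′ ℤ.+ y ℤ.+ + 3 ℤ.+ k) ℤ.- (x ℤ.+ y′))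
    regroup = ℤR.solve-∀
    vanish : ∀ e p x → e ℤ.+ p ℤ.* (x ℤ.- x) ≡ e
    vanish = ℤR.solve-∀

  energyℕ-cong : ∀ p {m m′ : ℕ → ℕ} → (∀ s → s < p → m s ≡ m′ s) → energyℕ p m ≡ energyℕ p m′
  energyℕ-cong p eq = ∑-cong p λ s s<p → ∑-cong s λ r r<s →
    cong₂ (λ x y → T (+ x ℤ.- + y)) (eq s s<p) (eq r (ℕₚ.<-trans r<s s<p))

  energyℕ-quadratic : ∀ p m →
    2 * energyℕ p m + ∑ p m * ∑ p m + p * ∑ p m ≡ p * ∑ p (λ s → m s * m s) + ∑ p m + 2 * ∑ p (λ s → s * m s)
  energyℕ-quadratic p m = ℤₚ.+-injective (begin
    + (2 * e) ℤ.+ + (a * a) ℤ.+ + (p * a)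
      ≡⟨ cong₂ ℤ._+_ (cong₂ ℤ._+_ (ℤₚ.pos-* 2 e) (ℤₚ.pos-* a a)) (ℤₚ.pos-* p a) ⟩
    + 2 ℤ.* + e ℤ.+ + a ℤ.* + a ℤ.+ + p ℤ.* + a
      ≡⟨ cong (λ x → x ℤ.+ + a ℤ.* + a ℤ.+ + p ℤ.* + a) (energy-quadratic p (λ s → + m s)) ⟩
    + p ℤ.* ∑ᶻ p (λ s → + m s ℤ.* + m s) ℤ.+ a′ ℤ.+ + 2 ℤ.* ∑ᶻ p (λ s → + s ℤ.* + m s) ℤ.- a′ ℤ.* a′ ℤ.- + p ℤ.* a′
      ℤ.+ + a ℤ.* + a ℤ.+ + p ℤ.* + a
      ≡⟨ cong (λ x → + p ℤ.* ∑ᶻ p (λ s → + m s ℤ.* + m s) ℤ.+ x ℤ.+ + 2 ℤ.* ∑ᶻ p (λ s → + s ℤ.* + m s)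
           ℤ.- x ℤ.* x ℤ.- + p ℤ.* x ℤ.+ + a ℤ.* + a ℤ.+ + p ℤ.* + a) (∑ᶻ-pos p m) ⟩
    + p ℤ.* ∑ᶻ p (λ s → + m s ℤ.* + m s) ℤ.+ + a ℤ.+ + 2 ℤ.* ∑ᶻ p (λ s → + s ℤ.* + m s) ℤ.- + a ℤ.* + a ℤ.- + p ℤ.* + a
      ℤ.+ + a ℤ.* + a ℤ.+ + p ℤ.* + a
      ≡⟨ cong₂ (λ x y → + p ℤ.* x ℤ.+ + a ℤ.+ + 2 ℤ.* y ℤ.- + a ℤ.* + a ℤ.- + p ℤ.* + a ℤ.+ + a ℤ.* + a ℤ.+ + p ℤ.* + a)
           (product-pos m m) (product-pos (λ s → s) m) ⟩
    + p ℤ.* + b ℤ.+ + a ℤ.+ + 2 ℤ.* + c ℤ.- + a ℤ.* + a ℤ.- + p ℤ.* + a ℤ.+ + a ℤ.* + a ℤ.+ + p ℤ.* + a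
      ≡⟨ lem (+ p) (+ a) (+ b) (+ c) ⟩
    + p ℤ.* + b ℤ.+ + a ℤ.+ + 2 ℤ.* + c
      ≡⟨ cong₂ (λ x y → x ℤ.+ + a ℤ.+ y) (ℤₚ.pos-* p b) (ℤₚ.pos-* 2 c) ⟨
    + (p * b + a + 2 * c) ∎)
    where
    open ≡-Reasoning
    e = energyℕ p m
    a = ∑ p m
    a′ = ∑ᶻ p (λ s → + m s)
    b = ∑ p (λ s → m s * m s)
    c = ∑ p (λ s → s * m s)
    product-pos : (f g : ℕ → ℕ) → ∑ᶻ p (λ s → + f s ℤ.* + g s) ≡ + ∑ p (λ s → f s * g s)
    product-pos f g = trans (∑ᶻ-cong p (λ s _ → sym (ℤₚ.pos-* (f s) (g s)))) (∑ᶻ-pos p (λ s → f s * g s))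
    lem : ∀ p a b c → p ℤ.* b ℤ.+ a ℤ.+ + 2 ℤ.* c ℤ.- a ℤ.* a ℤ.- p ℤ.* a ℤ.+ a ℤ.* a ℤ.+ p ℤ.* a ≡
                      p ℤ.* b ℤ.+ a ℤ.+ + 2 ℤ.* c
    lem = ℤR.solve-∀

  T[m⊖m]≡0 : ∀ k → T (+ k ℤ.- + k) ≡ 0
  T[m⊖m]≡0 k = cong T (ℤₚ.+-inverseʳ (+ k))

  T[m⊖1+m]≡0 : ∀ k → T (+ k ℤ.- + suc k) ≡ 0
  T[m⊖1+m]≡0 k = cong T (lem (+ k))
    where
    lem : ∀ x → x ℤ.- (+ 1 ℤ.+ x) ≡ ℤ.- + 1
    lem = ℤR.solve-∀

  T≡0⇒ : ∀ x y → T (+ x ℤ.- + y) ≡ 0 → y ≡ x ⊎ y ≡ suc x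
  T≡0⇒ x y T≡0 with + x ℤ.- + y in eq
  ... | + zero = inj₁ (sym (ℤₚ.+-injective (ℤₚ.i-j≡0⇒i≡j (+ x) (+ y) eq)))
  ... | -[1+ zero ] = inj₂ (ℤₚ.+-injective (trans (lem (+ x) (+ y)) (trans (cong (λ z → + x ℤ.- z) eq) (cong +_ (ℕₚ.+-comm x 1)))))
    where
    lem : ∀ x y → y ≡ x ℤ.- (x ℤ.- y)
    lem = ℤR.solve-∀
  T≡0⇒ x y () | + suc _
  T≡0⇒ x y () | -[1+ suc _ ]

  -- If neither alternative holds, the counts decrease weakly by at most one altogether, so `T` is
  -- evaluated only at 0 and -1, where it vanishes. The second alternative is an ascent across the
  -- wrap-around: a rotation of the runners puts `m (pred p) + 1` next to `m 0`.
  energy≢0⇒ : ∀ p m → energyℕ p m ≢ 0 → (∃[ r ] (suc r < p × m r < m (suc r))) ⊎ m (pred p) + 2 ≤ m 0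
  energy≢0⇒ zero m E≢0 = contradiction refl E≢0
  energy≢0⇒ (suc p) m E≢0 with search< p m (m ∘ suc)
  ... | inj₁ (r , r<p , lt) = inj₁ (r , s≤s r<p , lt)
  ... | inj₂ descending with m p + 2 ℕ.≤? m 0
  ...   | yes wrap = inj₂ wrap
  ...   | no ¬wrap = contradiction E≡0 E≢0
    where
    antitone : ∀ s → s ≤ p → ∀ r → r ≤ s → m s ≤ m r
    antitone zero _ zero _ = ℕₚ.≤-refl
    antitone (suc s) s<p r r≤1+s with r ℕ.≟ suc s
    ... | yes refl = ℕₚ.≤-refl
    ... | no r≢1+s = ℕₚ.≤-trans (descending s s<p)
      (antitone s (ℕₚ.<⇒≤ s<p) r (ℕₚ.≤-pred (ℕₚ.≤∧≢⇒< r≤1+s r≢1+s)))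
    flat : m 0 ≤ suc (m p)
    flat = ℕₚ.≤-pred (subst (m 0 <_) (ℕₚ.+-comm (m p) 2) (ℕₚ.≰⇒> ¬wrap))
    term : ∀ s → s < suc p → ∀ r → r < s → T (+ m s ℤ.- + m r) ≡ 0
    term s (s≤s s≤p) r r<s with m r ℕ.≟ m s
    ... | yes eq rewrite eq = T[m⊖m]≡0 (m s)
    ... | no neq rewrite ℕₚ.≤-antisym
      (ℕₚ.≤-trans (antitone r (ℕₚ.≤-trans (ℕₚ.<⇒≤ r<s) s≤p) 0 z≤n) (ℕₚ.≤-trans flat (s≤s (antitone p ℕₚ.≤-refl s s≤p))))
      (ℕₚ.≤∧≢⇒< (antitone s s≤p r (ℕₚ.<⇒≤ r<s)) (neq ∘ sym)) = T[m⊖1+m]≡0 (m s)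
    E≡0 : energyℕ (suc p) m ≡ 0
    E≡0 = trans (∑-cong (suc p) {g = λ _ → 0} λ s s<1+p →
            trans (∑-cong s {g = λ _ → 0} (term s s<1+p)) (trans (∑-const s 0) (ℕₚ.*-zeroʳ s)))
          (trans (∑-const (suc p) 0) (ℕₚ.*-zeroʳ (suc p)))

  energy≡0⇒ : ∀ p m r s → energyℕ p m ≡ 0 → r < s → s < p → m r ≡ m s ⊎ m r ≡ suc (m s)
  energy≡0⇒ p m r s E≡0 r<s s<p = T≡0⇒ (m s) (m r) (ℕₚ.n≤0⇒n≡0 (ℕₚ.≤-trans
    (term≤∑ s r (λ r → T (+ m s ℤ.- + m r)) r<s)
    (ℕₚ.≤-trans (term≤∑ p s (λ s → ∑ s λ r → T (+ m s ℤ.- + m r)) s<p) (ℕₚ.≤-reflexive E≡0))))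

  -- The counts decrease weakly by at most one. If they did decrease, their sum would lie strictly
  -- between two consecutive multiples of the number of runners.
  energy≡0⇒uniform : ∀ p m → energyℕ p m ≡ 0 → p ∣ ∑ p m → ∀ s → s < p → m s ≡ m 0
  energy≡0⇒uniform (suc p) m E≡0 (divides q ∑≡q*p) = uniform
    where
    descends : ∀ r s → r ≤ s → s ≤ p → m s ≤ m r
    descends r s r≤s s≤p with r ℕ.≟ s
    ... | yes refl = ℕₚ.≤-refl
    ... | no r≢s with energy≡0⇒ (suc p) m r s E≡0 (ℕₚ.≤∧≢⇒< r≤s r≢s) (s≤s s≤p)
    ...   | inj₁ eq = ℕₚ.≤-reflexive (sym eq)
    ...   | inj₂ eq = ℕₚ.≤-trans (ℕₚ.n≤1+n _) (ℕₚ.≤-reflexive (sym eq))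
    uniform : ∀ s → s < suc p → m s ≡ m 0
    uniform s (s≤s s≤p) with m p ℕ.≟ m 0
    ... | yes eq = ℕₚ.≤-antisym (descends 0 s z≤n s≤p)
                                (ℕₚ.≤-trans (ℕₚ.≤-reflexive (sym eq)) (descends s p s≤p ℕₚ.≤-refl))
    ... | no neq = contradiction q≤mp (ℕₚ.<⇒≱ mp<q)
      where
      mp<m0 : m p < m 0
      mp<m0 = ℕₚ.≤∧≢⇒< (descends 0 p z≤n ℕₚ.≤-refl) neq
      m0≤1+mp : m 0 ≤ suc (m p)
      m0≤1+mp with p ℕ.≟ 0
      ... | yes refl = ℕₚ.n≤1+n _
      ... | no p≢0 with energy≡0⇒ (suc p) m 0 p E≡0 (ℕₚ.n≢0⇒n>0 p≢0) ℕₚ.≤-refl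
      ...   | inj₁ eq = contradiction (sym eq) neq
      ...   | inj₂ eq = ℕₚ.≤-reflexive eq
      mp<q : m p < q
      mp<q = ℕₚ.*-cancelʳ-< (suc p) (m p) q (subst₂ _<_ (trans (∑-const (suc p) (m p)) (ℕₚ.*-comm (suc p) (m p))) ∑≡q*p
        (∑-strict (suc p) {f = λ _ → m p} 0 (s≤s z≤n) (λ i i<1+p → descends i p (ℕₚ.≤-pred i<1+p) ℕₚ.≤-refl) mp<m0))
      q≤mp : q ≤ m p
      q≤mp = ℕₚ.≤-pred (ℕₚ.*-cancelʳ-< (suc p) q (suc (m p)) (subst₂ _<_ ∑≡q*p
        (trans (∑-const (suc p) (suc (m p))) (ℕₚ.*-comm (suc p) (suc (m p))))
        (∑-strict (suc p) {g = λ _ → suc (m p)} p ℕₚ.≤-refl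
          (λ i i<1+p → ℕₚ.≤-trans (descends 0 i z≤n (ℕₚ.≤-pred i<1+p)) m0≤1+mp) ℕₚ.≤-refl)))

open Energy

module Saturation (p : ℕ) .{{_ : NonZero p}} (1<p : 1 < p) where

  open import Data.Vec.Relation.Unary.All as All using (All; []; _∷_)
  import Data.Vec.Relation.Unary.All.Properties as Allₚ

  -- Forests of tokens

  ind : ℕ → ℕ → ℕ
  ind c z with c ℕ.≟ z
  ... | yes _ = 1
  ... | no _ = 0

  ind-refl : ∀ c → ind c c ≡ 1
  ind-refl c with c ℕ.≟ c
  ... | yes _ = refl
  ... | no c≢c = contradiction refl c≢c

  ind-≢ : ∀ {c z} → c ≢ z → ind c z ≡ 0
  ind-≢ {c} {z} c≢z with c ℕ.≟ z
  ... | yes c≡z = contradiction c≡z c≢z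
  ... | no _ = refl

  ∑-ind : ∀ n c (g : ℕ → ℕ) → c < n → ∑ n (λ z → ind c z * g z) ≡ g c
  ∑-ind n c g c<n = ℕₚ.+-cancelʳ-≡ 0 _ _ (begin
    ∑ n (λ z → ind c z * g z) + 0     ≡⟨ ∑-update n c {g = λ _ → 0} c<n (λ z z≢c → cong (_* g z) (ind-≢ (z≢c ∘ sym))) ⟩
    ∑ n (λ _ → 0) + ind c c * g c     ≡⟨ cong₂ _+_ (trans (∑-const n 0) (ℕₚ.*-zeroʳ n)) (trans (cong (_* g c) (ind-refl c)) (ℕₚ.*-identityˡ (g c))) ⟩
    g c                               ≡⟨ ℕₚ.+-identityʳ (g c) ⟨
    g c + 0                           ∎)
    where open ≡-Reasoning

  [cp+r]/p : ∀ c {r} → r < p → (c * p + r) / p ≡ c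
  [cp+r]/p c {r} r<p = trans (+-distrib-/-∣ˡ r (Div.n∣m*n c))
    (trans (cong₂ _+_ (m*n/n≡m c p) (m<n⇒m/n≡0 r<p)) (ℕₚ.+-identityʳ c))

  [cp+r]%p : ∀ c {r} → r < p → (c * p + r) % p ≡ r
  [cp+r]%p c {r} r<p = trans (cong (_% p) (ℕₚ.+-comm (c * p) r)) (trans ([m+kn]%n≡m%n r c p) (m<n⇒m%n≡m r<p))

  div-mod : ∀ a → a ≡ a / p * p + a % p
  div-mod a = trans (m≡m%n+[m/n]*n a p) (ℕₚ.+-comm (a % p) _)

  child<  : ∀ {c r Q} → c < Q → r < p → c * p + r < Q * p
  child< {c} {r} {Q} c<Q r<p = ℕₚ.≤-trans (ℕₚ.+-monoʳ-< (c * p) r<p)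
    (ℕₚ.≤-trans (ℕₚ.≤-reflexive (ℕₚ.+-comm (c * p) p)) (ℕₚ.*-monoˡ-≤ p c<Q))

  -- A token (c , a) of colour c and value a stands for an entry a of the c-th component.  Passing to the
  -- next digit splits every colour c into the p colours c p + r, according to the residue r of a.
  Token : Set
  Token = ℕ × ℕ

  Forest : ℕ → Set
  Forest = Vec Token

  next-token prev-token : Token → Token
  next-token (c , a) = c * p + a % p , a / p
  prev-token (c , a) = c / p , a * p + c % p

  next-prev : ∀ t → next-token (prev-token t) ≡ t
  next-prev (c , a) = cong₂ _,_
    (trans (cong (c / p * p +_) ([cp+r]%p a (m%n<n c p))) (sym (div-mod c)))
    ([cp+r]/p a (m%n<n c p))

  prev-next : ∀ t → prev-token (next-token t) ≡ t
  prev-next (c , a) = cong₂ _,_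
    ([cp+r]/p c (m%n<n a p))
    (trans (cong (a / p * p +_) ([cp+r]%p c (m%n<n a p))) (sym (div-mod a)))

  next prev : ∀ {M} → Forest M → Forest M
  next = Vec.map next-token
  prev = Vec.map prev-token

  next∘prev : ∀ {M} (u : Forest M) → next (prev u) ≡ u
  next∘prev [] = refl
  next∘prev (t ∷ u) = cong₂ _∷_ (next-prev t) (next∘prev u)

  prev∘next : ∀ {M} (u : Forest M) → prev (next u) ≡ u
  prev∘next [] = refl
  prev∘next (t ∷ u) = cong₂ _∷_ (prev-next t) (prev∘next u)

  val : ∀ {M} → Forest M → ℕ
  val [] = 0
  val (t ∷ u) = proj₂ t + val u

  cnt : ∀ {M} → ℕ → Forest M → ℕ
  cnt z [] = 0
  cnt z (t ∷ u) = ind (proj₁ t) z + cnt z u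

  pairs : ∀ {M} → Forest M → ℕ
  pairs [] = 0
  pairs (t ∷ u) = cnt (proj₁ t) u + pairs u

  colour-sum : ∀ {M} → (ℕ → ℕ) → Forest M → ℕ
  colour-sum f [] = 0
  colour-sum f (t ∷ u) = f (proj₁ t) + colour-sum f u

  Coloured : ∀ {M} → ℕ → Forest M → Set
  Coloured Q = All (λ t → proj₁ t < Q)

  coloured-next : ∀ {M Q} {u : Forest M} → Coloured Q u → Coloured (Q * p) (next u)
  coloured-next [] = []
  coloured-next {u = (c , a) ∷ u} (c<Q ∷ u<Q) = child< c<Q (m%n<n a p) ∷ coloured-next u<Q

  ∑-cnt : ∀ {M} Q f (u : Forest M) → Coloured Q u → ∑ Q (λ z → f z * cnt z u) ≡ colour-sum f u
  ∑-cnt Q f [] [] = trans (∑-cong Q (λ z _ → ℕₚ.*-zeroʳ (f z))) (trans (∑-const Q 0) (ℕₚ.*-zeroʳ Q))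
  ∑-cnt Q f ((c , a) ∷ u) (c<Q ∷ u<Q) = begin
    ∑ Q (λ z → f z * (ind c z + cnt z u))                        ≡⟨ ∑-cong Q (λ z _ → distrib (f z) (ind c z) (cnt z u)) ⟩
    ∑ Q (λ z → ind c z * f z + f z * cnt z u)                    ≡⟨ ∑-+ Q (λ z → ind c z * f z) (λ z → f z * cnt z u) ⟩
    ∑ Q (λ z → ind c z * f z) + ∑ Q (λ z → f z * cnt z u)        ≡⟨ cong₂ _+_ (∑-ind Q c f c<Q) (∑-cnt Q f u u<Q) ⟩
    f c + colour-sum f u                                         ∎
    where
    open ≡-Reasoning
    distrib : ∀ x y z → x * (y + z) ≡ y * x + x * z
    distrib = ℕR.solve-∀

  -- A squared count is a number of ordered pairs of tokens of one colour; the summand `M` is the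
  -- diagonal.
  ∑-cnt² : ∀ {M} Q (u : Forest M) → Coloured Q u → ∑ Q (λ z → cnt z u * cnt z u) ≡ 2 * pairs u + M
  ∑-cnt² Q [] [] = trans (∑-const Q 0) (ℕₚ.*-zeroʳ Q)
  ∑-cnt² {suc M} Q ((c , a) ∷ u) (c<Q ∷ u<Q) = begin
    ∑ Q (λ z → (ind c z + cnt z u) * (ind c z + cnt z u))
      ≡⟨ ∑-cong Q (λ z _ → expand (ind c z) (cnt z u)) ⟩
    ∑ Q (λ z → ind c z * (ind c z + 2 * cnt z u) + cnt z u * cnt z u)
      ≡⟨ ∑-+ Q (λ z → ind c z * (ind c z + 2 * cnt z u)) (λ z → cnt z u * cnt z u) ⟩
    ∑ Q (λ z → ind c z * (ind c z + 2 * cnt z u)) + ∑ Q (λ z → cnt z u * cnt z u)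
      ≡⟨ cong₂ _+_ (∑-ind Q c (λ z → ind c z + 2 * cnt z u) c<Q) (∑-cnt² Q u u<Q) ⟩
    (ind c c + 2 * cnt c u) + (2 * pairs u + M)
      ≡⟨ cong (λ i → (i + 2 * cnt c u) + (2 * pairs u + M)) (ind-refl c) ⟩
    (1 + 2 * cnt c u) + (2 * pairs u + M)
      ≡⟨ collect (cnt c u) (pairs u) M ⟩
    2 * (cnt c u + pairs u) + suc M ∎
    where
    open ≡-Reasoning
    expand : ∀ x y → (x + y) * (x + y) ≡ x * (x + 2 * y) + y * y
    expand = ℕR.solve-∀
    collect : ∀ x y m → (1 + 2 * x) + (2 * y + m) ≡ 2 * (x + y) + suc m
    collect = ℕR.solve-∀

  child : ℕ → ℕ → ℕ
  child w s = w * p + s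

  child-injective : ∀ w w′ {s s′} → s < p → s′ < p → child w s ≡ child w′ s′ → w ≡ w′ × s ≡ s′
  child-injective w w′ s<p s′<p eq =
    trans (sym ([cp+r]/p w s<p)) (trans (cong (_/ p) eq) ([cp+r]/p w′ s′<p)) ,
    trans (sym ([cp+r]%p w s<p)) (trans (cong (_% p) eq) ([cp+r]%p w′ s′<p))

  -- `children u w` is the abacus of the colour `w`: the numbers of tokens on its `p` runners.
  children : ∀ {M} → Forest M → ℕ → ℕ → ℕ
  children u w s = cnt (child w s) (next u)

  cnt-children : ∀ {M} w (u : Forest M) → cnt w u ≡ ∑ p (children u w)
  cnt-children w [] = sym (trans (∑-const p 0) (ℕₚ.*-zeroʳ p))
  cnt-children w ((c , a) ∷ u) = begin
    ind c w + cnt w u                                                       ≡⟨ cong₂ _+_ (sym head) (cnt-children w u) ⟩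
    ∑ p (λ s → ind (child c (a % p)) (child w s)) + ∑ p (children u w)      ≡⟨ ∑-+ p _ (children u w) ⟨
    _                                                                       ∎
    where
    open ≡-Reasoning
    head : ∑ p (λ s → ind (child c (a % p)) (child w s)) ≡ ind c w
    head with c ℕ.≟ w
    ... | yes refl = trans (∑-cong p same) (∑-ind p (a % p) (λ _ → 1) (m%n<n a p))
      where
      same : ∀ s → s < p → ind (child c (a % p)) (child c s) ≡ ind (a % p) s * 1
      same s s<p with a % p ℕ.≟ s
      ... | yes eq rewrite eq = ind-refl (child c s)
      ... | no neq = ind-≢ (neq ∘ proj₂ ∘ child-injective c c (m%n<n a p) s<p)
    ... | no c≢w = trans (∑-cong p {g = λ _ → 0} (λ s s<p → ind-≢ (c≢w ∘ proj₁ ∘ child-injective c w (m%n<n a p) s<p)))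
                         (trans (∑-const p 0) (ℕₚ.*-zeroʳ p))

  total-energy : ∀ {M} → ℕ → Forest M → ℕ
  total-energy Q u = ∑ Q (λ w → energyℕ p (children u w))

  val-next : ∀ {M} (u : Forest M) → val u ≡ p * val (next u) + colour-sum (_% p) (next u)
  val-next [] = trans (sym (ℕₚ.*-zeroʳ p)) (sym (ℕₚ.+-identityʳ _))
  val-next ((c , a) ∷ u) = begin
    a + val u
      ≡⟨ cong₂ _+_ (div-mod a) (val-next u) ⟩
    (a / p * p + a % p) + (p * val (next u) + colour-sum (_% p) (next u))
      ≡⟨ regroup (a / p) p (a % p) (val (next u)) (colour-sum (_% p) (next u)) ⟩
    p * (a / p + val (next u)) + (a % p + colour-sum (_% p) (next u))
      ≡⟨ cong (λ r → p * (a / p + val (next u)) + (r + colour-sum (_% p) (next u))) ([cp+r]%p c (m%n<n a p)) ⟨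
    _ ∎
    where
    open ≡-Reasoning
    regroup : ∀ a p r v s → (a * p + r) + (p * v + s) ≡ p * (a + v) + (r + s)
    regroup = ℕR.solve-∀

  -- For the partition with beta-set {a : (c , a) ∈ u}, val minus pairs is its size and the energy of c is
  -- the size of its p-core; this is |λ| = |core λ| + p |quotient λ|.
  val-pairs-next : ∀ {M Q} (u : Forest M) → Coloured Q u →
    val u + p * pairs (next u) ≡ p * val (next u) + total-energy Q u + pairs u
  val-pairs-next {M} {Q} u u<Q = ℕₚ.*-cancelˡ-≡ _ _ 2 (ℕₚ.+-cancelʳ-≡ (M + p * M) _ _ (begin
    2 * (val u + p * pairs (next u)) + (M + p * M)
      ≡⟨ cong (λ v → 2 * (v + p * pairs (next u)) + (M + p * M)) (val-next u) ⟩
    2 * (p * val (next u) + R + p * pairs (next u)) + (M + p * M)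
      ≡⟨ regroup₁ p (val (next u)) R (pairs (next u)) M ⟩
    2 * (p * val (next u)) + (p * (2 * pairs (next u) + M) + M + 2 * R)
      ≡⟨ cong (2 * (p * val (next u)) +_) summed ⟨
    2 * (p * val (next u)) + (2 * total-energy Q u + (2 * pairs u + M) + p * M)
      ≡⟨ regroup₂ p (val (next u)) (total-energy Q u) (pairs u) M ⟩
    2 * (p * val (next u) + total-energy Q u + pairs u) + (M + p * M) ∎))
    where
    open ≡-Reasoning
    R = colour-sum (_% p) (next u)
    u′<Qp = coloured-next u<Q
    regroup₁ : ∀ p v r q m → 2 * (p * v + r + p * q) + (m + p * m) ≡ 2 * (p * v) + (p * (2 * q + m) + m + 2 * r)
    regroup₁ = ℕR.solve-∀
    regroup₂ : ∀ p v e q m → 2 * (p * v) + (2 * e + (2 * q + m) + p * m) ≡ 2 * (p * v + e + q) + (m + p * m)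
    regroup₂ = ℕR.solve-∀
    colour-sum-1 : ∀ {M} (u : Forest M) → colour-sum (λ _ → 1) u ≡ M
    colour-sum-1 [] = refl
    colour-sum-1 (t ∷ u) = cong suc (colour-sum-1 u)
    ∑cnt≡M : ∑ Q (λ w → cnt w u) ≡ M
    ∑cnt≡M = trans (∑-cong Q (λ w _ → sym (ℕₚ.*-identityˡ _))) (trans (∑-cnt Q (λ _ → 1) u u<Q) (colour-sum-1 u))
    local : ∀ w → 2 * energyℕ p (children u w) + cnt w u * cnt w u + p * cnt w u ≡
      p * ∑ p (λ s → children u w s * children u w s) + cnt w u + 2 * ∑ p (λ s → s * children u w s)
    local w rewrite cnt-children w u = energyℕ-quadratic p (children u w)
    sum₃ : ∀ f g h → ∑ Q (λ w → f w + g w + h w) ≡ ∑ Q f + ∑ Q g + ∑ Q h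
    sum₃ f g h = trans (∑-+ Q (λ w → f w + g w) h) (cong (_+ ∑ Q h) (∑-+ Q f g))
    squares : ∑ Q (λ w → p * ∑ p (λ s → children u w s * children u w s)) ≡ p * (2 * pairs (next u) + M)
    squares = trans (∑-* Q p _) (cong (p *_) (trans
      (sym (∑-block Q p (λ z → cnt z (next u) * cnt z (next u)))) (∑-cnt² (Q * p) (next u) u′<Qp)))
    residues : ∑ Q (λ w → 2 * ∑ p (λ s → s * children u w s)) ≡ 2 * R
    residues = trans (∑-* Q 2 _) (cong (2 *_) (trans
      (∑-cong Q (λ w _ → ∑-cong p (λ s s<p → cong (_* children u w s) (sym ([cp+r]%p w s<p)))))
      (trans (sym (∑-block Q p (λ z → z % p * cnt z (next u)))) (∑-cnt (Q * p) (_% p) (next u) u′<Qp))))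
    summed : 2 * total-energy Q u + (2 * pairs u + M) + p * M ≡ p * (2 * pairs (next u) + M) + M + 2 * R
    summed = begin
      2 * total-energy Q u + (2 * pairs u + M) + p * M
        ≡⟨ cong₂ _+_ (cong₂ _+_ (∑-* Q 2 _) (∑-cnt² Q u u<Q)) (trans (∑-* Q p _) (cong (p *_) ∑cnt≡M)) ⟨
      ∑ Q (λ w → 2 * energyℕ p (children u w)) + ∑ Q (λ w → cnt w u * cnt w u) + ∑ Q (λ w → p * cnt w u)
        ≡⟨ sum₃ _ _ _ ⟨
      ∑ Q (λ w → 2 * energyℕ p (children u w) + cnt w u * cnt w u + p * cnt w u)
        ≡⟨ ∑-cong Q (λ w _ → local w) ⟩
      ∑ Q (λ w → p * ∑ p (λ s → children u w s * children u w s) + cnt w u + 2 * ∑ p (λ s → s * children u w s))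
        ≡⟨ sum₃ _ _ _ ⟩
      _ ≡⟨ cong₂ _+_ (cong₂ _+_ squares ∑cnt≡M) residues ⟩
      _ ∎

  -- Perfect forests and recolouring

  nexts : ∀ {M} → ℕ → Forest M → Forest M
  nexts zero u = u
  nexts (suc L) u = nexts L (next u)

  shift : ℕ → ℕ → ℕ
  shift zero n = n
  shift (suc L) n = shift L (n / p)

  HasSize : ∀ {M} → Forest M → ℕ → Set
  HasSize u n = val u ≡ n + pairs u

  -- For prime p this says that the characters labelled by the partitions in u have degree prime to p (Macdonald).
  Perfect : ∀ {M} → Forest M → ℕ → Set
  Perfect u n = ∀ L → HasSize (nexts L u) (shift L n)

  perfect-cons : ∀ {M} {u : Forest M} {n} → HasSize u n → Perfect (next u) (n / p) → Perfect u n
  perfect-cons size P zero = size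
  perfect-cons size P (suc L) = P L

  perfect-next : ∀ {M} {u : Forest M} {n} → Perfect u n → Perfect (next u) (n / p)
  perfect-next P L = P (suc L)

  size-lift : ∀ {M Q n′} {u : Forest M} → Coloured Q u → HasSize (next u) n′ → HasSize u (p * n′ + total-energy Q u)
  size-lift {Q = Q} {n′} {u} u<Q size = ℕₚ.+-cancelʳ-≡ (p * pairs (next u)) _ _ (begin
    val u + p * pairs (next u)                                          ≡⟨ val-pairs-next u u<Q ⟩
    p * val (next u) + total-energy Q u + pairs u                       ≡⟨ cong (λ v → p * v + total-energy Q u + pairs u) size ⟩
    p * (n′ + pairs (next u)) + total-energy Q u + pairs u              ≡⟨ regroup p n′ (pairs (next u)) (total-energy Q u) (pairs u) ⟩
    p * n′ + total-energy Q u + pairs u + p * pairs (next u)            ∎)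
    where
    open ≡-Reasoning
    regroup : ∀ p n q e r → p * (n + q) + e + r ≡ p * n + e + r + p * q
    regroup = ℕR.solve-∀

  size-unique : ∀ {M m n} {u : Forest M} → HasSize u m → HasSize u n → m ≡ n
  size-unique {u = u} size size′ = ℕₚ.+-cancelʳ-≡ (pairs u) _ _ (trans (sym size) size′)

  size-energy : ∀ {M Q m n} {u : Forest M} → Coloured Q u → HasSize u m → HasSize (next u) n → m ≡ p * n + total-energy Q u
  size-energy {u = u} u<Q size size′ = size-unique {u = u} size (size-lift u<Q size′)

  -- The energy is what the size leaves over `p` times the size of the next level. For a perfect
  -- forest it equals the digit, rather than being merely congruent to it.
  perfect-energy : ∀ {M Q n} {u : Forest M} → Coloured Q u → Perfect u n → total-energy Q u ≡ n % p
  perfect-energy {Q = Q} {n} {u} u<Q P = ℕₚ.+-cancelˡ-≡ (p * (n / p)) _ _ (trans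
    (sym (size-energy u<Q (P 0) (P 1))) (trans (div-mod n) (cong (_+ n % p) (ℕₚ.*-comm (n / p) p))))

  -- Used with powers of `p`: each passage to the next digit removes one factor, and the bound 1,
  -- where all values are 0, is the base of the inductions.
  Bounded : ∀ {M} → ℕ → Forest M → Set
  Bounded N = All (λ t → proj₂ t < N)

  bounded-next : ∀ {M N} {u : Forest M} → Bounded (p * N) u → Bounded N (next u)
  bounded-next [] = []
  bounded-next {N = N} {(c , a) ∷ u} (a< ∷ u<) =
    m<n*o⇒m/o<n (subst (a <_) (ℕₚ.*-comm p N) a<) ∷ bounded-next u<

  bounded₁-val : ∀ {M} {u : Forest M} → Bounded 1 u → val u ≡ 0
  bounded₁-val [] = refl
  bounded₁-val (s≤s z≤n ∷ u<) = bounded₁-val u<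

  bounded₁-next : ∀ {M} {u : Forest M} → Bounded 1 u → Bounded 1 (next u)
  bounded₁-next [] = []
  bounded₁-next {u = (c , a) ∷ u} (a< ∷ u<) = ℕₚ.≤-<-trans (m/n≤m a p) a< ∷ bounded₁-next u<

  pairs-next≤ : ∀ {M} (u : Forest M) → pairs (next u) ≤ pairs u
  pairs-next≤ [] = z≤n
  pairs-next≤ ((c , a) ∷ u) = ℕₚ.+-mono-≤
    (ℕₚ.≤-trans (term≤∑ p (a % p) (children u c) (m%n<n a p)) (ℕₚ.≤-reflexive (sym (cnt-children c u))))
    (pairs-next≤ u)

  perfect-zero : ∀ {M} {u : Forest M} → Bounded 1 u → pairs u ≡ 0 → Perfect u 0
  perfect-zero {u = u} u< pairs≡0 zero = trans (bounded₁-val u<) (sym pairs≡0)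
  perfect-zero {u = u} u< pairs≡0 (suc L) = subst (λ n → HasSize (nexts L (next u)) (shift L n)) (sym (0/n≡0 p))
    (perfect-zero (bounded₁-next u<) (ℕₚ.n≤0⇒n≡0 (ℕₚ.≤-trans (pairs-next≤ u) (ℕₚ.≤-reflexive pairs≡0))) L)

  -- The meaning one level up depends on the two colours: for the same residue under two parents it
  -- is again a recolouring (`recolour-prev`), for adjacent residues under one parent it lowers
  -- values by one (`descent`). `keep` may also be applied to tokens of colour `x`, so the index
  -- counts the tokens that really move.
  data Recolour (x y : ℕ) : ℕ → ∀ {M} → Forest M → Forest M → Set where
    []   : Recolour x y 0 [] []
    keep : ∀ {d M t} {u v : Forest M} → Recolour x y d u v → Recolour x y d (t ∷ u) (t ∷ v)
    move : ∀ {d M a} {u v : Forest M} → Recolour x y d u v → Recolour x y (suc d) ((x , a) ∷ u) ((y , a) ∷ v)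

  recolour-refl : ∀ {x y M} (u : Forest M) → Recolour x y 0 u u
  recolour-refl [] = []
  recolour-refl (t ∷ u) = keep (recolour-refl u)

  recolour-trans : ∀ {x y d e M} {u v w : Forest M} → x ≢ y →
    Recolour x y d u v → Recolour x y e v w → Recolour x y (d + e) u w
  recolour-trans x≢y [] [] = []
  recolour-trans x≢y (keep r) (keep r′) = keep (recolour-trans x≢y r r′)
  recolour-trans {x} {y} {d} {suc e} {u = u} {w = w} x≢y (keep r) (move r′) =
    subst (λ k → Recolour x y k u w) (sym (ℕₚ.+-suc d e)) (move (recolour-trans x≢y r r′))
  recolour-trans x≢y (move r) (keep r′) = move (recolour-trans x≢y r r′)
  recolour-trans x≢y (move r) (move r′) = contradiction refl x≢y

  recolour-prev : ∀ {x y d s M} {u v : Forest M} → s < p →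
    Recolour (child x s) (child y s) d u v → Recolour x y d (prev u) (prev v)
  recolour-prev s<p [] = []
  recolour-prev s<p (keep r) = keep (recolour-prev s<p r)
  recolour-prev {x} {y} {s = s} {u = (_ , a) ∷ _} s<p (move r)
    rewrite [cp+r]/p x s<p | [cp+r]/p y s<p | [cp+r]%p x s<p | [cp+r]%p y s<p = move (recolour-prev s<p r)

  recolour-val : ∀ {x y d M} {u v : Forest M} → Recolour x y d u v → val v ≡ val u
  recolour-val [] = refl
  recolour-val (keep r) = cong (_ +_) (recolour-val r)
  recolour-val (move r) = cong (_ +_) (recolour-val r)

  recolour-coloured : ∀ {x y d M Q} {u v : Forest M} → y < Q → Recolour x y d u v → Coloured Q u → Coloured Q v
  recolour-coloured y<Q [] [] = []
  recolour-coloured y<Q (keep r) (t<Q ∷ u<Q) = t<Q ∷ recolour-coloured y<Q r u<Q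
  recolour-coloured y<Q (move r) (t<Q ∷ u<Q) = y<Q ∷ recolour-coloured y<Q r u<Q

  recolour-bounded : ∀ {x y d M N} {u v : Forest M} → Recolour x y d u v → Bounded N u → Bounded N v
  recolour-bounded [] [] = []
  recolour-bounded (keep r) (t< ∷ u<) = t< ∷ recolour-bounded r u<
  recolour-bounded (move r) (t< ∷ u<) = t< ∷ recolour-bounded r u<

  recolour-cnt-off : ∀ {x y d M z} {u v : Forest M} → Recolour x y d u v → z ≢ x → z ≢ y → cnt z v ≡ cnt z u
  recolour-cnt-off [] z≢x z≢y = refl
  recolour-cnt-off (keep r) z≢x z≢y = cong (_ +_) (recolour-cnt-off r z≢x z≢y)
  recolour-cnt-off (move r) z≢x z≢y = cong₂ _+_ (trans (ind-≢ (z≢y ∘ sym)) (sym (ind-≢ (z≢x ∘ sym)))) (recolour-cnt-off r z≢x z≢y)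

  recolour-cnt-source : ∀ {x y d M} {u v : Forest M} → x ≢ y → Recolour x y d u v → cnt x u ≡ cnt x v + d
  recolour-cnt-source x≢y [] = refl
  recolour-cnt-source {x} {d = d} {v = t ∷ v} x≢y (keep r) =
    trans (cong (ind (proj₁ t) x +_) (recolour-cnt-source x≢y r)) (sym (ℕₚ.+-assoc (ind (proj₁ t) x) _ d))
  recolour-cnt-source {x} {y} {suc d} {v = _ ∷ v} x≢y (move r) rewrite ind-refl x | ind-≢ (x≢y ∘ sym) =
    trans (cong suc (recolour-cnt-source x≢y r)) (sym (ℕₚ.+-suc (cnt x v) d))

  recolour-cnt-target : ∀ {x y d M} {u v : Forest M} → x ≢ y → Recolour x y d u v → cnt y v ≡ cnt y u + d
  recolour-cnt-target x≢y [] = refl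
  recolour-cnt-target {y = y} {d = d} {u = t ∷ u} x≢y (keep r) =
    trans (cong (ind (proj₁ t) y +_) (recolour-cnt-target x≢y r)) (sym (ℕₚ.+-assoc (ind (proj₁ t) y) _ d))
  recolour-cnt-target {x} {y} {suc d} {u = _ ∷ u} x≢y (move r) rewrite ind-refl y | ind-≢ x≢y =
    trans (cong suc (recolour-cnt-target x≢y r)) (sym (ℕₚ.+-suc (cnt y u) d))

  -- Up to a constant, twice `pairs` is the sum of the squared counts, and only the counts of `x`
  -- and `y` change.
  recolour-pairs : ∀ {x y d M Q} {u v : Forest M} → Coloured Q u → x < Q → y < Q → x ≢ y → Recolour x y d u v →
    pairs v + d * cnt x v ≡ pairs u + d * cnt y u
  recolour-pairs {x} {y} {d} {M} {Q} {u} {v} u<Q x<Q y<Q x≢y r = ℕₚ.*-cancelˡ-≡ _ _ 2 (ℕₚ.+-cancelʳ-≡ (M + d * d + X * X + Y * Y) _ _ (begin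
    2 * (pairs v + d * X) + (M + d * d + X * X + Y * Y)
      ≡⟨ regroup (pairs v) d X M Y ⟩
    (2 * pairs v + M) + ((X + d) * (X + d) + Y * Y)
      ≡⟨ cong₂ _+_ (∑-cnt² Q v (recolour-coloured y<Q r u<Q)) (cong (λ k → k * k + Y * Y) (recolour-cnt-source x≢y r)) ⟨
    ∑ Q (λ z → cnt z v * cnt z v) + (cnt x u * cnt x u + Y * Y)
      ≡⟨ ∑-update₂ Q x y x<Q y<Q x≢y (λ z z≢x z≢y → cong (λ k → k * k) (recolour-cnt-off r z≢x z≢y)) ⟩
    ∑ Q (λ z → cnt z u * cnt z u) + (X * X + cnt y v * cnt y v)
      ≡⟨ cong₂ _+_ (∑-cnt² Q u u<Q) (cong (λ k → X * X + k * k) (recolour-cnt-target x≢y r)) ⟩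
    (2 * pairs u + M) + (X * X + (Y + d) * (Y + d))
      ≡⟨ regroup′ (pairs u) d X M Y ⟩
    2 * (pairs u + d * Y) + (M + d * d + X * X + Y * Y) ∎))
    where
    open ≡-Reasoning
    X = cnt x v
    Y = cnt y u
    regroup : ∀ q d x m y → 2 * (q + d * x) + (m + d * d + x * x + y * y) ≡ (2 * q + m) + ((x + d) * (x + d) + y * y)
    regroup = ℕR.solve-∀
    regroup′ : ∀ q d x m y → (2 * q + m) + (x * x + (y + d) * (y + d)) ≡ 2 * (q + d * y) + (m + d * d + x * x + y * y)
    regroup′ = ℕR.solve-∀

  -- When `d` is the whole excess, the counts of `x` and `y` are interchanged, so the number of
  -- monochromatic pairs stays.
  recolour-exchange : ∀ {x y d M Q n} {u v : Forest M} → Coloured Q u → x < Q → y < Q → x ≢ y →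
    cnt x u ≡ cnt y u + d → Recolour x y d u v → HasSize u n → HasSize v n
  recolour-exchange {x} {y} {d} {n = n} {u} {v} u<Q x<Q y<Q x≢y excess r size = begin
    val v        ≡⟨ recolour-val r ⟩
    val u        ≡⟨ size ⟩
    n + pairs u  ≡⟨ cong (n +_) pairs≡ ⟨
    n + pairs v  ∎
    where
    open ≡-Reasoning
    X≡Y : cnt x v ≡ cnt y u
    X≡Y = ℕₚ.+-cancelʳ-≡ d _ _ (trans (sym (recolour-cnt-source x≢y r)) excess)
    pairs≡ : pairs v ≡ pairs u
    pairs≡ = ℕₚ.+-cancelʳ-≡ (d * cnt y u) _ _
      (trans (cong (λ k → pairs v + d * k) (sym X≡Y)) (recolour-pairs u<Q x<Q y<Q x≢y r))

  recolour-one : ∀ {x y M} (u : Forest M) → cnt x u ≢ 0 → ∃[ v ] Recolour x y 1 u v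
  recolour-one [] cnt≢0 = contradiction refl cnt≢0
  recolour-one {x} {y} ((c , a) ∷ u) cnt≢0 with c ℕ.≟ x
  ... | yes refl = (y , a) ∷ u , move (recolour-refl u)
  ... | no _ with recolour-one u cnt≢0
  ...   | v , r = (c , a) ∷ v , keep r

  pairs≡0⇒cnt≤1 : ∀ {M} z (u : Forest M) → pairs u ≡ 0 → cnt z u ≤ 1
  pairs≡0⇒cnt≤1 z [] _ = z≤n
  pairs≡0⇒cnt≤1 z ((c , a) ∷ u) pairs≡0 with c ℕ.≟ z
  ... | yes refl = s≤s (ℕₚ.≤-reflexive (ℕₚ.m+n≡0⇒m≡0 (cnt c u) pairs≡0))
  ... | no _ = pairs≡0⇒cnt≤1 z u (ℕₚ.m+n≡0⇒n≡0 (cnt c u) pairs≡0)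

  -- Exchanging the counts of two colours by moves in one direction

  module _ (α β : ℕ → ℕ) where

    -- At each residue either nothing moves or the two runners exchange their counts; in both cases
    -- the size on the next level is preserved.
    Amounts : ℕ → ℕ → (ℕ → ℕ) → Set
    Amounts j e t = (∀ s → s < j → t s ≡ 0 ⊎ α s ≡ β s + t s) × ∑ j t ≡ e

    extend : ∀ j e {t} k → k ≡ 0 ⊎ α j ≡ β j + k → Amounts j e t → ∃[ t′ ] Amounts (suc j) (e + k) t′
    extend j e {t} k ok (each , ∑≡) = t′ , each′ , cong₂ _+_ (trans (∑-cong j below) ∑≡) at
      where
      t′ : ℕ → ℕ
      t′ s with s ℕ.≟ j
      ... | yes _ = k
      ... | no _ = t s
      at : t′ j ≡ k
      at with j ℕ.≟ j
      ... | yes _ = refl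
      ... | no j≢j = contradiction refl j≢j
      below : ∀ s → s < j → t′ s ≡ t s
      below s s<j with s ℕ.≟ j
      ... | yes refl = contradiction s<j (ℕₚ.<-irrefl refl)
      ... | no _ = refl
      each′ : ∀ s → s < suc j → t′ s ≡ 0 ⊎ α s ≡ β s + t′ s
      each′ s s<1+j with s ℕ.≟ j
      ... | yes refl = ok
      ... | no s≢j = each s (ℕₚ.≤∧≢⇒< (ℕₚ.≤-pred s<1+j) s≢j)

    -- Every residue with `β s < α s` has excess exactly 1, and the inequality between the sums
    -- provides at least `e` of them; the scan from the top takes them until `e` are found.
    amounts-≤1 : ∀ j e → (∀ s → s < j → α s ≤ suc (β s)) → e + ∑ j β ≤ ∑ j α → ∃[ t ] Amounts j e t
    amounts-≤1 j zero le1 le = (λ _ → 0) , (λ s _ → inj₁ refl) , trans (∑-const j 0) (ℕₚ.*-zeroʳ j)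
    amounts-≤1 zero (suc e) le1 ()
    amounts-≤1 (suc j) (suc e) le1 le with β j ℕ.<? α j
    ... | yes βj<αj with amounts-≤1 j e (λ s s<j → le1 s (ℕₚ.m<n⇒m<1+n s<j)) e+∑β≤∑α
      where
      αj≡1+βj : α j ≡ suc (β j)
      αj≡1+βj = ℕₚ.≤-antisym (le1 j ℕₚ.≤-refl) βj<αj
      e+∑β≤∑α : e + ∑ j β ≤ ∑ j α
      e+∑β≤∑α = ℕₚ.+-cancelʳ-≤ (suc (β j)) _ _ (subst₂ _≤_ (lem e (∑ j β) (β j)) (cong (∑ j α +_) αj≡1+βj) le)
        where
        lem : ∀ e b x → suc e + (b + x) ≡ e + b + suc x
        lem = ℕR.solve-∀
    ...   | t , T with extend j e 1 (inj₂ (trans (ℕₚ.≤-antisym (le1 j ℕₚ.≤-refl) βj<αj) (ℕₚ.+-comm 1 (β j)))) T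
    ...     | t′ , T′ = t′ , subst (λ k → Amounts (suc j) k t′) (ℕₚ.+-comm e 1) T′
    amounts-≤1 (suc j) (suc e) le1 le | no βj≮αj
      with amounts-≤1 j (suc e) (λ s s<j → le1 s (ℕₚ.m<n⇒m<1+n s<j))
        (ℕₚ.+-cancelʳ-≤ (β j) _ _ (ℕₚ.≤-trans (ℕₚ.≤-reflexive (ℕₚ.+-assoc (suc e) (∑ j β) (β j)))
          (ℕₚ.≤-trans le (ℕₚ.+-monoʳ-≤ (∑ j α) (ℕₚ.≮⇒≥ βj≮αj)))))
    ... | t , T with extend j (suc e) 0 (inj₁ refl) T
    ...   | t′ , T′ = t′ , subst (λ k → Amounts (suc j) k t′) (ℕₚ.+-identityʳ (suc e)) T′

    amounts-all : ∀ j d → (∀ s → s < j → β s ≤ α s) → ∑ j α ≡ ∑ j β + d → ∃[ t ] Amounts j d t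
    amounts-all j d β≤α ∑≡ = (λ s → α s ∸ β s) , (λ s s<j → inj₂ (sym (ℕₚ.m+[n∸m]≡n (β≤α s s<j)))) ,
      ℕₚ.+-cancelˡ-≡ (∑ j β) _ _ (trans (sym (∑-+ j β _))
        (trans (∑-cong j (λ s s<j → ℕₚ.m+[n∸m]≡n (β≤α s s<j))) ∑≡))

    -- If no count of `β` is larger, all excesses are moved and their sum is `d`. Otherwise one
    -- residue with `α i < β i` forces, by narrowness, every excess to be at most 1, and then any
    -- `d` of them can be selected.
    amounts : ∀ j d → (∀ r s → r < j → s < j → α r + β s ≤ α s + β r + 2) → ∑ j α ≡ ∑ j β + d → ∃[ t ] Amounts j d t
    amounts j d narrow ∑≡ with search< j α β
    ... | inj₂ β≤α = amounts-all j d β≤α ∑≡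
    ... | inj₁ (i , i<j , αi<βi) = amounts-≤1 j d
      (λ r r<j → ℕₚ.+-cancelʳ-≤ (suc (α i)) _ _ (begin
        α r + suc (α i)        ≤⟨ ℕₚ.+-monoʳ-≤ (α r) αi<βi ⟩
        α r + β i              ≤⟨ narrow r i r<j i<j ⟩
        α i + β r + 2          ≡⟨ lem (α i) (β r) ⟩
        suc (β r) + suc (α i)  ∎))
      (ℕₚ.≤-reflexive (trans (ℕₚ.+-comm d _) (sym ∑≡)))
      where
      open ℕₚ.≤-Reasoning
      lem : ∀ x y → x + y + 2 ≡ suc y + suc x
      lem = ℕR.solve-∀

  -- A spread of 3 would require energy at least `p` in the two colours together, by
  -- `energy-spread`, while all energies of a perfect forest add up to `n % p`.
  children-narrow : ∀ {M Q n x y} {u : Forest M} → Coloured Q u → Perfect u n → x < Q → y < Q → x ≢ y →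
    ∀ r s → r < p → s < p → children u x r + children u y s ≤ children u x s + children u y r + 2
  children-narrow {Q = Q} {n} {x} {y} {u} u<Q P x<Q y<Q x≢y r s r<p s<p =
    ℕₚ.≮⇒≥ λ wide → ℕₚ.<⇒≱ (m%n<n n p) (begin
      p                                                              ≤⟨ energy-spread p (children u x) (children u y) r s r<p s<p
                                                                         (ℕₚ.≤-trans (ℕₚ.≤-reflexive (ℕₚ.+-suc _ 2)) wide) ⟩
      energyℕ p (children u x) + energyℕ p (children u y)            ≤⟨ two-terms≤∑ Q x y (energyℕ p ∘ children u) x<Q y<Q x≢y ⟩
      total-energy Q u                                               ≡⟨ perfect-energy u<Q P ⟩
      n % p                                                          ∎)
    where open ℕₚ.≤-Reasoning

  -- Renaming the two colours would exchange their counts trivially, but it moves tokens both ways.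
  -- Here only the excess moves, and only from `x` to `y`, as a descent requires.
  Swappable : ℕ → Set
  Swappable N = ∀ {M Q n} (u : Forest M) x y d → Coloured Q u → Bounded N u → Perfect u n →
    x < Q → y < Q → x ≢ y → cnt x u ≡ cnt y u + d → ∃[ v ] (Recolour x y d u v × Perfect v n)

  -- The residues are treated one after another. The last component records that the runners still
  -- to come are untouched, so that the amounts computed from `u` remain valid for them.
  swap-children : ∀ {N M Q n x y} → Swappable N → (u : Forest M) (t : ℕ → ℕ) →
    Coloured Q u → Bounded (p * N) u → Perfect u n → x < Q → y < Q → x ≢ y →
    (∀ s → s < p → t s ≡ 0 ⊎ children u x s ≡ children u y s + t s) →
    ∀ j → j ≤ p → ∃[ v ] (Recolour x y (∑ j t) u (prev v) × Perfect v (n / p) × Coloured (Q * p) v × Bounded N v ×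
      (∀ s → j ≤ s → s < p → cnt (child x s) v ≡ children u x s × cnt (child y s) v ≡ children u y s))
  swap-children {x = x} {y} swap u t u<Q u< P x<Q y<Q x≢y each zero _ =
    next u , subst (Recolour x y 0 u) (sym (prev∘next u)) (recolour-refl u) , perfect-next P ,
    coloured-next u<Q , bounded-next u< , λ _ _ _ → refl , refl
  swap-children {x = x} {y} swap u t u<Q u< P x<Q y<Q x≢y each (suc j) j<p
    with swap-children swap u t u<Q u< P x<Q y<Q x≢y each j (ℕₚ.<⇒≤ j<p) | each j j<p
  ... | v , r , P′ , v<Qp , v< , same | inj₁ tj≡0 = v ,
    subst (λ k → Recolour x y k u (prev v)) (sym (trans (cong (∑ j t +_) tj≡0) (ℕₚ.+-identityʳ (∑ j t)))) r ,
    P′ , v<Qp , v< , λ s 1+j≤s → same s (ℕₚ.<⇒≤ 1+j≤s)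
  ... | v , r , P′ , v<Qp , v< , same | inj₂ xj≡yj+tj
    with swap v (child x j) (child y j) (t j) v<Qp v< P′ (child< x<Q j<p) (child< y<Q j<p)
           (x≢y ∘ proj₁ ∘ child-injective x y j<p j<p)
           (trans (proj₁ (same j ℕₚ.≤-refl j<p)) (trans xj≡yj+tj (cong (_+ t j) (sym (proj₂ (same j ℕₚ.≤-refl j<p))))))
  ...   | v′ , r′ , P″ = v′ , recolour-trans x≢y r (recolour-prev j<p r′) , P″ ,
    recolour-coloured (child< y<Q j<p) r′ v<Qp , recolour-bounded r′ v< , λ s j<s s<p →
      trans (untouched s j<s s<p x) (proj₁ (same s (ℕₚ.<⇒≤ j<s) s<p)) ,
      trans (untouched s j<s s<p y) (proj₂ (same s (ℕₚ.<⇒≤ j<s) s<p))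
    where
    untouched : ∀ s → j < s → s < p → ∀ z → cnt (child z s) v′ ≡ cnt (child z s) v
    untouched s j<s s<p z = recolour-cnt-off r′ (distinct x) (distinct y)
      where
      distinct : ∀ w → child z s ≢ child w j
      distinct w eq = ℕₚ.<⇒≢ j<s (sym (proj₂ (child-injective z w s<p j<p eq)))

  -- With all values 0 the size equation makes `n` and `pairs u` vanish; no colour then has two
  -- tokens, and the excess is at most 1.
  swap₁ : Swappable 1
  swap₁ {n = n} u x y zero u<Q u< P x<Q y<Q x≢y excess = u , recolour-refl u , P
  swap₁ {n = n} u x y (suc zero) u<Q u< P x<Q y<Q x≢y excess
    with recolour-one {x} {y} u (λ cnt≡0 → contradiction (trans (sym (trans excess (ℕₚ.+-suc (cnt y u) 0))) cnt≡0) (λ ()))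
  ... | v , r = v , r , subst (Perfect v) (sym n≡0) (perfect-zero (recolour-bounded r u<)
        (ℕₚ.m+n≡0⇒n≡0 n (trans (sym (recolour-exchange u<Q x<Q y<Q x≢y excess r (P 0)))
                                   (trans (recolour-val r) (bounded₁-val u<)))))
    where
    n≡0 : n ≡ 0
    n≡0 = ℕₚ.m+n≡0⇒m≡0 n (trans (sym (P 0)) (bounded₁-val u<))
  swap₁ {n = n} u x y (suc (suc d)) u<Q u< P x<Q y<Q x≢y excess = contradiction
    (pairs≡0⇒cnt≤1 x u (ℕₚ.m+n≡0⇒n≡0 n (trans (sym (P 0)) (bounded₁-val u<))))
    (ℕₚ.<⇒≱ (subst (2 ≤_) (sym excess) (ℕₚ.≤-trans (s≤s (s≤s z≤n)) (ℕₚ.m≤n+m (2 + d) (cnt y u)))))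

  -- `amounts` distributes the excess over the residues so that each part is a swap on the next
  -- level, available by induction; on the present level the counts are exchanged as a whole.
  swap : ∀ K → Swappable (p ^ K)
  swap zero = swap₁
  swap (suc K) {n = n} u x y d u<Q u< P x<Q y<Q x≢y excess = realise
    (amounts (children u x) (children u y) p d (children-narrow u<Q P x<Q y<Q x≢y)
      (trans (sym (cnt-children x u)) (trans excess (cong (_+ d) (cnt-children y u)))))
    where
    realise : ∃[ t ] Amounts (children u x) (children u y) p d t → ∃[ v ] (Recolour x y d u v × Perfect v n)
    realise (t , each , ∑t≡d) with swap-children {N = p ^ K} (swap K) u t u<Q u< P x<Q y<Q x≢y each p ℕₚ.≤-refl
    ... | v , r , P′ , _ = prev v , r′ ,
      perfect-cons (recolour-exchange u<Q x<Q y<Q x≢y excess r′ (P 0)) (subst (λ w → Perfect w (n / p)) (sym (next∘prev v)) P′)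
      where
      r′ : Recolour x y d u (prev v)
      r′ = subst (λ k → Recolour x y k u (prev v)) ∑t≡d r

  -- Descents and padding

  infix 4 _⊑_

  data _⊑_ : ∀ {M} → Forest M → Forest M → Set where
    []  : [] ⊑ []
    _∷_ : ∀ {M c b a} {v u : Forest M} → b ≤ a → v ⊑ u → (c , b) ∷ v ⊑ (c , a) ∷ u

  ⊑-refl : ∀ {M} (u : Forest M) → u ⊑ u
  ⊑-refl [] = []
  ⊑-refl (t ∷ u) = ℕₚ.≤-refl ∷ ⊑-refl u

  ⊑-trans : ∀ {M} {u v w : Forest M} → u ⊑ v → v ⊑ w → u ⊑ w
  ⊑-trans [] [] = []
  ⊑-trans (b≤a ∷ u⊑v) (a≤a′ ∷ v⊑w) = ℕₚ.≤-trans b≤a a≤a′ ∷ ⊑-trans u⊑v v⊑w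

  ⊑-coloured : ∀ {M Q} {u v : Forest M} → v ⊑ u → Coloured Q u → Coloured Q v
  ⊑-coloured [] [] = []
  ⊑-coloured (_ ∷ v⊑u) (c<Q ∷ u<Q) = c<Q ∷ ⊑-coloured v⊑u u<Q

  ⊑-prev : ∀ {M} {u v : Forest M} → v ⊑ u → prev v ⊑ prev u
  ⊑-prev [] = []
  ⊑-prev {u = (c , _) ∷ _} (b≤a ∷ v⊑u) = ℕₚ.+-monoˡ-≤ (c % p) (ℕₚ.*-monoˡ-≤ p b≤a) ∷ ⊑-prev v⊑u

  ⊑-next : ∀ {M} {u : Forest M} {v} → v ⊑ next u → prev v ⊑ u
  ⊑-next {u = u} v⊑u = subst (_ ⊑_) (prev∘next u) (⊑-prev v⊑u)

  ⊑-cnt : ∀ {M} {u v : Forest M} z → v ⊑ u → cnt z v ≡ cnt z u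
  ⊑-cnt z [] = refl
  ⊑-cnt z (_ ∷ v⊑u) = cong (_ +_) (⊑-cnt z v⊑u)

  ⊑-pairs : ∀ {M} {u v : Forest M} → v ⊑ u → pairs v ≡ pairs u
  ⊑-pairs [] = refl
  ⊑-pairs (_ ∷ v⊑u) = cong₂ _+_ (⊑-cnt _ v⊑u) (⊑-pairs v⊑u)

  descent : ∀ {M} w {r d} {u v : Forest M} → suc r < p → Recolour (child w (suc r)) (child w r) d u v →
    prev v ⊑ prev u × val (prev u) ≡ val (prev v) + d
  descent w 1+r<p [] = [] , refl
  descent w {d = d} {v = (c , b) ∷ v} 1+r<p (keep rec) with descent w 1+r<p rec
  ... | v⊑u , val≡ = ℕₚ.≤-refl ∷ v⊑u , trans (cong (_ +_) val≡) (sym (ℕₚ.+-assoc (b * p + c % p) _ d))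
  descent w {r} {suc d} {v = (_ , a) ∷ v} 1+r<p (move rec) with descent w 1+r<p rec
  ... | v⊑u , val≡
    rewrite [cp+r]/p w 1+r<p | [cp+r]/p w (ℕₚ.<⇒≤ 1+r<p) | [cp+r]%p w 1+r<p | [cp+r]%p w (ℕₚ.<⇒≤ 1+r<p) =
    ℕₚ.+-monoʳ-≤ (a * p) (ℕₚ.n≤1+n r) ∷ v⊑u , trans (cong (_ +_) val≡) (lem (a * p) r (val (prev v)) d)
    where
    lem : ∀ x r v d → x + suc r + (v + d) ≡ x + r + v + suc d
    lem = ℕR.solve-∀

  n<p^n : ∀ n → n < p ^ n
  n<p^n zero = s≤s z≤n
  n<p^n (suc n) = ℕₚ.≤-trans (s≤s (n<p^n n)) (ℕₚ.≤-trans
    (ℕₚ.+-monoˡ-≤ (p ^ n) (ℕₚ.≤-trans (s≤s z≤n) (n<p^n n)))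
    (ℕₚ.≤-trans (ℕₚ.≤-reflexive (cong (p ^ n +_) (sym (ℕₚ.+-identityʳ (p ^ n))))) (ℕₚ.*-monoˡ-≤ (p ^ n) 1<p)))

  bounded-mono : ∀ {M N N′} {u : Forest M} → N ≤ N′ → Bounded N u → Bounded N′ u
  bounded-mono N≤N′ [] = []
  bounded-mono N≤N′ (a<N ∷ u<) = ℕₚ.≤-trans a<N N≤N′ ∷ bounded-mono N≤N′ u<

  bounded-val : ∀ {M} (u : Forest M) → Bounded (suc (val u)) u
  bounded-val [] = []
  bounded-val ((c , a) ∷ u) = s≤s (ℕₚ.m≤m+n a (val u)) ∷ bounded-mono (s≤s (ℕₚ.m≤n+m (val u) a)) (bounded-val u)

  bounded-power : ∀ {M} (u : Forest M) → Bounded (p ^ val u) u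
  bounded-power u = bounded-mono (n<p^n (val u)) (bounded-val u)

  cnt≡0⇒≢ : ∀ {M} c a (u : Forest M) → cnt c u ≡ 0 → All ((c , a) ≢_) u
  cnt≡0⇒≢ c a [] _ = []
  cnt≡0⇒≢ c a ((c′ , a′) ∷ u) cnt≡0 with c′ ℕ.≟ c
  cnt≡0⇒≢ c a ((c′ , a′) ∷ u) () | yes _
  ... | no c′≢c = (λ eq → c′≢c (sym (cong proj₁ eq))) ∷ cnt≡0⇒≢ c a u cnt≡0

  pairs≡0⇒unique : ∀ {M} (u : Forest M) → pairs u ≡ 0 → Unique u
  pairs≡0⇒unique [] _ = []
  pairs≡0⇒unique ((c , a) ∷ u) pairs≡0 =
    cnt≡0⇒≢ c a u (ℕₚ.m+n≡0⇒m≡0 _ pairs≡0) ∷ pairs≡0⇒unique u (ℕₚ.m+n≡0⇒n≡0 (cnt c u) pairs≡0)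

  unique-next⁻ : ∀ {M} (u : Forest M) → Unique (next u) → Unique u
  unique-next⁻ [] [] = []
  unique-next⁻ (t ∷ u) (t∉u ∷ distinct) = off u t∉u ∷ unique-next⁻ u distinct
    where
    off : ∀ {M} (u : Forest M) → All (next-token t ≢_) (next u) → All (t ≢_) u
    off [] [] = []
    off (t′ ∷ u) (neq ∷ rest) = neq ∘ cong next-token ∷ off u rest

  -- On a level where all values are 0, the size equation leaves no pairs, so the tokens are
  -- distinct there; tokens distinct after `next` were distinct before. This makes the forests that
  -- are constructed legal positions.
  perfect⇒unique : ∀ {M n} {u : Forest M} → Perfect u n → Unique u
  perfect⇒unique {u = u} = go (val u) (bounded-power u)
    where
    go : ∀ K {M n} {u : Forest M} → Bounded (p ^ K) u → Perfect u n → Unique u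
    go zero {n = n} {u} u< P = pairs≡0⇒unique u (ℕₚ.m+n≡0⇒n≡0 n (trans (sym (P 0)) (bounded₁-val u<)))
    go (suc K) {u = u} u< P = unique-next⁻ u (go K (bounded-next u<) (perfect-next P))

  -- A new token of value 0 enters the colour w, whose other tokens are raised by one; colours are renamed by π.
  -- The renaming makes the construction stable under next: it becomes there a cyclic rotation of the p colours
  -- splitting w, and only the rotated-around colour is raised.
  pad-token : (ℕ → ℕ) → ℕ → Token → Token
  pad-token π w (c , a) = π c , a + ind (π c) w

  padding : ∀ {M} → (ℕ → ℕ) → ℕ → Forest M → Forest (suc M)
  padding π w u = (w , 0) ∷ Vec.map (pad-token π w) u

  pad : ∀ {M} → ℕ → Forest M → Forest (suc M)
  pad = padding id

  InjectiveOn : (ℕ → ℕ) → Set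
  InjectiveOn π = ∀ {x y} → π x ≡ π y → x ≡ y

  module _ {π : ℕ → ℕ} (π-injective : InjectiveOn π) (w : ℕ) where

    ind-π : ∀ c z → ind (π c) (π z) ≡ ind c z
    ind-π c z with c ℕ.≟ z
    ... | yes refl = ind-refl (π c)
    ... | no c≢z = ind-≢ (c≢z ∘ π-injective)

    cnt-pad : ∀ {M} z (u : Forest M) → cnt (π z) (Vec.map (pad-token π w) u) ≡ cnt z u
    cnt-pad z [] = refl
    cnt-pad z ((c , a) ∷ u) = cong₂ _+_ (ind-π c z) (cnt-pad z u)

    pairs-pad : ∀ {M} (u : Forest M) → pairs (Vec.map (pad-token π w) u) ≡ pairs u
    pairs-pad [] = refl
    pairs-pad ((c , a) ∷ u) = cong₂ _+_ (cnt-pad c u) (pairs-pad u)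

    val-pad : ∀ {M} (u : Forest M) → val (Vec.map (pad-token π w) u) ≡ cnt w (Vec.map (pad-token π w) u) + val u
    val-pad [] = refl
    val-pad ((c , a) ∷ u) = trans (cong (a + ind (π c) w +_) (val-pad u)) (lem a (ind (π c) w) (cnt w (Vec.map (pad-token π w) u)) (val u))
      where
      lem : ∀ a i c v → a + i + (c + v) ≡ i + c + (a + v)
      lem = ℕR.solve-∀

    -- The `k` old tokens of colour `w` gain 1 each, and the new token forms a pair with each of
    -- them.
    size-pad : ∀ {M n} (u : Forest M) → HasSize u n → HasSize (padding π w u) n
    size-pad {n = n} u size = begin
      val (Vec.map (pad-token π w) u)     ≡⟨ val-pad u ⟩
      k + val u                           ≡⟨ cong (k +_) (trans size (cong (n +_) (sym (pairs-pad u)))) ⟩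
      k + (n + pairs (Vec.map (pad-token π w) u))  ≡⟨ lem k n (pairs (Vec.map (pad-token π w) u)) ⟩
      n + (k + pairs (Vec.map (pad-token π w) u))  ∎
      where
      open ≡-Reasoning
      k = cnt w (Vec.map (pad-token π w) u)
      lem : ∀ k n q → k + (n + q) ≡ n + (k + q)
      lem = ℕR.solve-∀

    size-unpad : ∀ {M n} (u : Forest M) → HasSize (padding π w u) n → HasSize u n
    size-unpad {n = n} u size = ℕₚ.+-cancelˡ-≡ k _ _ (begin
      k + val u                           ≡⟨ val-pad u ⟨
      val (Vec.map (pad-token π w) u)     ≡⟨ size ⟩
      n + (k + pairs (Vec.map (pad-token π w) u))  ≡⟨ cong (λ q → n + (k + q)) (pairs-pad u) ⟩
      n + (k + pairs u)                   ≡⟨ lem k n (pairs u) ⟩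
      k + (n + pairs u)                   ∎)
      where
      open ≡-Reasoning
      k = cnt w (Vec.map (pad-token π w) u)
      lem : ∀ k n q → n + (k + q) ≡ k + (n + q)
      lem = ℕR.solve-∀

  suc-% : ∀ a → suc (a % p) % p ≡ suc a % p
  suc-% a = begin
    suc (a % p) % p                ≡⟨ [m+kn]%n≡m%n (suc (a % p)) (a / p) p ⟨
    (suc (a % p) + a / p * p) % p  ≡⟨ cong (λ k → suc k % p) (m≡m%n+[m/n]*n a p) ⟨
    suc a % p                      ∎
    where open ≡-Reasoning

  suc-/ : ∀ a → suc a / p ≡ a / p + ind (suc (a % p) % p) 0
  suc-/ a with suc (a % p) ℕ.<? p
  ... | yes lt rewrite m<n⇒m%n≡m lt = trans (cong (_/ p) (trans (cong suc (div-mod a)) (sym (ℕₚ.+-suc _ _))))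
    (trans ([cp+r]/p (a / p) lt) (sym (ℕₚ.+-identityʳ (a / p))))
  ... | no ¬lt = begin
    suc a / p                               ≡⟨ cong (_/ p) (trans (cong suc (m≡m%n+[m/n]*n a p)) (cong (_+ a / p * p) eq)) ⟩
    suc (a / p) * p / p                     ≡⟨ m*n/n≡m (suc (a / p)) p ⟩
    suc (a / p)                             ≡⟨ ℕₚ.+-comm 1 (a / p) ⟩
    a / p + 1                               ≡⟨ cong (λ k → a / p + ind k 0) (trans (cong (_% p) eq) (n%n≡0 p)) ⟨
    a / p + ind (suc (a % p) % p) 0         ∎
    where
    open ≡-Reasoning
    eq : suc (a % p) ≡ p
    eq = ℕₚ.≤-antisym (m%n<n a p) (ℕₚ.≮⇒≥ ¬lt)

  suc-%-injective : ∀ {r s} → r < p → s < p → suc r % p ≡ suc s % p → r ≡ s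
  suc-%-injective {r} {s} r<p s<p eq with suc r ℕ.<? p | suc s ℕ.<? p
  ... | yes lt | yes lt′ = ℕₚ.suc-injective (trans (sym (m<n⇒m%n≡m lt)) (trans eq (m<n⇒m%n≡m lt′)))
  ... | no ¬lt | no ¬lt′ = ℕₚ.suc-injective (trans (ℕₚ.≤-antisym r<p (ℕₚ.≮⇒≥ ¬lt)) (sym (ℕₚ.≤-antisym s<p (ℕₚ.≮⇒≥ ¬lt′))))
  ... | yes lt | no ¬lt′ = contradiction
    (trans (sym (m<n⇒m%n≡m lt)) (trans eq (trans (cong (_% p) (ℕₚ.≤-antisym s<p (ℕₚ.≮⇒≥ ¬lt′))) (n%n≡0 p)))) (λ ())
  ... | no ¬lt | yes lt′ = contradiction
    (trans (sym (m<n⇒m%n≡m lt′)) (trans (sym eq) (trans (cong (_% p) (ℕₚ.≤-antisym r<p (ℕₚ.≮⇒≥ ¬lt))) (n%n≡0 p)))) (λ ())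

  rotate : (ℕ → ℕ) → ℕ → ℕ → ℕ
  rotate π w z with π (z / p) ℕ.≟ w
  ... | yes _ = child w (suc (z % p) % p)
  ... | no _ = child (π (z / p)) (z % p)

  rotate-injective : ∀ {π} w → InjectiveOn π → InjectiveOn (rotate π w)
  rotate-injective {π} w π-injective {x} {y} eq with π (x / p) ℕ.≟ w | π (y / p) ℕ.≟ w
  ... | yes x≡w | yes y≡w = trans (div-mod x) (trans (cong₂ (λ c r → c * p + r)
      (π-injective (trans x≡w (sym y≡w)))
      (suc-%-injective (m%n<n x p) (m%n<n y p) (proj₂ (child-injective w w (m%n<n _ p) (m%n<n _ p) eq)))) (sym (div-mod y)))
  ... | no x≢w | no y≢w = trans (div-mod x) (trans (cong₂ (λ c r → c * p + r)
      (π-injective (proj₁ parts)) (proj₂ parts)) (sym (div-mod y)))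
    where
    parts : π (x / p) ≡ π (y / p) × x % p ≡ y % p
    parts = child-injective _ _ (m%n<n x p) (m%n<n y p) eq
  ... | yes x≡w | no y≢w = contradiction (sym (proj₁ (child-injective w _ (m%n<n _ p) (m%n<n y p) eq))) y≢w
  ... | no x≢w | yes y≡w = contradiction (proj₁ (child-injective _ w (m%n<n x p) (m%n<n _ p) eq)) x≢w

  rotate-hit : ∀ π w c {r} → π c ≡ w → r < p → rotate π w (child c r) ≡ child w (suc r % p)
  rotate-hit π w c {r} c≡w r<p with π (child c r / p) ℕ.≟ w
  ... | yes _ = cong (λ k → child w (suc k % p)) ([cp+r]%p c r<p)
  ... | no ≢w = contradiction (trans (cong π ([cp+r]/p c r<p)) c≡w) ≢w

  rotate-miss : ∀ π w c {r} → π c ≢ w → r < p → rotate π w (child c r) ≡ child (π c) r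
  rotate-miss π w c {r} c≢w r<p with π (child c r / p) ℕ.≟ w
  ... | yes ≡w = contradiction (trans (cong π (sym ([cp+r]/p c r<p))) ≡w) c≢w
  ... | no _ = cong₂ (λ z k → child (π z) k) ([cp+r]/p c r<p) ([cp+r]%p c r<p)

  -- Raising a value of residue r gives residue r + 1 modulo `p`, with a carry exactly when this is
  -- 0. So after the passage the tokens that are still raised are those of colour `child w 0`.
  next-pad-token : ∀ π w t → next-token (pad-token π w t) ≡ pad-token (rotate π w) (child w 0) (next-token t)
  next-pad-token π w (c , a) with π c ℕ.≟ w
  ... | yes refl = cong₂ _,_
    (trans (cong (child w) (trans (cong (_% p) (ℕₚ.+-comm a 1)) (sym (suc-% a)))) (sym hit))
    (trans (cong (_/ p) (ℕₚ.+-comm a 1)) (trans (suc-/ a)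
      (cong (a / p +_) (trans (same (suc (a % p) % p) (m%n<n _ p)) (cong (λ z → ind z (child w 0)) (sym hit))))))
    where
    hit : rotate π w (child c (a % p)) ≡ child w (suc (a % p) % p)
    hit = rotate-hit π w c refl (m%n<n a p)
    same : ∀ s → s < p → ind s 0 ≡ ind (child w s) (child w 0)
    same s s<p with s ℕ.≟ 0
    ... | yes refl = sym (ind-refl (child w 0))
    ... | no s≢0 = sym (ind-≢ (s≢0 ∘ proj₂ ∘ child-injective w w s<p (ℕₚ.<⇒≤ 1<p)))
  ... | no c≢w = cong₂ _,_
    (trans (cong (λ k → child (π c) (k % p)) (ℕₚ.+-identityʳ a)) (sym miss))
    (trans (cong (_/ p) (ℕₚ.+-identityʳ a)) (trans (sym (ℕₚ.+-identityʳ (a / p)))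
      (cong (a / p +_) (trans (sym (ind-≢ (c≢w ∘ proj₁ ∘ child-injective (π c) w (m%n<n a p) (ℕₚ.<⇒≤ 1<p))))
                              (cong (λ z → ind z (child w 0)) (sym miss))))))
    where
    miss : rotate π w (child c (a % p)) ≡ child (π c) (a % p)
    miss = rotate-miss π w c c≢w (m%n<n a p)

  next-padding : ∀ {M} π w (u : Forest M) → next (padding π w u) ≡ padding (rotate π w) (child w 0) (next u)
  next-padding π w u = cong₂ _∷_ (cong₂ _,_ (cong (child w) (m*n%n≡0 0 p)) (0/n≡0 p)) (go u)
    where
    go : ∀ {M} (u : Forest M) → next (Vec.map (pad-token π w) u) ≡ Vec.map (pad-token (rotate π w) (child w 0)) (next u)
    go [] = refl
    go (t ∷ u) = cong₂ _∷_ (next-pad-token π w t) (go u)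

  perfect-padding : ∀ {M n π} w (u : Forest M) → InjectiveOn π → Perfect u n → Perfect (padding π w u) n
  perfect-padding w u π-injective P zero = size-pad π-injective w u (P 0)
  perfect-padding {n = n} {π} w u π-injective P (suc L) =
    subst (λ v → HasSize (nexts L v) (shift L (n / p))) (sym (next-padding π w u))
      (perfect-padding (child w 0) (next u) (rotate-injective w π-injective) (perfect-next P) L)

  perfect-unpadding : ∀ {M n π} w (u : Forest M) → InjectiveOn π → Perfect (padding π w u) n → Perfect u n
  perfect-unpadding w u π-injective P zero = size-unpad π-injective w u (P 0)
  perfect-unpadding {n = n} {π} w u π-injective P (suc L) =
    perfect-unpadding (child w 0) (next u) (rotate-injective w π-injective)
      (subst (λ v → Perfect v (n / p)) (next-padding π w u) (perfect-next P)) L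

  unpad-map : ∀ {M w} {u v : Forest M} → v ⊑ Vec.map (pad-token id w) u → All ((w , 0) ≢_) v →
    ∃[ v′ ] (v′ ⊑ u × Vec.map (pad-token id w) v′ ≡ v)
  unpad-map {u = []} [] [] = [] , [] , refl
  unpad-map {w = w} {(c , a) ∷ u} {(_ , b) ∷ v} (b≤ ∷ v⊑) (≢w0 ∷ w0∉v) with unpad-map v⊑ w0∉v | c ℕ.≟ w in c≟w
  ... | v′ , v′⊑u , eq | no _ = (c , b) ∷ v′ , subst (b ≤_) (ℕₚ.+-identityʳ a) b≤ ∷ v′⊑u , cong₂ _∷_ (cong (c ,_) unraised) eq
    where
    unraised : b + ind c w ≡ b
    unraised rewrite c≟w = ℕₚ.+-identityʳ b
  unpad-map {w = w} {(c , a) ∷ u} {(_ , zero) ∷ v} (b≤ ∷ v⊑) (≢w0 ∷ w0∉v) | v′ , v′⊑u , eq | yes refl = contradiction refl ≢w0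
  unpad-map {w = w} {(c , a) ∷ u} {(_ , suc b) ∷ v} (b≤ ∷ v⊑) (≢w0 ∷ w0∉v) | v′ , v′⊑u , eq | yes refl =
    (c , b) ∷ v′ , ℕₚ.≤-pred (subst (suc b ≤_) (ℕₚ.+-comm a 1) b≤) ∷ v′⊑u , cong₂ _∷_ (cong (c ,_) raised) eq
    where
    raised : b + ind c c ≡ suc b
    raised = trans (cong (b +_) (ind-refl c)) (ℕₚ.+-comm b 1)

  -- The added token has value 0 and cannot descend; distinctness then keeps every other token of
  -- colour `w` at 1 or above, so the shift can be undone.
  unpad : ∀ {M w} {u : Forest M} {v} → v ⊑ pad w u → Unique v → ∃[ v′ ] (v′ ⊑ u × pad w v′ ≡ v)
  unpad (z≤n ∷ v⊑) (w0∉v ∷ _) with unpad-map v⊑ w0∉v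
  ... | v′ , v′⊑u , eq = v′ , v′⊑u , cong (_ ∷_) eq

  coloured-pad : ∀ {M Q w} {u : Forest M} → w < Q → Coloured Q u → Coloured Q (pad w u)
  coloured-pad {Q = Q} {w} w<Q u<Q = w<Q ∷ go u<Q
    where
    go : ∀ {M} {u : Forest M} → Coloured Q u → Coloured Q (Vec.map (pad-token id w) u)
    go [] = []
    go (c<Q ∷ u<Q) = c<Q ∷ go u<Q

  -- Lowering the lowest digit

  0<p : 0 < p
  0<p = ℕₚ.<⇒≤ 1<p

  -- The last component guarantees that a descent by more than one box does not jump over the sizes
  -- p n′ , … , p n′ + p − 1.
  Drops : ∀ {M} → Forest M → ℕ → ℕ → Set
  Drops u n′ n = ∃[ v ] ∃[ m ] ∃[ d ]
    (v ⊑ u × Perfect (next v) n′ × HasSize v m × n ≡ m + suc d × (d ≡ 0 ⊎ p * n′ + p ≤ suc m))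

  -- With `suc d` boxes removed from an energy of at least `1 + p * d`, at least (p - 1) d are left,
  -- which is at least p - 1 as soon as `d` is not 0.
  no-jump : ∀ {m n′ e} d → p * n′ + e ≡ m + suc d → 1 + p * d ≤ e → d ≡ 0 ⊎ p * n′ + p ≤ suc m
  no-jump zero _ _ = inj₁ refl
  no-jump {m} {n′} {e} (suc d) eq bound = inj₂ (ℕₚ.+-cancelʳ-≤ (suc d) _ _ (begin
    p * n′ + p + suc d        ≡⟨ lem₁ (p * n′) p d ⟩
    p * n′ + (1 + (p + d))    ≤⟨ ℕₚ.+-monoʳ-≤ (p * n′) (s≤s (ℕₚ.+-monoʳ-≤ p (ℕₚ.m≤n*m d p))) ⟩
    p * n′ + (1 + (p + p * d))  ≡⟨ cong (λ k → p * n′ + (1 + k)) (sym (ℕₚ.*-suc p d)) ⟩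
    p * n′ + (1 + p * suc d)  ≤⟨ ℕₚ.+-monoʳ-≤ (p * n′) bound ⟩
    p * n′ + e                ≡⟨ eq ⟩
    m + suc (suc d)           ≡⟨ ℕₚ.+-suc m (suc d) ⟩
    suc m + suc d             ∎))
    where
    open ℕₚ.≤-Reasoning
    lem₁ : ∀ x p d → x + p + suc d ≡ x + (1 + (p + d))
    lem₁ = ℕR.solve-∀

  -- Swapping the two runners keeps the next level perfect with the same `n′`. By `descent` it
  -- lowers `suc d` values by one each, so the size falls by `suc d`.
  drop-ascent : ∀ {M Q n n′} (u : Forest M) w r → Coloured Q u → HasSize u n → Perfect (next u) n′ →
    w < Q → suc r < p → children u w r < children u w (suc r) → Drops u n′ n
  drop-ascent {Q = Q} {n} {n′} u w r u<Q size P w<Q 1+r<p ascent = drop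
    (swap (val (next u)) (next u) (child w (suc r)) (child w r) (suc d) (coloured-next u<Q) (bounded-power (next u)) P
      (child< w<Q 1+r<p) (child< w<Q (ℕₚ.<⇒≤ 1+r<p))
      (λ eq → ℕₚ.1+n≢n (proj₂ (child-injective w w 1+r<p (ℕₚ.<⇒≤ 1+r<p) eq))) excess)
    where
    d = children u w (suc r) ∸ suc (children u w r)
    excess : children u w (suc r) ≡ children u w r + suc d
    excess = trans (sym (ℕₚ.m+[n∸m]≡n ascent)) (sym (ℕₚ.+-suc _ d))
    drop : ∃[ v ] (Recolour (child w (suc r)) (child w r) (suc d) (next u) v × Perfect v n′) → Drops u n′ n
    drop (v′ , rec , P′) = v , m , d , v⊑u , subst (λ x → Perfect x n′) (sym (next∘prev v′)) P′ , size-v , n≡ ,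
      no-jump d (trans (sym (size-energy u<Q size (P 0))) n≡)
        (ℕₚ.≤-trans (energy-ascent p (children u w) r d 1+r<p excess) (term≤∑ Q w (energyℕ p ∘ children u) w<Q))
      where
      open ≡-Reasoning
      v = prev v′
      v⊑u : v ⊑ u
      v⊑u = subst (v ⊑_) (prev∘next u) (proj₁ (descent w 1+r<p rec))
      val≡ : val u ≡ val v + suc d
      val≡ = subst (λ x → val x ≡ val v + suc d) (prev∘next u) (proj₂ (descent w 1+r<p rec))
      m = p * n′ + total-energy Q v
      size-v : HasSize v m
      size-v = size-lift (⊑-coloured v⊑u u<Q) (subst (λ x → HasSize x n′) (sym (next∘prev v′)) (P′ 0))
      n≡ : n ≡ m + suc d
      n≡ = ℕₚ.+-cancelʳ-≡ (pairs u) _ _ (begin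
        n + pairs u            ≡⟨ size ⟨
        val u                  ≡⟨ val≡ ⟩
        val v + suc d          ≡⟨ cong (_+ suc d) (trans size-v (cong (m +_) (⊑-pairs v⊑u))) ⟩
        m + pairs u + suc d    ≡⟨ lem m (pairs u) (suc d) ⟩
        m + suc d + pairs u    ∎)
        where
        lem : ∀ m q d → m + q + d ≡ m + d + q
        lem = ℕR.solve-∀

  id-injective : InjectiveOn id
  id-injective eq = eq

  -- Raising the values rotates the last runner onto runner 0, where the new token joins it.
  children-pad-0 : ∀ {M} w (u : Forest M) → children (pad w u) w 0 ≡ suc (children u w (pred p))
  children-pad-0 w u = begin
    cnt (child w 0) (next (pad w u))                                  ≡⟨ cong (cnt (child w 0)) (next-padding id w u) ⟩
    ind (child w 0) (child w 0) + cnt (child w 0) raised              ≡⟨ cong₂ _+_ (ind-refl (child w 0)) (cong (λ z → cnt z raised) (sym back)) ⟩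
    suc (cnt (rotate id w (child w (pred p))) raised)                 ≡⟨ cong suc (cnt-pad (rotate-injective w id-injective) (child w 0) (child w (pred p)) (next u)) ⟩
    suc (children u w (pred p))                                       ∎
    where
    open ≡-Reasoning
    raised = Vec.map (pad-token (rotate id w) (child w 0)) (next u)
    back : rotate id w (child w (pred p)) ≡ child w 0
    back = trans (rotate-hit id w w refl (ℕₚ.≤-reflexive (ℕₚ.suc-pred p)))
                 (cong (child w) (trans (cong (_% p) (ℕₚ.suc-pred p)) (n%n≡0 p)))

  children-pad-1 : ∀ {M} w (u : Forest M) → children (pad w u) w 1 ≡ children u w 0
  children-pad-1 w u = begin
    cnt (child w 1) (next (pad w u))                                  ≡⟨ cong (cnt (child w 1)) (next-padding id w u) ⟩
    ind (child w 0) (child w 1) + cnt (child w 1) raised              ≡⟨ cong₂ _+_ (ind-≢ 0≢1) (cong (λ z → cnt z raised) (sym forth)) ⟩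
    cnt (rotate id w (child w 0)) raised                              ≡⟨ cnt-pad (rotate-injective w id-injective) (child w 0) (child w 0) (next u) ⟩
    children u w 0                                                    ∎
    where
    open ≡-Reasoning
    raised = Vec.map (pad-token (rotate id w) (child w 0)) (next u)
    forth : rotate id w (child w 0) ≡ child w 1
    forth = trans (rotate-hit id w w refl 0<p) (cong (child w) (m<n⇒m%n≡m 1<p))
    0≢1 : child w 0 ≢ child w 1
    0≢1 eq with proj₂ (child-injective w w 0<p 1<p eq)
    ... | ()

  perfect-next-pad⁺ : ∀ {M n w} (u : Forest M) → Perfect (next u) n → Perfect (next (pad w u)) n
  perfect-next-pad⁺ {n = n} {w} u P = subst (λ v → Perfect v n) (sym (next-padding id w u))
    (perfect-padding (child w 0) (next u) (rotate-injective w id-injective) P)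

  perfect-next-pad⁻ : ∀ {M n w} (u : Forest M) → Perfect (next (pad w u)) n → Perfect (next u) n
  perfect-next-pad⁻ {n = n} {w} u P = perfect-unpadding (child w 0) (next u) (rotate-injective w id-injective)
    (subst (λ v → Perfect v n) (next-padding id w u) P)

  drops-unpad : ∀ {M n n′ w} {u : Forest M} → Drops (pad w u) n′ n → Drops u n′ n
  drops-unpad {w = w} (v⁺ , m , d , v⁺⊑u⁺ , P , size , n≡ , jump)
    with unpad v⁺⊑u⁺ (unique-next⁻ v⁺ (perfect⇒unique P))
  ... | v , v⊑u , refl = v , m , d , v⊑u , perfect-next-pad⁻ v P , size-unpad id-injective w v size , n≡ , jump

  drop-step : ∀ {M Q n n′} (u : Forest M) → Coloured Q u → HasSize u n → Perfect (next u) n′ →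
    total-energy Q u ≢ 0 → Drops u n′ n
  drop-step {Q = Q} u u<Q size P E≢0 with ∑≢0⇒term≢0 Q (λ w → energyℕ p (children u w)) E≢0
  ... | w , w<Q , E≢0′ with energy≢0⇒ p (children u w) E≢0′
  ...   | inj₁ (r , 1+r<p , ascent) = drop-ascent u w r u<Q size P w<Q 1+r<p ascent
  -- Padding puts `suc (children u w (pred p))` on runner 0 and `children u w 0` on runner 1, so a
  -- difference of 2 across the wrap-around is an ordinary ascent at `r = 0`.
  ...   | inj₂ wrap = drops-unpad (drop-ascent (pad w u) w 0 (coloured-pad w<Q u<Q) (size-pad id-injective w u size)
    (perfect-next-pad⁺ u P) w<Q 1<p
    (subst₂ _<_ (sym (children-pad-0 w u)) (sym (children-pad-1 w u)) (subst (_≤ children u w 0) (ℕₚ.+-comm _ 2) wrap)))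

  DropTo : ∀ {M} → Forest M → ℕ → ℕ → Set
  DropTo u n′ t = ∃[ v ] (v ⊑ u × HasSize v (p * n′ + t) × Perfect (next v) n′)

  -- As long as the energy exceeds `t`, it is nonzero and `drop-step` applies. A step by one cannot
  -- miss `t`, and a longer step leaves energy at least p - 1, which is still at least `t`.
  drop : ∀ {M Q n′} t c (u : Forest M) → t < p → t ≤ c → Coloured Q u → HasSize u (p * n′ + c) → Perfect (next u) n′ →
    DropTo u n′ t
  drop {n′ = n′} t c u t<p = go c c u ℕₚ.≤-refl
    where
    go : ∀ fuel {M Q} c (u : Forest M) → c ≤ fuel → t ≤ c → Coloured Q u → HasSize u (p * n′ + c) → Perfect (next u) n′ →
      DropTo u n′ t
    go fuel c u c≤fuel t≤c u<Q size P with t ℕ.≟ c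
    ... | yes refl = u , ⊑-refl u , size , P
    go zero c u c≤fuel t≤c u<Q size P | no t≢c =
      contradiction (trans (ℕₚ.n≤0⇒n≡0 (ℕₚ.≤-trans t≤c c≤fuel)) (sym (ℕₚ.n≤0⇒n≡0 c≤fuel))) t≢c
    go (suc fuel) {Q = Q} c u c≤fuel t≤c u<Q size P | no t≢c = descend
      (drop-step u u<Q size P (λ E≡0 → t≢c (trans (ℕₚ.n≤0⇒n≡0 (subst (t ≤_) (trans c≡E E≡0) t≤c)) (sym (trans c≡E E≡0)))))
      where
      c≡E : c ≡ total-energy Q u
      c≡E = ℕₚ.+-cancelˡ-≡ (p * n′) _ _ (size-energy u<Q size (P 0))
      further : ∀ {v} → v ⊑ u → DropTo v n′ t → DropTo u n′ t
      further v⊑u (v′ , v′⊑v , rest) = v′ , ⊑-trans v′⊑v v⊑u , rest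
      descend : Drops u n′ (p * n′ + c) → DropTo u n′ t
      descend (v , m , d , v⊑u , P′ , size′ , n≡ , jump) = further v⊑u
        (go fuel c′ v (ℕₚ.≤-pred (ℕₚ.≤-trans c′<c c≤fuel)) (t≤c′ jump) (⊑-coloured v⊑u u<Q) (subst (HasSize v) m≡ size′) P′)
        where
        c′ = total-energy Q v
        m≡ : m ≡ p * n′ + c′
        m≡ = size-energy (⊑-coloured v⊑u u<Q) size′ (P′ 0)
        c≡ : c ≡ c′ + suc d
        c≡ = ℕₚ.+-cancelˡ-≡ (p * n′) _ _ (trans n≡ (trans (cong (_+ suc d) m≡) (ℕₚ.+-assoc (p * n′) c′ (suc d))))
        c′<c : c′ < c
        c′<c = ℕₚ.≤-trans (ℕₚ.m≤m+n (suc c′) d) (ℕₚ.≤-reflexive (sym (trans c≡ (ℕₚ.+-suc c′ d))))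
        t≤c′ : d ≡ 0 ⊎ p * n′ + p ≤ suc m → t ≤ c′
        t≤c′ (inj₁ d≡0) = ℕₚ.≤-pred (subst (t <_) (trans c≡ (trans (cong (λ k → c′ + suc k) d≡0) (ℕₚ.+-comm c′ 1))) (ℕₚ.≤∧≢⇒< t≤c t≢c))
        t≤c′ (inj₂ le) = ℕₚ.≤-pred (ℕₚ.≤-trans t<p (ℕₚ.+-cancelˡ-≤ (p * n′) _ _
          (ℕₚ.≤-trans le (ℕₚ.≤-reflexive (trans (cong suc m≡) (sym (ℕₚ.+-suc (p * n′) c′)))))))

  perfect-lift : ∀ {M n′ t} {u : Forest M} → t < p → HasSize u (p * n′ + t) → Perfect (next u) n′ → Perfect u (p * n′ + t)
  perfect-lift {n′ = n′} {t} {u} t<p size P = perfect-cons size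
    (subst (Perfect (next u)) (sym (trans (cong (λ k → (k + t) / p) (ℕₚ.*-comm p n′)) ([cp+r]/p n′ t<p))) P)

  -- Borrowing from the higher digits

  data FirstNonzeroDigit : ℕ → ℕ → Set where
    here  : ∀ {n} → n % p ≢ 0 → FirstNonzeroDigit n 0
    there : ∀ {n k} → n % p ≡ 0 → FirstNonzeroDigit (n / p) k → FirstNonzeroDigit n (suc k)

  n/p<n : ∀ {n} → n ≢ 0 → n / p < n
  n/p<n {n} n≢0 = m/n<m n p {{ℕ.≢-nonZero n≢0}} 1<p

  n≡p*[n/p] : ∀ n → n % p ≡ 0 → n ≡ p * (n / p)
  n≡p*[n/p] n n%p≡0 = trans (div-mod n) (trans (cong (n / p * p +_) n%p≡0) (trans (ℕₚ.+-identityʳ _) (ℕₚ.*-comm (n / p) p)))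

  first-nonzero-digit : ∀ n → n ≢ 0 → ∃ (FirstNonzeroDigit n)
  first-nonzero-digit n = go n n ℕₚ.≤-refl
    where
    go : ∀ fuel n → n ≤ fuel → n ≢ 0 → ∃ (FirstNonzeroDigit n)
    go zero n n≤0 n≢0 = contradiction (ℕₚ.n≤0⇒n≡0 n≤0) n≢0
    go (suc fuel) n n≤ n≢0 with n % p ℕ.≟ 0
    ... | no ≢0 = 0 , here ≢0
    ... | yes ≡0 with go fuel (n / p) (ℕₚ.≤-pred (ℕₚ.≤-trans (n/p<n n≢0) n≤))
                        (λ n/p≡0 → n≢0 (trans (n≡p*[n/p] n ≡0) (trans (cong (p *_) n/p≡0) (ℕₚ.*-zeroʳ p))))
    ...   | k , first = suc k , there ≡0 first

  first-digit≢0 : ∀ {n k} → FirstNonzeroDigit n k → shift k n % p ≢ 0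
  first-digit≢0 (here ≢0) = ≢0
  first-digit≢0 (there _ first) = first-digit≢0 first

  first⇒≢0 : ∀ {n k} → FirstNonzeroDigit n k → n ≢ 0
  first⇒≢0 (here ≢0) refl = ≢0 (m*n%n≡0 0 p)
  first⇒≢0 {n} (there _ first) refl = first⇒≢0 first (0/n≡0 p)

  -- The share of the colours descending from `w` in the energy found `k` levels below; over all
  -- colours of a perfect forest the shares add up to digit `k`.
  deep-energy : ∀ {M} → ℕ → ℕ → Forest M → ℕ
  deep-energy zero w u = energyℕ p (children u w)
  deep-energy (suc k) w u = ∑ p (λ s → deep-energy k (child w s) (next u))

  ∑-deep-energy : ∀ k {M Q n} (u : Forest M) → Coloured Q u → Perfect u n → ∑ Q (λ w → deep-energy k w u) ≡ shift k n % p
  ∑-deep-energy zero u u<Q P = perfect-energy u<Q P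
  ∑-deep-energy (suc k) {Q = Q} u u<Q P = trans (sym (∑-block Q p (λ z → deep-energy k z (next u))))
    (∑-deep-energy k (next u) (coloured-next u<Q) (perfect-next P))

  Lends : ∀ {M} → ℕ → ℕ → Forest M → ℕ → Set
  Lends x y u n = ∃[ v ] (Recolour x y 1 u v × Perfect v (pred n))

  -- The moved token loses its partners in `x`, one fewer than the common count, and gains the full
  -- count in `y`. This makes one new pair and costs one unit of size.
  recolour-one-size : ∀ {x y M Q m n} {u v : Forest M} → Coloured Q u → x < Q → y < Q → x ≢ y →
    cnt x u ≡ cnt y u → Recolour x y 1 u v → HasSize u n → HasSize v m → n ≡ suc m
  recolour-one-size {x} {y} {m = m} {n} {u} {v} u<Q x<Q y<Q x≢y same rec size size′ = ℕₚ.+-cancelʳ-≡ (pairs u) _ _ (begin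
    n + pairs u         ≡⟨ trans (sym size) (trans (sym (recolour-val rec)) size′) ⟩
    m + pairs v         ≡⟨ cong (m +_) pairs≡ ⟩
    m + suc (pairs u)   ≡⟨ ℕₚ.+-suc m (pairs u) ⟩
    suc m + pairs u     ∎)
    where
    open ≡-Reasoning
    pairs≡ : pairs v ≡ suc (pairs u)
    pairs≡ = ℕₚ.+-cancelʳ-≡ (cnt x v) _ _ (begin
      pairs v + cnt x v         ≡⟨ cong (pairs v +_) (ℕₚ.*-identityˡ (cnt x v)) ⟨
      pairs v + 1 * cnt x v     ≡⟨ recolour-pairs u<Q x<Q y<Q x≢y rec ⟩
      pairs u + 1 * cnt y u     ≡⟨ cong (pairs u +_) (trans (ℕₚ.*-identityˡ (cnt y u)) (trans (sym same) (recolour-cnt-source x≢y rec))) ⟩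
      pairs u + (cnt x v + 1)   ≡⟨ lem (pairs u) (cnt x v) ⟩
      suc (pairs u) + cnt x v   ∎)
      where
      lem : ∀ q c → q + (c + 1) ≡ suc q + c
      lem = ℕR.solve-∀

  -- Equal totals force the opposite inequality at some other residue, and narrowness then makes the
  -- excess at `j` exactly 1, so a swap below moves a single token. The next level keeps `n / p`
  -- while the size falls by one, so the unit comes out of a positive last digit.
  lends-within : ∀ {M Q n x y} (u : Forest M) j → Coloured Q u → Perfect u n → x < Q → y < Q → x ≢ y → cnt x u ≡ cnt y u →
    j < p → children u y j < children u x j → Lends x y u n × n % p ≢ 0
  lends-within {Q = Q} {n} {x} {y} u j u<Q P x<Q y<Q x≢y same j<p yj<xj = below (search< p (children u x) (children u y))
    where
    ∑x≡∑y : ∑ p (children u x) ≡ ∑ p (children u y)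
    ∑x≡∑y = trans (sym (cnt-children x u)) (trans same (cnt-children y u))
    lend : children u x j ≡ children u y j + 1 → ∃[ v ] (Recolour (child x j) (child y j) 1 (next u) v × Perfect v (n / p)) →
      Lends x y u n × n % p ≢ 0
    lend excess (v′ , rec′ , P′) = (v , rec , subst (Perfect v) (cong pred (sym n≡)) (perfect-lift E<p size Pv)) , n%p≢0
      where
      v = prev v′
      rec : Recolour x y 1 u v
      rec = subst (λ w → Recolour x y 1 w v) (prev∘next u) (recolour-prev j<p rec′)
      Pv : Perfect (next v) (n / p)
      Pv = subst (λ w → Perfect w (n / p)) (sym (next∘prev v′)) P′
      E = total-energy Q v
      size : HasSize v (p * (n / p) + E)
      size = size-lift (recolour-coloured y<Q rec u<Q) (Pv 0)
      n≡ : n ≡ suc (p * (n / p) + E)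
      n≡ = recolour-one-size u<Q x<Q y<Q x≢y same rec (P 0) size
      n%p≡ : n % p ≡ suc E
      n%p≡ = ℕₚ.+-cancelˡ-≡ (p * (n / p)) _ _ (trans (cong (_+ n % p) (ℕₚ.*-comm p (n / p)))
        (trans (sym (div-mod n)) (trans n≡ (sym (ℕₚ.+-suc _ E)))))
      E<p : E < p
      E<p = ℕₚ.<-trans (ℕₚ.≤-reflexive (sym n%p≡)) (m%n<n n p)
      n%p≢0 : n % p ≢ 0
      n%p≢0 eq = contradiction (trans (sym n%p≡) eq) (λ ())
    below : (∃[ i ] (i < p × children u x i < children u y i)) ⊎ (∀ i → i < p → children u y i ≤ children u x i) →
      Lends x y u n × n % p ≢ 0
    below (inj₂ y≤x) = contradiction (sym ∑x≡∑y) (ℕₚ.<⇒≢ (∑-strict p j j<p y≤x yj<xj))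
    below (inj₁ (i , i<p , xi<yi)) = lend excess
      (swap (val (next u)) (next u) (child x j) (child y j) 1 (coloured-next u<Q) (bounded-power (next u)) (perfect-next P)
        (child< x<Q j<p) (child< y<Q j<p) (x≢y ∘ proj₁ ∘ child-injective x y j<p j<p) excess)
      where
      excess : children u x j ≡ children u y j + 1
      excess = ℕₚ.≤-antisym (ℕₚ.+-cancelʳ-≤ (suc (children u x i)) _ _ (begin
        children u x j + suc (children u x i)   ≤⟨ ℕₚ.+-monoʳ-≤ (children u x j) xi<yi ⟩
        children u x j + children u y i         ≤⟨ children-narrow u<Q P x<Q y<Q x≢y j i j<p i<p ⟩
        children u x i + children u y j + 2     ≡⟨ lem (children u x i) (children u y j) ⟩
        children u y j + 1 + suc (children u x i) ∎))
        (subst (_≤ children u x j) (ℕₚ.+-comm 1 (children u y j)) yj<xj)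
        where
        open ℕₚ.≤-Reasoning
        lem : ∀ a b → a + b + 2 ≡ b + 1 + suc a
        lem = ℕR.solve-∀

  compare-children : ∀ {M Q n x y} (u : Forest M) → Coloured Q u → Perfect u n → x < Q → y < Q → x ≢ y → cnt x u ≡ cnt y u →
    (Lends x y u n × n % p ≢ 0) ⊎ (∀ j → j < p → children u x j ≡ children u y j)
  compare-children {x = x} {y} u u<Q P x<Q y<Q x≢y same with search< p (children u y) (children u x)
  ... | inj₁ (j , j<p , yj<xj) = inj₁ (lends-within u j u<Q P x<Q y<Q x≢y same j<p yj<xj)
  ... | inj₂ x≤y = inj₂ λ j j<p → ℕₚ.≤-antisym (x≤y j j<p) (ℕₚ.≮⇒≥ λ xj<yj →
    ℕₚ.<⇒≢ (∑-strict p j j<p x≤y xj<yj) (trans (sym (cnt-children x u)) (trans same (cnt-children y u))))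

  LendsInTuple : ∀ {M} → (ℕ → ℕ) → Forest M → ℕ → Set
  LendsInTuple x u n = ∃[ s ] (suc s < p × Lends (x (suc s)) (x s) u n)

  module _ {M Q n} (u : Forest M) (x : ℕ → ℕ) (u<Q : Coloured Q u) (P : Perfect u n)
    (x<Q : ∀ s → s < p → x s < Q) (distinct : ∀ r s → r < s → s < p → x r ≢ x s)
    (same : ∀ s → s < p → cnt (x s) u ≡ cnt (x 0) u) where

    compare-tuple : ∀ b → b < p → (LendsInTuple x u n × n % p ≢ 0) ⊎
      (∀ s → s ≤ b → ∀ j → j < p → children u (x s) j ≡ children u (x 0) j)
    compare-tuple zero _ = inj₂ λ { zero z≤n j _ → refl }
    compare-tuple (suc b) 1+b<p = both (compare-tuple b b<p)
      (compare-children u u<Q P (x<Q (suc b) 1+b<p) (x<Q b b<p) (distinct b (suc b) ℕₚ.≤-refl 1+b<p ∘ sym)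
        (trans (same (suc b) 1+b<p) (sym (same b b<p))))
      where
      b<p : b < p
      b<p = ℕₚ.<⇒≤ 1+b<p
      both : (LendsInTuple x u n × n % p ≢ 0) ⊎ (∀ s → s ≤ b → ∀ j → j < p → children u (x s) j ≡ children u (x 0) j) →
        (Lends (x (suc b)) (x b) u n × n % p ≢ 0) ⊎ (∀ j → j < p → children u (x (suc b)) j ≡ children u (x b) j) →
        (LendsInTuple x u n × n % p ≢ 0) ⊎ (∀ s → s ≤ suc b → ∀ j → j < p → children u (x s) j ≡ children u (x 0) j)
      both (inj₁ found) _ = inj₁ found
      both (inj₂ _) (inj₁ (lends , n%p≢0)) = inj₁ ((b , 1+b<p , lends) , n%p≢0)
      both (inj₂ equal) (inj₂ equal′) = inj₂ step
        where
        step : ∀ s → s ≤ suc b → ∀ j → j < p → children u (x s) j ≡ children u (x 0) j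
        step s s≤1+b j j<p with s ℕ.≟ suc b
        ... | yes refl = trans (equal′ j j<p) (equal b ℕₚ.≤-refl j j<p)
        ... | no s≢1+b = equal s (ℕₚ.≤-pred (ℕₚ.≤∧≢⇒< s≤1+b s≢1+b)) j j<p

    -- The `p` energies coincide, and their sum is bounded by the total energy, which is below `p`.
    equal-energies-vanish : (∀ s → s < p → ∀ j → j < p → children u (x s) j ≡ children u (x 0) j) →
      ∑ p (λ s → energyℕ p (children u (x s))) ≡ 0
    equal-energies-vanish equal = trans ∑≡ (trans (cong (p *_) e≡0) (ℕₚ.*-zeroʳ p))
      where
      e = energyℕ p (children u (x 0))
      ∑≡ : ∑ p (λ s → energyℕ p (children u (x s))) ≡ p * e
      ∑≡ = trans (∑-cong p (λ s s<p → energyℕ-cong p (equal s s<p))) (∑-const p e)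
      pe<p : p * e < p
      pe<p = ℕₚ.≤-<-trans (ℕₚ.≤-trans (ℕₚ.≤-reflexive (sym ∑≡))
        (ℕₚ.≤-trans (∑-injective p Q x (energyℕ p ∘ children u) x<Q distinct) (ℕₚ.≤-reflexive (perfect-energy u<Q P)))) (m%n<n n p)
      e≡0 : e ≡ 0
      e≡0 = ℕₚ.n<1⇒n≡0 (ℕₚ.*-cancelˡ-< p e 1 (subst (p * e <_) (sym (ℕₚ.*-identityʳ p)) pe<p))

  -- If the size and the size of the next level both decrease by one and the last digit was 0, the
  -- new energy has to be p - 1.
  borrow-size : ∀ {n E} → n % p ≡ 0 → n / p ≢ 0 → n ≡ suc (p * pred (n / p) + E) → suc E ≡ p
  borrow-size {n} {E = E} n%p≡0 n/p≢0 n≡ = ℕₚ.+-cancelˡ-≡ (p * pred (n / p)) _ _ (begin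
    p * pred (n / p) + suc E      ≡⟨ ℕₚ.+-suc _ E ⟩
    suc (p * pred (n / p) + E)    ≡⟨ n≡ ⟨
    n                             ≡⟨ n≡p*[n/p] n n%p≡0 ⟩
    p * (n / p)                   ≡⟨ cong (p *_) (ℕₚ.suc-pred (n / p) {{ℕ.≢-nonZero n/p≢0}}) ⟨
    p * suc (pred (n / p))        ≡⟨ ℕₚ.*-suc p _ ⟩
    p + p * pred (n / p)          ≡⟨ ℕₚ.+-comm p _ ⟩
    p * pred (n / p) + p          ∎)
    where open ≡-Reasoning

  -- Two neighbouring colours of the tuple with different runners lend at once. If all runners
  -- agree, then for every residue `j` the colours `child (x s) j` form a tuple with equal counts
  -- one level down, and the induction on the first nonzero digit continues there. At `k = 0`
  -- agreement would make the energies vanish.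
  lends : ∀ k {M Q n} (u : Forest M) (x : ℕ → ℕ) → Coloured Q u → Perfect u n → FirstNonzeroDigit n k →
    (∀ s → s < p → x s < Q) → (∀ r s → r < s → s < p → x r ≢ x s) → (∀ s → s < p → cnt (x s) u ≡ cnt (x 0) u) →
    ∑ p (λ s → deep-energy k (x s) u) ≢ 0 → LendsInTuple x u n
  lends k {Q = Q} {n} u x u<Q P first x<Q distinct same ∑≢0 =
    decide k first ∑≢0 (compare-tuple u x u<Q P x<Q distinct same (pred p) (ℕₚ.≤-reflexive (ℕₚ.suc-pred p)))
    where
    s≤pred : ∀ {s} → s < p → s ≤ pred p
    s≤pred {s} s<p = ℕₚ.≤-pred (subst (s <_) (sym (ℕₚ.suc-pred p)) s<p)
    decide : ∀ k → FirstNonzeroDigit n k → ∑ p (λ s → deep-energy k (x s) u) ≢ 0 →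
      (LendsInTuple x u n × n % p ≢ 0) ⊎ (∀ s → s ≤ pred p → ∀ j → j < p → children u (x s) j ≡ children u (x 0) j) →
      LendsInTuple x u n
    decide k first ∑≢0 (inj₁ (found , _)) = found
    decide zero first ∑≢0 (inj₂ equal) = contradiction
      (equal-energies-vanish u x u<Q P x<Q distinct same (λ s s<p → equal s (s≤pred s<p))) ∑≢0
    decide (suc k) (there n%p≡0 first) ∑≢0 (inj₂ equal) = descend
      -- Grouping the deep energy by residue instead of by colour of the tuple finds a residue whose
      -- tuple carries some of it.
      (∑≢0⇒term≢0 p _ (λ eq → ∑≢0 (trans (∑-swap p p (λ s j → deep-energy k (child (x s) j) (next u))) eq)))
      where
      raise : ∀ {j} → j < p → LendsInTuple (λ s → child (x s) j) (next u) (n / p) → LendsInTuple x u n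
      raise j<p (s , 1+s<p , v′ , rec′ , P′) = s , 1+s<p , v , rec , subst (Perfect v) (cong pred (sym n≡)) (perfect-lift E<p size Pv)
        where
        v = prev v′
        s<p = ℕₚ.<⇒≤ 1+s<p
        rec : Recolour (x (suc s)) (x s) 1 u v
        rec = subst (λ w → Recolour (x (suc s)) (x s) 1 w v) (prev∘next u) (recolour-prev j<p rec′)
        Pv : Perfect (next v) (pred (n / p))
        Pv = subst (λ w → Perfect w (pred (n / p))) (sym (next∘prev v′)) P′
        E = total-energy Q v
        size : HasSize v (p * pred (n / p) + E)
        size = size-lift (recolour-coloured (x<Q s s<p) rec u<Q) (Pv 0)
        n≡ : n ≡ suc (p * pred (n / p) + E)
        n≡ = recolour-one-size u<Q (x<Q (suc s) 1+s<p) (x<Q s s<p) (distinct s (suc s) ℕₚ.≤-refl 1+s<p ∘ sym)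
          (trans (same (suc s) 1+s<p) (sym (same s s<p))) rec (P 0) size
        E<p : E < p
        E<p = ℕₚ.≤-reflexive (borrow-size n%p≡0 (first⇒≢0 first) n≡)
      descend : ∃[ j ] (j < p × ∑ p (λ s → deep-energy k (child (x s) j) (next u)) ≢ 0) → LendsInTuple x u n
      descend (j , j<p , ∑≢0′) = raise j<p (lends k (next u) (λ s → child (x s) j) (coloured-next u<Q) (perfect-next P) first
        (λ s s<p → child< (x<Q s s<p) j<p)
        (λ r s r<s s<p eq → distinct r s r<s s<p (proj₁ (child-injective (x r) (x s) j<p j<p eq)))
        (λ s s<p → equal s (s≤pred s<p) j j<p) ∑≢0′)

  Lowers : ∀ {M} → Forest M → ℕ → Set
  Lowers u m = ∃[ v ] (v ⊑ u × Perfect v m)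

  -- A last digit 0 makes all energies vanish, and with counts divisible by `p` the runners of each
  -- colour are equally full. They therefore form a tuple for `lends`, and the token lent between
  -- adjacent runners descends by one.
  borrow-uniform : ∀ {M Q n k} (u : Forest M) → Coloured Q u → Perfect u n → n % p ≡ 0 → FirstNonzeroDigit (n / p) k →
    (∀ w → w < Q → p ∣ cnt w u) → Lowers u (pred n)
  borrow-uniform {Q = Q} {n} {k} u u<Q P n%p≡0 first p∣cnt = choose
    (∑≢0⇒term≢0 Q _ (λ eq → first-digit≢0 first
      (trans (sym (∑-deep-energy k (next u) (coloured-next u<Q) (perfect-next P))) (trans (∑-block Q p _) eq))))
    where
    uniform : ∀ w → w < Q → ∀ s → s < p → children u w s ≡ children u w 0
    uniform w w<Q = energy≡0⇒uniform p (children u w)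
      (ℕₚ.n≤0⇒n≡0 (ℕₚ.≤-trans (term≤∑ Q w (energyℕ p ∘ children u) w<Q) (ℕₚ.≤-reflexive (trans (perfect-energy u<Q P) n%p≡0))))
      (subst (p ∣_) (cnt-children w u) (p∣cnt w w<Q))
    raise : ∀ {w} → w < Q → LendsInTuple (child w) (next u) (n / p) → Lowers u (pred n)
    raise {w} w<Q (s , 1+s<p , v′ , rec , P′) = v , v⊑u , subst (Perfect v) (cong pred (sym n≡)) (perfect-lift E<p size Pv)
      where
      open ≡-Reasoning
      v = prev v′
      v⊑u : v ⊑ u
      v⊑u = subst (v ⊑_) (prev∘next u) (proj₁ (descent w 1+s<p rec))
      val≡ : val u ≡ val v + 1
      val≡ = subst (λ x → val x ≡ val v + 1) (prev∘next u) (proj₂ (descent w 1+s<p rec))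
      Pv : Perfect (next v) (pred (n / p))
      Pv = subst (λ w → Perfect w (pred (n / p))) (sym (next∘prev v′)) P′
      E = total-energy Q v
      m = p * pred (n / p) + E
      size : HasSize v m
      size = size-lift (⊑-coloured v⊑u u<Q) (Pv 0)
      n≡ : n ≡ suc m
      n≡ = ℕₚ.+-cancelʳ-≡ (pairs u) _ _ (begin
        n + pairs u         ≡⟨ P 0 ⟨
        val u               ≡⟨ val≡ ⟩
        val v + 1           ≡⟨ cong (_+ 1) (trans size (cong (m +_) (⊑-pairs v⊑u))) ⟩
        m + pairs u + 1     ≡⟨ ℕₚ.+-comm _ 1 ⟩
        suc m + pairs u     ∎)
      E<p : E < p
      E<p = ℕₚ.≤-reflexive (borrow-size n%p≡0 (first⇒≢0 first) n≡)
    choose : ∃[ w ] (w < Q × ∑ p (λ s → deep-energy k (child w s) (next u)) ≢ 0) → Lowers u (pred n)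
    choose (w , w<Q , ∑≢0) = raise w<Q (lends k (next u) (child w) (coloured-next u<Q) (perfect-next P) first
      (λ s s<p → child< w<Q s<p)
      (λ r s r<s s<p eq → ℕₚ.<⇒≢ r<s (proj₂ (child-injective w w (ℕₚ.<-trans r<s s<p) s<p eq)))
      (uniform w w<Q) ∑≢0)

  lowers-unpad : ∀ {M m w} {u : Forest M} → Lowers (pad w u) m → Lowers u m
  lowers-unpad {m = m} {w} (v⁺ , v⁺⊑u⁺ , P) = strip P (unpad v⁺⊑u⁺ (perfect⇒unique P))
    where
    strip : ∀ {M} {u : Forest M} {v⁺} → Perfect v⁺ m → ∃[ v ] (v ⊑ u × pad w v ≡ v⁺) → Lowers u m
    strip P (v , v⊑u , refl) = v , v⊑u , perfect-unpadding w v id-injective P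

  cnt-pad-≢ : ∀ {M w z} (u : Forest M) → z ≢ w → cnt z (pad w u) ≡ cnt z u
  cnt-pad-≢ {w = w} {z} u z≢w = cong₂ _+_ (ind-≢ (z≢w ∘ sym)) (cnt-pad id-injective w z u)

  cnt-pad-≡ : ∀ {M} w (u : Forest M) → cnt w (pad w u) ≡ suc (cnt w u)
  cnt-pad-≡ w u = cong₂ _+_ (ind-refl w) (cnt-pad id-injective w w u)

  lowers-padded : ∀ {Q m n w} r {M} (u : Forest M) → w < Q → Coloured Q u → Perfect u n →
    (∀ {M′} (u′ : Forest M′) → Coloured Q u′ → Perfect u′ n → cnt w u′ ≡ r + cnt w u → (∀ z → z ≢ w → cnt z u′ ≡ cnt z u) → Lowers u′ m) →
    Lowers u m
  lowers-padded zero u w<Q u<Q P lower = lower u u<Q P refl (λ _ _ → refl)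
  lowers-padded {w = w} (suc r) u w<Q u<Q P lower = lowers-unpad
    (lowers-padded r (pad w u) w<Q (coloured-pad w<Q u<Q) (perfect-padding w u id-injective P)
      λ u′ u′<Q P′ at off → lower u′ u′<Q P′ (trans at (trans (cong (r +_) (cnt-pad-≡ w u)) (ℕₚ.+-suc r (cnt w u))))
        (λ z z≢w → trans (off z z≢w) (cnt-pad-≢ u z≢w)))

  -- Padding makes every number of tokens of one colour divisible by p, so that no descent wraps around.
  borrow : ∀ {M Q n k} (u : Forest M) → Coloured Q u → Perfect u n → n % p ≡ 0 → FirstNonzeroDigit (n / p) k → Lowers u (pred n)
  borrow {Q = Q} {n} u u<Q P n%p≡0 first = from Q ℕₚ.≤-refl u u<Q P (λ w Q≤w w<Q → contradiction w<Q (ℕₚ.≤⇒≯ Q≤w))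
    where
    from : ∀ b → b ≤ Q → ∀ {M} (u : Forest M) → Coloured Q u → Perfect u n → (∀ w → b ≤ w → w < Q → p ∣ cnt w u) → Lowers u (pred n)
    from zero _ u u<Q P p∣cnt = borrow-uniform u u<Q P n%p≡0 first (λ w → p∣cnt w z≤n)
    from (suc b) b<Q u u<Q P p∣cnt = lowers-padded (pred p * cnt b u) u b<Q u<Q P
      λ u′ u′<Q P′ at off → from b (ℕₚ.<⇒≤ b<Q) u′ u′<Q P′ λ w b≤w w<Q → p∣cnt′ u′ at off w b≤w w<Q (w ℕ.≟ b)
      where
      p∣cnt′ : ∀ {M′} (u′ : Forest M′) → cnt b u′ ≡ pred p * cnt b u + cnt b u → (∀ z → z ≢ b → cnt z u′ ≡ cnt z u) →
        ∀ w → b ≤ w → w < Q → Dec (w ≡ b) → p ∣ cnt w u′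
      p∣cnt′ u′ at off w b≤w w<Q (yes refl) = divides (cnt w u) (trans at (trans (ℕₚ.+-comm (pred p * cnt w u) (cnt w u))
        (trans (cong (_* cnt w u) (ℕₚ.suc-pred p)) (ℕₚ.*-comm p (cnt w u)))))
      p∣cnt′ u′ at off w b≤w w<Q (no w≢b) =
        subst (p ∣_) (sym (off w w≢b)) (p∣cnt w (ℕₚ.≤∧≢⇒< b≤w (w≢b ∘ sym)) w<Q)

  -- Attained values and calmness

  +-%-congˡ : ∀ a {b c} → b % p ≡ c % p → (a + b) % p ≡ (a + c) % p
  +-%-congˡ a {b} {c} eq = trans (%-distribˡ-+ a b p) (trans (cong (λ k → (a % p + k) % p) eq) (sym (%-distribˡ-+ a c p)))

  +-%-congʳ : ∀ {a b} c → a % p ≡ b % p → (a + c) % p ≡ (b + c) % p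
  +-%-congʳ {a} {b} c eq = trans (cong (_% p) (ℕₚ.+-comm a c)) (trans (+-%-congˡ c eq) (cong (_% p) (ℕₚ.+-comm c b)))

  +-%-cancelʳ : ∀ a b c → (a + c) % p ≡ (b + c) % p → a % p ≡ b % p
  +-%-cancelʳ a b c eq = trans (sym (absorb a)) (trans (+-%-congʳ (pred p * c) eq) (absorb b))
    where
    absorb : ∀ a → (a + c + pred p * c) % p ≡ a % p
    absorb a = trans (cong (_% p) (trans (ℕₚ.+-assoc a c _) (cong (a +_)
      (trans (cong (_* c) (ℕₚ.suc-pred p)) (ℕₚ.*-comm p c))))) ([m+kn]%n≡m%n a c p)

  p*-+-% : ∀ a b → (p * a + b) % p ≡ b % p
  p*-+-% a b = trans (cong (_% p) (trans (ℕₚ.+-comm (p * a) b) (cong (b +_) (ℕₚ.*-comm p a)))) ([m+kn]%n≡m%n b a p)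

  -- x is the value of ψ at u: digit L of x is congruent to val − pairs after L passages to the next digit.
  HasDigits : ∀ {M} → Forest M → ℕ → Set
  HasDigits u x = ∀ L → (shift L x + pairs (nexts L u)) % p ≡ val (nexts L u) % p

  digits-cons : ∀ {M} {u : Forest M} {x} → (x + pairs u) % p ≡ val u % p → HasDigits (next u) (x / p) → HasDigits u x
  digits-cons digit digits zero = digit
  digits-cons digit digits (suc L) = digits L

  digits-next : ∀ {M} {u : Forest M} {x} → HasDigits u x → HasDigits (next u) (x / p)
  digits-next digits L = digits (suc L)

  perfect⇒digits : ∀ {M n} {u : Forest M} → Perfect u n → HasDigits u n
  perfect⇒digits P L = cong (_% p) (sym (P L))

  shift-injective : ∀ x y → (∀ L → shift L x % p ≡ shift L y % p) → x ≡ y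
  shift-injective x y = go (x + y) x y (ℕₚ.m≤m+n x y) (ℕₚ.m≤n+m y x)
    where
    quotient≤ : ∀ {fuel} x → x ≤ suc fuel → x / p ≤ fuel
    quotient≤ zero _ = ℕₚ.≤-trans (ℕₚ.≤-reflexive (0/n≡0 p)) z≤n
    quotient≤ (suc x) x≤ = ℕₚ.≤-pred (ℕₚ.≤-trans (n/p<n (λ ())) x≤)
    go : ∀ fuel x y → x ≤ fuel → y ≤ fuel → (∀ L → shift L x % p ≡ shift L y % p) → x ≡ y
    go zero _ _ z≤n z≤n _ = refl
    go (suc fuel) x y x≤ y≤ same = trans (div-mod x) (trans (cong₂ (λ q r → q * p + r)
      (go fuel (x / p) (y / p) (quotient≤ x x≤) (quotient≤ y y≤) (same ∘ suc)) (same 0)) (sym (div-mod y)))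

  digits-unique : ∀ {M x y} {u : Forest M} → HasDigits u x → HasDigits u y → x ≡ y
  digits-unique {x = x} {y} {u} X Y = shift-injective x y
    λ L → +-%-cancelʳ (shift L x) (shift L y) (pairs (nexts L u)) (trans (X L) (sym (Y L)))

  unique⇒cnt≡0 : ∀ {M c} (u : Forest M) → Bounded 1 u → All ((c , 0) ≢_) u → cnt c u ≡ 0
  unique⇒cnt≡0 [] [] [] = refl
  unique⇒cnt≡0 ((c , zero) ∷ u) (_ ∷ u<) (neq ∷ rest) =
    cong₂ _+_ (ind-≢ λ c≡ → neq (cong (_, 0) (sym c≡))) (unique⇒cnt≡0 u u< rest)
  unique⇒cnt≡0 ((c , suc a) ∷ u) (s≤s () ∷ _) _

  unique⇒pairs≡0 : ∀ {M} (u : Forest M) → Bounded 1 u → Unique u → pairs u ≡ 0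
  unique⇒pairs≡0 [] [] [] = refl
  unique⇒pairs≡0 ((c , zero) ∷ u) (_ ∷ u<) (t∉u ∷ distinct) =
    cong₂ _+_ (unique⇒cnt≡0 u u< t∉u) (unique⇒pairs≡0 u u< distinct)
  unique⇒pairs≡0 ((c , suc a) ∷ u) (s≤s () ∷ _) _

  unique-next : ∀ {M} {u : Forest M} → Unique u → Unique (next u)
  unique-next = Uniqueₚ.map⁺ (λ {s} {t} eq → trans (sym (prev-next s)) (trans (cong prev-token eq) (prev-next t)))

  digits-exist : ∀ {M} (u : Forest M) → Unique u → ∃ (HasDigits u)
  digits-exist u distinct = go (val u) u (bounded-power u) distinct
    where
    go : ∀ K {M} (u : Forest M) → Bounded (p ^ K) u → Unique u → ∃ (HasDigits u)
    go zero u u< distinct = 0 , perfect⇒digits (perfect-zero u< (unique⇒pairs≡0 u u< distinct))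
    go (suc K) u u< distinct = prepend (go K (next u) (bounded-next u<) (unique-next distinct))
      where
      open ≡-Reasoning
      -- Modulo `p`, the summand `pred p * pairs u` is -`pairs u`.
      r = (val u + pred p * pairs u) % p
      prepend : ∃ (HasDigits (next u)) → ∃ (HasDigits u)
      prepend (x , digits) = child x r , digits-cons (begin
        (x * p + r + pairs u) % p                       ≡⟨ cong (λ k → (k + r + pairs u) % p) (ℕₚ.*-comm x p) ⟩
        (p * x + r + pairs u) % p                       ≡⟨ +-%-congʳ (pairs u) (trans (p*-+-% x r) (m%n%n≡m%n _ p)) ⟩
        (val u + pred p * pairs u + pairs u) % p        ≡⟨ cong (_% p) (trans (ℕₚ.+-assoc (val u) _ _) (cong (val u +_)
                                                             (trans (ℕₚ.+-comm (pred p * pairs u) (pairs u))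
                                                             (trans (cong (_* pairs u) (ℕₚ.suc-pred p)) (ℕₚ.*-comm p (pairs u)))))) ⟩
        (val u + pairs u * p) % p                       ≡⟨ [m+kn]%n≡m%n (val u) (pairs u) p ⟩
        val u % p                                       ∎)
        (subst (HasDigits (next u)) (sym ([cp+r]/p x (m%n<n _ p))) digits)

  ⊑-colour-sum : ∀ {M f} {u v : Forest M} → v ⊑ u → colour-sum f v ≡ colour-sum f u
  ⊑-colour-sum [] = refl
  ⊑-colour-sum (_ ∷ v⊑u) = cong (_ +_) (⊑-colour-sum v⊑u)

  -- The residues of the values are recorded in the colours of the next level, and a descent there
  -- preserves colours.
  val-% : ∀ {M} {u v : Forest M} → next v ⊑ next u → val v % p ≡ val u % p
  val-% {u = u} {v} v⊑u = begin
    val v % p                            ≡⟨ residue v ⟩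
    colour-sum (_% p) (next v) % p       ≡⟨ cong (_% p) (⊑-colour-sum v⊑u) ⟩
    colour-sum (_% p) (next u) % p       ≡⟨ residue u ⟨
    val u % p                            ∎
    where
    open ≡-Reasoning
    residue : ∀ {M} (u : Forest M) → val u % p ≡ colour-sum (_% p) (next u) % p
    residue u = trans (cong (_% p) (val-next u)) (p*-+-% (val (next u)) _)

  lowers-drop : ∀ {M Q n c} {u v : Forest M} → Coloured Q u → v ⊑ u →
    HasSize v (p * (n / p) + c) → Perfect (next v) (n / p) → n % p ≤ c → Lowers u n
  lowers-drop {n = n} {c} {u} {v} u<Q v⊑u size P n%p≤c = finish (drop (n % p) c v (m%n<n n p) n%p≤c (⊑-coloured v⊑u u<Q) size P)
    where
    finish : DropTo v (n / p) (n % p) → Lowers u n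
    finish (w , w⊑v , size′ , P′) = w , ⊑-trans w⊑v v⊑u ,
      subst (Perfect w) (sym (trans (div-mod n) (cong (_+ n % p) (ℕₚ.*-comm (n / p) p)))) (perfect-lift (m%n<n n p) size′ P′)

  attain : ∀ K {M Q} (u : Forest M) x n → Coloured Q u → Bounded (p ^ K) u → Unique u → HasDigits u x → n ≤ x → Lowers u n
  attain zero u x n u<Q u< distinct digits n≤x = u , ⊑-refl u ,
    subst (Perfect u) (sym (ℕₚ.n≤0⇒n≡0 (subst (n ≤_) x≡0 n≤x))) P₀
    where
    P₀ : Perfect u 0
    P₀ = perfect-zero u< (unique⇒pairs≡0 u u< distinct)
    x≡0 : x ≡ 0
    x≡0 = digits-unique digits (perfect⇒digits P₀)
  attain (suc K) {Q = Q} u x n u<Q u< distinct digits n≤x with n / p ℕ.≟ x / p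
  ... | yes n/p≡x/p = keep-quotient (attain K (next u) (x / p) (n / p) (coloured-next u<Q) (bounded-next u<) (unique-next distinct)
          (digits-next digits) (ℕₚ.≤-reflexive n/p≡x/p))
    where
    n%p≤x%p : n % p ≤ x % p
    n%p≤x%p = ℕₚ.+-cancelˡ-≤ (n / p * p) _ _
      (subst₂ _≤_ (div-mod n) (trans (div-mod x) (cong (λ q → q * p + x % p) (sym n/p≡x/p))) n≤x)
    keep-quotient : Lowers (next u) (n / p) → Lowers u n
    keep-quotient (v′ , v′⊑ , P′) = lowers-drop u<Q v⊑u size P (ℕₚ.≤-trans n%p≤x%p x%p≤c)
      where
      v = prev v′
      v⊑u : v ⊑ u
      v⊑u = ⊑-next v′⊑
      P : Perfect (next v) (n / p)
      P = subst (λ w → Perfect w (n / p)) (sym (next∘prev v′)) P′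
      c = total-energy Q v
      size : HasSize v (p * (n / p) + c)
      size = size-lift (⊑-coloured v⊑u u<Q) (P 0)
      open ≡-Reasoning
      x%p≡c%p : x % p ≡ c % p
      x%p≡c%p = +-%-cancelʳ x c (pairs u) (begin
        (x + pairs u) % p                      ≡⟨ digits 0 ⟩
        val u % p                              ≡⟨ val-% (subst (_⊑ next u) (sym (next∘prev v′)) v′⊑) ⟨
        val v % p                              ≡⟨ cong (_% p) size ⟩
        (p * (n / p) + c + pairs v) % p        ≡⟨ cong (_% p) (ℕₚ.+-assoc (p * (n / p)) c (pairs v)) ⟩
        (p * (n / p) + (c + pairs v)) % p      ≡⟨ p*-+-% (n / p) _ ⟩
        (c + pairs v) % p                      ≡⟨ cong (λ k → (c + k) % p) (⊑-pairs v⊑u) ⟩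
        (c + pairs u) % p                      ∎)
      x%p≤c : x % p ≤ c
      x%p≤c = ℕₚ.≤-trans (ℕₚ.≤-reflexive x%p≡c%p) (m%n≤m c p)
  ... | no n/p≢x/p = lower-quotient (attain K (next u) (x / p) (suc (n / p)) (coloured-next u<Q) (bounded-next u<) (unique-next distinct)
          (digits-next digits) (ℕₚ.≤∧≢⇒< (/-monoˡ-≤ p n≤x) n/p≢x/p))
    where
    n′ = n / p
    N = p * suc n′ + 0
    N≡ : N ≡ child (suc n′) 0
    N≡ = cong (_+ 0) (ℕₚ.*-comm p (suc n′))
    N/p≡ : N / p ≡ suc n′
    N/p≡ = trans (cong (_/ p) N≡) ([cp+r]/p (suc n′) 0<p)
    pred-N≡ : pred N ≡ p * n′ + pred p
    pred-N≡ = cong pred (begin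
      p * suc n′ + 0            ≡⟨ ℕₚ.+-identityʳ _ ⟩
      p * suc n′                ≡⟨ ℕₚ.*-suc p n′ ⟩
      p + p * n′                ≡⟨ cong (_+ p * n′) (ℕₚ.suc-pred p) ⟨
      suc (pred p) + p * n′     ≡⟨ cong suc (ℕₚ.+-comm (pred p) (p * n′)) ⟩
      suc (p * n′ + pred p)     ∎)
      where open ≡-Reasoning
    fill : ∀ {v} → v ⊑ u → Lowers v (pred N) → Lowers u n
    fill v⊑u (w , w⊑v , P) = lowers-drop u<Q (⊑-trans w⊑v v⊑u) (subst (HasSize w) pred-N≡ (P 0))
      (subst (Perfect (next w)) pred-N/p≡ (perfect-next P)) (ℕₚ.≤-pred (subst (n % p <_) (sym (ℕₚ.suc-pred p)) (m%n<n n p)))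
      where
      pred-N/p≡ : pred N / p ≡ n′
      pred-N/p≡ = trans (cong (_/ p) (trans pred-N≡ (cong (_+ pred p) (ℕₚ.*-comm p n′))))
        ([cp+r]/p n′ (ℕₚ.≤-reflexive (ℕₚ.suc-pred p)))
    borrow-from : ∀ {v} → v ⊑ u → DropTo v (suc n′) 0 → ∃ (FirstNonzeroDigit (suc n′)) → Lowers u n
    borrow-from v⊑u (w , w⊑v , size , P) (k , first) = fill (⊑-trans w⊑v v⊑u)
      (borrow w (⊑-coloured (⊑-trans w⊑v v⊑u) u<Q) (perfect-lift 0<p size P) (trans (cong (_% p) N≡) ([cp+r]%p (suc n′) 0<p))
        (subst (λ m → FirstNonzeroDigit m k) (sym N/p≡) first))
    lower-quotient : Lowers (next u) (suc n′) → Lowers u n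
    lower-quotient (v′ , v′⊑ , P′) = borrow-from (⊑-next v′⊑)
      (drop 0 (total-energy Q v) v 0<p z≤n v<Q (size-lift v<Q (P 0)) P) (first-nonzero-digit (suc n′) (λ ()))
      where
      v = prev v′
      v<Q = ⊑-coloured (⊑-next v′⊑) u<Q
      P : Perfect (next v) (suc n′)
      P = subst (λ w → Perfect w (suc n′)) (sym (next∘prev v′)) P′

  -- Moves in S and congruences between values

  data Differ (N : ℕ) : ∀ {M} → Vec ℕ M → Forest M → Forest M → Set where
    []  : Differ N [] [] []
    _∷_ : ∀ {M c a b e} {es : Vec ℕ M} {u v} → a ≡ b + N * e → Differ N es u v → Differ N (e ∷ es) ((c , a) ∷ u) ((c , b) ∷ v)

  differ-⊑ : ∀ {N M} {es : Vec ℕ M} {u v} → Differ N es u v → v ⊑ u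
  differ-⊑ [] = []
  differ-⊑ {N} (_∷_ {b = b} {e} eq D) = subst (b ≤_) (sym eq) (ℕₚ.m≤m+n b (N * e)) ∷ differ-⊑ D

  ⊑-differ : ∀ {M} {u v : Forest M} → v ⊑ u → ∃[ es ] Differ 1 es u v
  ⊑-differ [] = [] , []
  ⊑-differ (_∷_ {b = b} {a} b≤a v⊑u) with ⊑-differ v⊑u
  ... | es , D = a ∸ b ∷ es , trans (sym (ℕₚ.m+[n∸m]≡n b≤a)) (cong (b +_) (sym (ℕₚ.*-identityˡ (a ∸ b)))) ∷ D

  differ-val : ∀ {N M} {es : Vec ℕ M} {u v} → Differ N es u v → val u ≡ val v + N * Vec.sum es
  differ-val {N} [] = sym (ℕₚ.*-zeroʳ N)
  differ-val {N} {es = e ∷ es} {v = (c , b) ∷ v} (eq ∷ D) =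
    trans (cong₂ _+_ eq (differ-val D)) (lem b N e (val v) (Vec.sum es))
    where
    lem : ∀ b n e v s → (b + n * e) + (v + n * s) ≡ b + v + n * (e + s)
    lem = ℕR.solve-∀

  differ-prev : ∀ {N M} {es : Vec ℕ M} {u v} → Differ N es u v → Differ (p * N) es (prev u) (prev v)
  differ-prev [] = []
  differ-prev {N} {es = e ∷ es} {u = (c , a) ∷ u} {(_ , b) ∷ v} (eq ∷ D) =
    trans (cong (λ a → a * p + c % p) eq) (lem b N e p (c % p)) ∷ differ-prev D
    where
    lem : ∀ b n e p r → (b + n * e) * p + r ≡ b * p + r + p * n * e
    lem = ℕR.solve-∀

  differ-next : ∀ {N M} {es : Vec ℕ M} {u v} → Differ (p * N) es u v → Differ N es (next u) (next v)
  differ-next [] = []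
  differ-next {N} {es = e ∷ es} {u = (c , a) ∷ u} {(_ , b) ∷ v} (eq ∷ D) =
    subst₂ (λ r q → Differ N (e ∷ es) ((c * p + r , q) ∷ next u) (next ((c , b) ∷ v)))
      (sym (trans (cong (_% p) a≡) ([cp+r]%p (b / p + N * e) (m%n<n b p))))
      (sym (trans (cong (_/ p) a≡) ([cp+r]/p (b / p + N * e) (m%n<n b p))))
      (refl ∷ differ-next D)
    where
    lem : ∀ q p r n e → q * p + r + p * n * e ≡ (q + n * e) * p + r
    lem = ℕR.solve-∀
    a≡ : a ≡ (b / p + N * e) * p + b % p
    a≡ = trans eq (trans (cong (_+ p * N * e) (div-mod b)) (lem (b / p) p (b % p) N e))

  Reaches : ∀ {M} → Forest M → ℕ → Set
  Reaches u n = ∃[ v ] ∃[ k ] ∃[ es ] (Differ (p ^ k) es u v × ¬ p ∣ Vec.sum es × Unique v × HasDigits v n)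

  -- Descents do not change `pairs`, so at the first differing digit the sum of the differences is
  -- congruent to the difference of the two digits, and `p` does not divide it. Each passage back
  -- through `prev` multiplies the differences by `p` and leaves the common lower digit unchanged.
  reach : ∀ {M Q x n} (u : Forest M) → Coloured Q u → Unique u → HasDigits u x → n < x → Reaches u n
  reach {x = x} u = go x u ℕₚ.≤-refl
    where
    go : ∀ fuel {M Q x n} (u : Forest M) → x ≤ fuel → Coloured Q u → Unique u → HasDigits u x → n < x → Reaches u n
    go zero u z≤n u<Q distinct digits ()
    go (suc fuel) {x = x} {n} u x≤ u<Q distinct digits n<x with n % p ℕ.≟ x % p
    ... | no n%p≢x%p = settle (attain (val u) u x n u<Q (bounded-power u) distinct digits (ℕₚ.<⇒≤ n<x))
      where
      settle : Lowers u n → Reaches u n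
      settle (v , v⊑u , P) = v , 0 , proj₁ (⊑-differ v⊑u) , proj₂ (⊑-differ v⊑u) , p∤∑ , perfect⇒unique P , perfect⇒digits P
        where
        open ≡-Reasoning
        es = proj₁ (⊑-differ v⊑u)
        p∤∑ : ¬ p ∣ Vec.sum es
        p∤∑ (divides q ∑≡) = n%p≢x%p (+-%-cancelʳ n x (pairs u) (begin
          (n + pairs u) % p            ≡⟨ cong (λ k → (n + k) % p) (⊑-pairs v⊑u) ⟨
          (n + pairs v) % p            ≡⟨ cong (_% p) (P 0) ⟨
          val v % p                    ≡⟨ [m+kn]%n≡m%n (val v) q p ⟨
          (val v + q * p) % p          ≡⟨ cong (λ k → (val v + k) % p) (trans (ℕₚ.*-identityˡ (Vec.sum es)) ∑≡) ⟨
          (val v + 1 * Vec.sum es) % p ≡⟨ cong (_% p) (differ-val (proj₂ (⊑-differ v⊑u))) ⟨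
          val u % p                    ≡⟨ digits 0 ⟨
          (x + pairs u) % p            ∎))
    ... | yes n%p≡x%p = raise (go fuel (next u) (ℕₚ.≤-pred (ℕₚ.≤-trans (n/p<n (λ x≡0 → ℕₚ.n≮0 (subst (n <_) x≡0 n<x))) x≤))
        (coloured-next u<Q) (unique-next distinct) (digits-next digits) n/p<x/p)
      where
      n/p<x/p : n / p < x / p
      n/p<x/p = ℕₚ.*-cancelʳ-< p _ _ (ℕₚ.+-cancelʳ-< (n % p) _ _
        (subst₂ _<_ (div-mod n) (trans (div-mod x) (cong (x / p * p +_) (sym n%p≡x%p))) n<x))
      raise : Reaches (next u) (n / p) → Reaches u n
      raise (v′ , k , es , D , p∤∑ , distinct′ , digits′) =
        v , suc k , es , D′ , p∤∑ , unique-next⁻ v (subst Unique (sym (next∘prev v′)) distinct′) ,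
        digits-cons (begin
          (n + pairs v) % p      ≡⟨ cong (λ k → (n + k) % p) (⊑-pairs (differ-⊑ D′)) ⟩
          (n + pairs u) % p      ≡⟨ +-%-congʳ (pairs u) n%p≡x%p ⟩
          (x + pairs u) % p      ≡⟨ digits 0 ⟩
          val u % p              ≡⟨ val-% (subst (_⊑ next u) (sym (next∘prev v′)) (differ-⊑ D)) ⟨
          val v % p              ∎)
          (subst (λ w → HasDigits w (n / p)) (sym (next∘prev v′)) digits′)
        where
        open ≡-Reasoning
        v = prev v′
        D′ : Differ (p ^ suc k) es u v
        D′ = subst (λ w → Differ (p ^ suc k) es w v) (prev∘next u) (differ-prev D)

  -- A congruence modulo `p ^ suc k`, written with a multiple on each side to stay in ℕ. At `k = 0`
  -- both digits are values minus the same number of pairs. For larger `k` the residues of `u` and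
  -- `v` agree and cancel, and the congruence for the quotients is multiplied by `p`.
  calm : ∀ k {M x y} {es : Vec ℕ M} {u v} → Differ (p ^ k) es u v → HasDigits u x → HasDigits v y →
    ∃[ i ] ∃[ j ] x + val v + p ^ suc k * i ≡ y + val u + p ^ suc k * j
  calm zero {x = x} {y} {u = u} {v} D X Y = b / p , a / p , (begin
    a + p * 1 * (b / p)            ≡⟨ cong₂ (λ k l → k + l * (b / p)) (div-mod a) (ℕₚ.*-identityʳ p) ⟩
    a / p * p + a % p + p * (b / p)   ≡⟨ cong (λ r → a / p * p + r + p * (b / p)) a%p≡b%p ⟩
    a / p * p + b % p + p * (b / p)   ≡⟨ lem (a / p) p (b % p) (b / p) ⟩
    b / p * p + b % p + p * (a / p)   ≡⟨ cong₂ (λ k l → k + l * (a / p)) (div-mod b) (ℕₚ.*-identityʳ p) ⟨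
    b + p * 1 * (a / p)            ∎)
    where
    open ≡-Reasoning
    a = x + val v
    b = y + val u
    a%p≡b%p : a % p ≡ b % p
    a%p≡b%p = begin
      (x + val v) % p            ≡⟨ +-%-congˡ x (Y 0) ⟨
      (x + (y + pairs v)) % p    ≡⟨ cong (λ q → (x + (y + q)) % p) (⊑-pairs (differ-⊑ D)) ⟩
      (x + (y + pairs u)) % p    ≡⟨ cong (_% p) (exchange x y (pairs u)) ⟩
      (y + (x + pairs u)) % p    ≡⟨ +-%-congˡ y (X 0) ⟩
      (y + val u) % p            ∎
      where
      exchange : ∀ x y q → x + (y + q) ≡ y + (x + q)
      exchange = ℕR.solve-∀
    lem : ∀ q p r s → q * p + r + p * s ≡ s * p + r + p * q
    lem = ℕR.solve-∀
  calm (suc k) {x = x} {y} {u = u} {v} D X Y with calm k (differ-next {N = p ^ k} D) (digits-next X) (digits-next Y)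
  ... | i , j , eq = i , j , (begin
    x + val v + p * P * i
      ≡⟨ cong₂ (λ k l → k + l + p * P * i) (div-mod x) (val-next v) ⟩
    x / p * p + x % p + (p * val (next v) + R v) + p * P * i
      ≡⟨ regroup (x / p) p (x % p) (val (next v)) (R v) P i ⟩
    p * (x / p + val (next v) + P * i) + (x % p + R v)
      ≡⟨ cong₂ (λ k l → p * k + l) eq (cong₂ _+_ x%p≡y%p (⊑-colour-sum v⊑u)) ⟩
    p * (y / p + val (next u) + P * j) + (y % p + R u)
      ≡⟨ regroup (y / p) p (y % p) (val (next u)) (R u) P j ⟨
    y / p * p + y % p + (p * val (next u) + R u) + p * P * j
      ≡⟨ cong₂ (λ k l → k + l + p * P * j) (div-mod y) (val-next u) ⟨
    y + val u + p * P * j ∎)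
    where
    open ≡-Reasoning
    P = p ^ suc k
    R : ∀ {M} → Forest M → ℕ
    R u = colour-sum (_% p) (next u)
    v⊑u : next v ⊑ next u
    v⊑u = differ-⊑ (differ-next {N = p ^ k} D)
    x%p≡y%p : x % p ≡ y % p
    x%p≡y%p = +-%-cancelʳ x y (pairs u) (begin
      (x + pairs u) % p     ≡⟨ X 0 ⟩
      val u % p             ≡⟨ val-% v⊑u ⟨
      val v % p             ≡⟨ Y 0 ⟨
      (y + pairs v) % p     ≡⟨ cong (λ q → (y + q) % p) (⊑-pairs (differ-⊑ D)) ⟩
      (y + pairs u) % p     ∎)
    regroup : ∀ a p r v s q i → a * p + r + (p * v + s) + p * q * i ≡ p * (a + v + q * i) + (r + s)
    regroup = ℕR.solve-∀

  -- Digits of p-Nim-sums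

  quotients≤ : ∀ {f} x y → x + y ≤ suc f → x / p + y / p ≤ f
  quotients≤ {f} x y x+y≤ with x ℕ.≟ 0
  ... | no x≢0 = ℕₚ.≤-pred (ℕₚ.≤-trans (ℕₚ.+-mono-<-≤ (n/p<n x≢0) (m/n≤m y p)) x+y≤)
  ... | yes refl with y ℕ.≟ 0
  ...   | no y≢0 = ℕₚ.≤-pred (ℕₚ.≤-trans (ℕₚ.+-mono-≤-< (m/n≤m 0 p) (n/p<n y≢0)) x+y≤)
  ...   | yes refl = ℕₚ.≤-trans (ℕₚ.≤-reflexive (cong₂ _+_ (0/n≡0 p) (0/n≡0 p))) z≤n

  module _ where
    private
      -- `nimAux` splits on its base, so the equation is proved for a variable base, which can be
      -- matched, and then specialised to the fixed `p`.
      unfold : ∀ p .{{_ : NonZero p}} f x y →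
        nimAux p (suc f) x y ≡ (x % p + y % p) % p + p * nimAux p f (x / p) (y / p)
      unfold (suc q) f x y = refl

      nimAux-fuel-0 : ∀ p .{{_ : NonZero p}} x y → nimAux p 0 x y ≡ 0
      nimAux-fuel-0 (suc q) x y = refl

    nimAux-suc : ∀ f x y → nimAux p (suc f) x y ≡ (x % p + y % p) % p + p * nimAux p f (x / p) (y / p)
    nimAux-suc = unfold p

    nimAux-zero : ∀ x y → nimAux p 0 x y ≡ 0
    nimAux-zero = nimAux-fuel-0 p

  0%p≡0 : 0 % p ≡ 0
  0%p≡0 = m*n%n≡0 0 p

  nimAux-0-0 : ∀ f → nimAux p f 0 0 ≡ 0
  nimAux-0-0 zero = nimAux-zero 0 0
  nimAux-0-0 (suc f) = begin
    nimAux p (suc f) 0 0                                       ≡⟨ nimAux-suc f 0 0 ⟩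
    (0 % p + 0 % p) % p + p * nimAux p f (0 / p) (0 / p)       ≡⟨ cong₂ (λ r q → (r + r) % p + p * nimAux p f q q) 0%p≡0 (0/n≡0 p) ⟩
    0 % p + p * nimAux p f 0 0                                 ≡⟨ cong₂ (λ r z → r + p * z) 0%p≡0 (nimAux-0-0 f) ⟩
    p * 0                                                      ≡⟨ ℕₚ.*-zeroʳ p ⟩
    0                                                          ∎
    where open ≡-Reasoning

  nimAux-fuel : ∀ f f′ x y → x + y ≤ f → x + y ≤ f′ → nimAux p f x y ≡ nimAux p f′ x y
  nimAux-fuel zero f′ zero zero _ _ = trans (nimAux-0-0 0) (sym (nimAux-0-0 f′))
  nimAux-fuel (suc f) zero zero zero _ _ = trans (nimAux-0-0 (suc f)) (sym (nimAux-0-0 0))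
  nimAux-fuel (suc f) (suc f′) x y le le′ = trans (nimAux-suc f x y) (trans
    (cong (λ z → (x % p + y % p) % p + p * z) (nimAux-fuel f f′ (x / p) (y / p) (quotients≤ x y le) (quotients≤ x y le′)))
    (sym (nimAux-suc f′ x y)))

  ⊕-step : ∀ x y → x ⊕[ p ] y ≡ p * ((x / p) ⊕[ p ] (y / p)) + (x % p + y % p) % p
  ⊕-step x y = begin
    nimAux p (x + y) x y                                                  ≡⟨ nimAux-fuel (x + y) (suc (x + y)) x y ℕₚ.≤-refl (ℕₚ.n≤1+n _) ⟩
    nimAux p (suc (x + y)) x y                                            ≡⟨ nimAux-suc (x + y) x y ⟩
    (x % p + y % p) % p + p * nimAux p (x + y) (x / p) (y / p)            ≡⟨ cong (λ z → (x % p + y % p) % p + p * z)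
                                                                               (nimAux-fuel (x + y) _ (x / p) (y / p) (ℕₚ.+-mono-≤ (m/n≤m x p) (m/n≤m y p)) ℕₚ.≤-refl) ⟩
    (x % p + y % p) % p + p * ((x / p) ⊕[ p ] (y / p))                    ≡⟨ ℕₚ.+-comm _ (p * ((x / p) ⊕[ p ] (y / p))) ⟩
    p * ((x / p) ⊕[ p ] (y / p)) + (x % p + y % p) % p                    ∎
    where open ≡-Reasoning

  ⊕-% : ∀ x y → (x ⊕[ p ] y) % p ≡ (x + y) % p
  ⊕-% x y = trans (cong (_% p) (⊕-step x y)) (trans (p*-+-% _ ((x % p + y % p) % p))
    (trans (m%n%n≡m%n _ p) (sym (%-distribˡ-+ x y p))))

  ⊕-/ : ∀ x y → (x ⊕[ p ] y) / p ≡ (x / p) ⊕[ p ] (y / p)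
  ⊕-/ x y = trans (cong (_/ p) (trans (⊕-step x y) (cong (_+ (x % p + y % p) % p) (ℕₚ.*-comm p z))))
    ([cp+r]/p z (m%n<n _ p))
    where z = (x / p) ⊕[ p ] (y / p)

  nimSum-% : ∀ xs → nimSum p xs % p ≡ sum xs % p
  nimSum-% [] = refl
  nimSum-% (x ∷ xs) = trans (⊕-% x (nimSum p xs)) (+-%-congˡ x (nimSum-% xs))

  nimSum-/ : ∀ xs → nimSum p xs / p ≡ nimSum p (List.map (_/ p) xs)
  nimSum-/ [] = 0/n≡0 p
  nimSum-/ (x ∷ xs) = trans (⊕-/ x (nimSum p xs)) (cong (λ y → (x / p) ⊕[ p ] y) (nimSum-/ xs))

  shift-nimSum : ∀ L xs → shift L (nimSum p xs) % p ≡ sum (List.map (shift L) xs) % p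
  shift-nimSum zero xs = trans (nimSum-% xs) (cong (λ ys → sum ys % p) (sym (Listₚ.map-id xs)))
  shift-nimSum (suc L) xs = trans (cong (λ x → shift L x % p) (nimSum-/ xs)) (trans (shift-nimSum L (List.map (_/ p) xs))
    (cong (λ ys → sum ys % p) (sym (Listₚ.map-∘ xs))))

  nimSum-digits : ∀ {M} {u : Forest M} xs →
    (∀ L → (sum (List.map (shift L) xs) + pairs (nexts L u)) % p ≡ val (nexts L u) % p) → HasDigits u (nimSum p xs)
  nimSum-digits {u = u} xs digits L = trans (+-%-congʳ (pairs (nexts L u)) (shift-nimSum L xs)) (digits L)

  -- Orders and the pair terms of ψ

  module _ where
    private
      unfold-0 : ∀ p .{{_ : NonZero p}} f n → n % p ≢ 0 → ordAux p f n ≡ 0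
      unfold-0 (suc q) zero n _ = refl
      unfold-0 (suc q) (suc f) zero _ = refl
      unfold-0 (suc q) (suc f) n@(suc _) n%p≢0 with n % suc q
      ... | zero = contradiction refl n%p≢0
      ... | suc _ = refl

      unfold-suc : ∀ p .{{_ : NonZero p}} f n → n ≢ 0 → n % p ≡ 0 → ordAux p (suc f) n ≡ suc (ordAux p f (n / p))
      unfold-suc (suc q) f zero n≢0 _ = contradiction refl n≢0
      unfold-suc (suc q) f n@(suc _) _ n%p≡0 rewrite n%p≡0 = refl

    ordAux-≢0 : ∀ f n → n % p ≢ 0 → ordAux p f n ≡ 0
    ordAux-≢0 = unfold-0 p

    ordAux-≡0 : ∀ f n → n ≢ 0 → n % p ≡ 0 → ordAux p (suc f) n ≡ suc (ordAux p f (n / p))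
    ordAux-≡0 = unfold-suc p

  n/p≢0 : ∀ n → n ≢ 0 → n % p ≡ 0 → n / p ≢ 0
  n/p≢0 n n≢0 n%p≡0 n/p≡0 = n≢0 (trans (n≡p*[n/p] n n%p≡0) (trans (cong (p *_) n/p≡0) (ℕₚ.*-zeroʳ p)))

  ordAux-fuel : ∀ f f′ n → n ≢ 0 → n ≤ f → n ≤ f′ → ordAux p f n ≡ ordAux p f′ n
  ordAux-fuel zero _ n n≢0 n≤0 _ = contradiction (ℕₚ.n≤0⇒n≡0 n≤0) n≢0
  ordAux-fuel (suc f) zero n n≢0 _ n≤0 = contradiction (ℕₚ.n≤0⇒n≡0 n≤0) n≢0
  ordAux-fuel (suc f) (suc f′) n n≢0 n≤ n≤′ with n % p ℕ.≟ 0
  ... | no n%p≢0 = trans (ordAux-≢0 (suc f) n n%p≢0) (sym (ordAux-≢0 (suc f′) n n%p≢0))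
  ... | yes n%p≡0 = trans (ordAux-≡0 f n n≢0 n%p≡0) (trans (cong suc
    (ordAux-fuel f f′ (n / p) (n/p≢0 n n≢0 n%p≡0) (ℕₚ.≤-pred (ℕₚ.≤-trans (n/p<n n≢0) n≤)) (ℕₚ.≤-pred (ℕₚ.≤-trans (n/p<n n≢0) n≤′))))
    (sym (ordAux-≡0 f′ n n≢0 n%p≡0)))

  ord-* : ∀ n → n ≢ 0 → ord p (p * n) ≡ suc (ord p n)
  ord-* n n≢0 = begin
    ordAux p (p * n) (p * n)                ≡⟨ ordAux-fuel (p * n) (suc (p * n)) (p * n) pn≢0 ℕₚ.≤-refl (ℕₚ.n≤1+n _) ⟩
    ordAux p (suc (p * n)) (p * n)          ≡⟨ ordAux-≡0 (p * n) (p * n) pn≢0 (trans (cong (_% p) (ℕₚ.*-comm p n)) (m*n%n≡0 n p)) ⟩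
    suc (ordAux p (p * n) (p * n / p))      ≡⟨ cong (λ k → suc (ordAux p (p * n) k)) (trans (cong (_/ p) (ℕₚ.*-comm p n)) (m*n/n≡m n p)) ⟩
    suc (ordAux p (p * n) n)                ≡⟨ cong suc (ordAux-fuel (p * n) n n n≢0 (ℕₚ.m≤n*m n p) ℕₚ.≤-refl) ⟩
    suc (ord p n)                           ∎
    where
    open ≡-Reasoning
    pn≢0 : p * n ≢ 0
    pn≢0 eq = n≢0 (ℕₚ.n≤0⇒n≡0 (subst (n ≤_) eq (ℕₚ.m≤n*m n p)))

  pair-term : ℕ → ℕ → ℕ
  pair-term a b = p ^ suc (ord p ∣ a - b ∣) ∸ 1

  all-digits-p-1 : ∀ k → p ^ suc k ∸ 1 ≡ child (p ^ k ∸ 1) (pred p)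
  all-digits-p-1 k = begin
    p * p ^ k ∸ 1                          ≡⟨ cong (λ n → p * n ∸ 1) (sym (ℕₚ.m+[n∸m]≡n (ℕₚ.≤-trans (s≤s z≤n) (n<p^n k)))) ⟩
    p * suc (p ^ k ∸ 1) ∸ 1                ≡⟨ cong (_∸ 1) (trans (ℕₚ.*-suc p n) (cong (_+ p * n) (sym (ℕₚ.suc-pred p)))) ⟩
    pred p + p * n                         ≡⟨ trans (ℕₚ.+-comm (pred p) (p * n)) (cong (_+ pred p) (ℕₚ.*-comm p n)) ⟩
    child (p ^ k ∸ 1) (pred p)             ∎
    where
    open ≡-Reasoning
    n = p ^ k ∸ 1

  pred-p<p : pred p < p
  pred-p<p = ℕₚ.≤-reflexive (ℕₚ.suc-pred p)

  shift-0 : ∀ L → shift L 0 ≡ 0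
  shift-0 zero = refl
  shift-0 (suc L) = trans (cong (shift L) (0/n≡0 p)) (shift-0 L)

  ∣-∣-same-residue : ∀ q q′ r → ∣ child q r - child q′ r ∣ ≡ p * ∣ q - q′ ∣
  ∣-∣-same-residue q q′ r = begin
    ∣ q * p + r - q′ * p + r ∣       ≡⟨ cong₂ ∣_-_∣ (ℕₚ.+-comm (q * p) r) (ℕₚ.+-comm (q′ * p) r) ⟩
    ∣ r + q * p - r + q′ * p ∣       ≡⟨ ℕₚ.∣m+n-m+o∣≡∣n-o∣ r (q * p) (q′ * p) ⟩
    ∣ q * p - q′ * p ∣               ≡⟨ ℕₚ.*-distribʳ-∣-∣ p q q′ ⟨
    ∣ q - q′ ∣ * p                   ≡⟨ ℕₚ.*-comm ∣ q - q′ ∣ p ⟩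
    p * ∣ q - q′ ∣                   ∎
    where open ≡-Reasoning

  pair-term-same-residue : ∀ a b → a ≢ b → a % p ≡ b % p → pair-term a b / p ≡ pair-term (a / p) (b / p)
  pair-term-same-residue a b a≢b same = begin
    (p ^ suc (ord p ∣ a - b ∣) ∸ 1) / p                ≡⟨ cong (_/ p) (all-digits-p-1 (ord p ∣ a - b ∣)) ⟩
    child (p ^ ord p ∣ a - b ∣ ∸ 1) (pred p) / p       ≡⟨ [cp+r]/p (p ^ ord p ∣ a - b ∣ ∸ 1) pred-p<p ⟩
    p ^ ord p ∣ a - b ∣ ∸ 1                            ≡⟨ cong (λ n → p ^ ord p n ∸ 1) difference ⟩
    p ^ ord p (p * ∣ a / p - b / p ∣) ∸ 1              ≡⟨ cong (λ k → p ^ k ∸ 1) (ord-* _ quotients-differ) ⟩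
    pair-term (a / p) (b / p)                          ∎
    where
    open ≡-Reasoning
    difference : ∣ a - b ∣ ≡ p * ∣ a / p - b / p ∣
    difference = trans (cong₂ ∣_-_∣ (div-mod a) (trans (div-mod b) (cong (b / p * p +_) (sym same))))
      (∣-∣-same-residue (a / p) (b / p) (a % p))
    quotients-differ : ∣ a / p - b / p ∣ ≢ 0
    quotients-differ eq = a≢b (ℕₚ.∣m-n∣≡0⇒m≡n (trans difference (trans (cong (p *_) eq) (ℕₚ.*-zeroʳ p))))

  ∣-∣%p≡0⇒ : ∀ a b → ∣ a - b ∣ % p ≡ 0 → a % p ≡ b % p
  ∣-∣%p≡0⇒ a b ≡0 with ℕₚ.≤-total a b
  ... | inj₁ a≤b = sym (trans (cong (_% p) (sym (ℕₚ.m+[n∸m]≡n a≤b))) (trans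
    (+-%-congˡ a (trans (cong (_% p) (sym (ℕₚ.m≤n⇒∣m-n∣≡n∸m a≤b))) (trans ≡0 (sym 0%p≡0)))) (cong (_% p) (ℕₚ.+-identityʳ a))))
  ... | inj₂ b≤a = trans (cong (_% p) (sym (ℕₚ.m+[n∸m]≡n b≤a))) (trans
    (+-%-congˡ b (trans (cong (_% p) (sym (ℕₚ.m≤n⇒∣n-m∣≡n∸m b≤a))) (trans ≡0 (sym 0%p≡0)))) (cong (_% p) (ℕₚ.+-identityʳ b)))

  pair-term-distinct-residues : ∀ a b → a % p ≢ b % p → pair-term a b / p ≡ 0
  pair-term-distinct-residues a b distinct = begin
    pair-term a b / p                                  ≡⟨ cong (_/ p) (all-digits-p-1 (ord p ∣ a - b ∣)) ⟩
    child (p ^ ord p ∣ a - b ∣ ∸ 1) (pred p) / p       ≡⟨ [cp+r]/p (p ^ ord p ∣ a - b ∣ ∸ 1) pred-p<p ⟩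
    p ^ ord p ∣ a - b ∣ ∸ 1                            ≡⟨ cong (λ k → p ^ k ∸ 1) (ordAux-≢0 _ ∣ a - b ∣ (distinct ∘ ∣-∣%p≡0⇒ a b)) ⟩
    0                                                  ∎
    where open ≡-Reasoning

  next-tokens : ℕ → Token → Token
  next-tokens zero t = t
  next-tokens (suc L) t = next-tokens L (next-token t)

  nexts-[] : ∀ L → nexts L [] ≡ []
  nexts-[] zero = refl
  nexts-[] (suc L) = nexts-[] L

  nexts-∷ : ∀ L {M} t (u : Forest M) → nexts L (t ∷ u) ≡ next-tokens L t ∷ nexts L u
  nexts-∷ zero t u = refl
  nexts-∷ (suc L) t u = nexts-∷ L (next-token t) (next u)

  colours-stay-distinct : ∀ L {c c′ a a′} → c ≢ c′ → proj₁ (next-tokens L (c , a)) ≢ proj₁ (next-tokens L (c′ , a′))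
  colours-stay-distinct zero c≢c′ = c≢c′
  colours-stay-distinct (suc L) {c} {c′} {a} {a′} c≢c′ = colours-stay-distinct L (c≢c′ ∘ proj₁ ∘ child-injective c c′ (m%n<n a p) (m%n<n a′ p))

  -- The digits of `pair-term a b` are p - 1 up to the position of the order of a - b and 0 beyond,
  -- and the two tokens share a colour exactly at those positions. As p - 1 is -1 modulo `p`, the
  -- pair terms of ψ subtract the monochromatic pairs digit by digit.
  pair-term-digit : ∀ L k a b → a ≢ b →
    (shift L (pair-term a b) + ind (proj₁ (next-tokens L (k , b))) (proj₁ (next-tokens L (k , a)))) % p ≡ 0 % p
  pair-term-digit zero k a b a≢b = begin
    (pair-term a b + ind k k) % p             ≡⟨ cong₂ (λ x y → (x + y) % p) (all-digits-p-1 (ord p ∣ a - b ∣)) (ind-refl k) ⟩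
    (n * p + pred p + 1) % p                  ≡⟨ cong (_% p) (trans (ℕₚ.+-assoc (n * p) (pred p) 1)
                                                   (cong (n * p +_) (trans (ℕₚ.+-comm (pred p) 1) (ℕₚ.suc-pred p)))) ⟩
    (n * p + p) % p                           ≡⟨ cong (_% p) (ℕₚ.+-comm (n * p) p) ⟩
    suc n * p % p                             ≡⟨ m*n%n≡0 (suc n) p ⟩
    0                                         ≡⟨ 0%p≡0 ⟨
    0 % p                                     ∎
    where
    open ≡-Reasoning
    n = p ^ ord p ∣ a - b ∣ ∸ 1
  pair-term-digit (suc L) k a b a≢b with a % p ℕ.≟ b % p
  ... | no distinct = cong (_% p) (cong₂ _+_
    (trans (cong (shift L) (pair-term-distinct-residues a b distinct)) (shift-0 L))
    (ind-≢ (colours-stay-distinct L (λ eq → distinct (sym (proj₂ (child-injective k k (m%n<n b p) (m%n<n a p) eq)))))))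
  ... | yes same = trans
    (cong₂ (λ x r → (shift L x + ind (proj₁ (next-tokens L (child k r , b / p))) (proj₁ (next-tokens L (child k (a % p) , a / p)))) % p)
      (pair-term-same-residue a b a≢b same) (sym same))
    (pair-term-digit L (child k (a % p)) (a / p) (b / p)
      (λ eq → a≢b (trans (div-mod a) (trans (cong₂ (λ q r → q * p + r) eq same) (sym (div-mod b))))))

  module _ (k : ℕ) where

    block : ∀ {m} → Vec ℕ m → Forest m
    block = Vec.map (k ,_)

    pair-terms-digit : ∀ L {m} a (A : Vec ℕ m) → All (a ≢_) A →
      (sum (List.map (shift L) (List.map (pair-term a) (Vec.toList A))) + cnt (proj₁ (next-tokens L (k , a))) (nexts L (block A))) % p ≡ 0 % p
    pair-terms-digit L a [] [] = cong (λ u → cnt (proj₁ (next-tokens L (k , a))) u % p) (nexts-[] L)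
    pair-terms-digit L a (b ∷ A) (a≢b ∷ a∉A) rewrite nexts-∷ L (k , b) (block A) = begin
      (x + xs + (i + c)) % p        ≡⟨ cong (_% p) (lem x xs i c) ⟩
      ((x + i) + (xs + c)) % p      ≡⟨ +-%-congʳ (xs + c) (pair-term-digit L k a b a≢b) ⟩
      (xs + c) % p                  ≡⟨ pair-terms-digit L a A a∉A ⟩
      0 % p                         ∎
      where
      open ≡-Reasoning
      x = shift L (pair-term a b)
      xs = sum (List.map (shift L) (List.map (pair-term a) (Vec.toList A)))
      i = ind (proj₁ (next-tokens L (k , b))) (proj₁ (next-tokens L (k , a)))
      c = cnt (proj₁ (next-tokens L (k , a))) (nexts L (block A))
      lem : ∀ x xs i c → x + xs + (i + c) ≡ (x + i) + (xs + c)
      lem = ℕR.solve-∀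

    all-pair-terms-digit : ∀ L {m} (A : Vec ℕ m) → Unique A →
      (sum (List.map (shift L) (pairTerms p (Vec.toList A))) + pairs (nexts L (block A))) % p ≡ 0 % p
    all-pair-terms-digit L [] [] = cong (λ u → pairs u % p) (nexts-[] L)
    all-pair-terms-digit L (a ∷ A) (a∉A ∷ distinct)
      rewrite nexts-∷ L (k , a) (block A)
            | Listₚ.map-++ (shift L) (List.map (pair-term a) (Vec.toList A)) (pairTerms p (Vec.toList A))
            | sum-++ (List.map (shift L) (List.map (pair-term a) (Vec.toList A))) (List.map (shift L) (pairTerms p (Vec.toList A))) = begin
      (xs + ys + (c + q)) % p        ≡⟨ cong (_% p) (lem xs ys c q) ⟩
      ((xs + c) + (ys + q)) % p      ≡⟨ +-%-congʳ (ys + q) (pair-terms-digit L a A a∉A) ⟩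
      (ys + q) % p                   ≡⟨ all-pair-terms-digit L A distinct ⟩
      0 % p                          ∎
      where
      open ≡-Reasoning
      xs = sum (List.map (shift L) (List.map (pair-term a) (Vec.toList A)))
      ys = sum (List.map (shift L) (pairTerms p (Vec.toList A)))
      c = cnt (proj₁ (next-tokens L (k , a))) (nexts L (block A))
      q = pairs (nexts L (block A))
      lem : ∀ x xs i c → x + xs + (i + c) ≡ (x + i) + (xs + c)
      lem = ℕR.solve-∀

    val-shift : ∀ L {m} (A : Vec ℕ m) → sum (List.map (shift L) (Vec.toList A)) ≡ val (nexts L (block A))
    val-shift L [] = cong val (sym (nexts-[] L))
    val-shift L (a ∷ A) rewrite nexts-∷ L (k , a) (block A) = cong₂ _+_ (value L k a) (val-shift L A)
      where
      value : ∀ L k a → shift L a ≡ proj₂ (next-tokens L (k , a))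
      value zero k a = refl
      value (suc L) k a = value L (child k (a % p)) (a / p)

    ψ-digits : ∀ {m} (A : Vec ℕ m) → Unique A → HasDigits (block A) (ψ p A)
    ψ-digits A distinct = nimSum-digits (Vec.toList A List.++ pairTerms p (Vec.toList A)) digit
      where
      open ≡-Reasoning
      digit : ∀ L → (sum (List.map (shift L) (Vec.toList A List.++ pairTerms p (Vec.toList A))) + pairs (nexts L (block A))) % p
        ≡ val (nexts L (block A)) % p
      digit L
        rewrite Listₚ.map-++ (shift L) (Vec.toList A) (pairTerms p (Vec.toList A))
              | sum-++ (List.map (shift L) (Vec.toList A)) (List.map (shift L) (pairTerms p (Vec.toList A)))
              | val-shift L A = begin
        (v + ys + q) % p     ≡⟨ cong (_% p) (ℕₚ.+-assoc v ys q) ⟩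
        (v + (ys + q)) % p   ≡⟨ +-%-congˡ v (all-pair-terms-digit L A distinct) ⟩
        (v + 0) % p          ≡⟨ cong (_% p) (ℕₚ.+-identityʳ v) ⟩
        v % p                ∎
        where
        v = val (nexts L (block A))
        ys = sum (List.map (shift L) (pairTerms p (Vec.toList A)))
        q = pairs (nexts L (block A))

  -- Sprague-Grundy functions

  p^k≢0 : ∀ k → NonZero (p ^ k)
  p^k≢0 k = ℕ.>-nonZero (ℕₚ.≤-trans (s≤s z≤n) (n<p^n k))

  _⊞_ : ∀ {m} → Vec ℕ m → Vec ℕ m → Vec ℕ m
  _⊞_ = zipWith _+_

  val-zip : ∀ {m} (c A : Vec ℕ m) → val (Vec.zip c A) ≡ Vec.sum A
  val-zip [] [] = refl
  val-zip (c ∷ cs) (a ∷ A) = cong (a +_) (val-zip cs A)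

  coloured-zip : ∀ {m Q} {c : Vec ℕ m} (A : Vec ℕ m) → All (_< Q) c → Coloured Q (Vec.zip c A)
  coloured-zip [] [] = []
  coloured-zip (a ∷ A) (c<Q ∷ cs<Q) = c<Q ∷ coloured-zip A cs<Q

  scale : ∀ {m} → ℕ → Vec ℕ m → Vec ℕ m
  scale N = Vec.map (N *_)

  sum-scale : ∀ {m} N (es : Vec ℕ m) → Vec.sum (scale N es) ≡ N * Vec.sum es
  sum-scale N [] = sym (ℕₚ.*-zeroʳ N)
  sum-scale N (e ∷ es) = trans (cong (N * e +_) (sum-scale N es)) (sym (ℕₚ.*-distribˡ-+ N e (Vec.sum es)))

  sum-⊞ : ∀ {m} (A B : Vec ℕ m) → Vec.sum (A ⊞ B) ≡ Vec.sum A + Vec.sum B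
  sum-⊞ [] [] = refl
  sum-⊞ (a ∷ A) (b ∷ B) = trans (cong (a + b +_) (sum-⊞ A B)) (lem a b (Vec.sum A) (Vec.sum B))
    where
    lem : ∀ a b x y → a + b + (x + y) ≡ a + x + (b + y)
    lem = ℕR.solve-∀

  divisible⇒scale : ∀ {m} N (D : Vec ℕ m) → (∀ i → N ∣ lookup D i) → ∃[ es ] D ≡ scale N es
  divisible⇒scale N [] _ = [] , refl
  divisible⇒scale N (d ∷ D) N∣ with N∣ zero | divisible⇒scale N D (N∣ ∘ suc)
  ... | divides e d≡ | es , D≡ = e ∷ es , cong₂ _∷_ (trans d≡ (ℕₚ.*-comm e N)) D≡

  differ-zip : ∀ {m} N (c B es : Vec ℕ m) → Differ N es (Vec.zip c (B ⊞ scale N es)) (Vec.zip c B)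
  differ-zip N [] [] [] = []
  differ-zip N (c ∷ cs) (b ∷ B) (e ∷ es) = refl ∷ differ-zip N cs B es

  differ-unzip : ∀ {m N} {c A es : Vec ℕ m} {v} → Differ N es (Vec.zip c A) v → ∃[ B ] (v ≡ Vec.zip c B × A ≡ B ⊞ scale N es)
  differ-unzip {c = []} {[]} [] = [] , refl , refl
  differ-unzip {c = c ∷ cs} {a ∷ A} (_∷_ {b = b} eq D) with differ-unzip D
  ... | B , v≡ , A≡ = b ∷ B , cong ((c , b) ∷_) v≡ , cong₂ _∷_ eq A≡

  ∤sum⇒∤term : ∀ {m} (es : Vec ℕ m) → ¬ p ∣ Vec.sum es → ∃[ i ] ¬ p ∣ lookup es i
  ∤sum⇒∤term [] p∤0 = contradiction (p Div.∣0) p∤0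
  ∤sum⇒∤term (e ∷ es) p∤∑ with p ∣? e
  ... | no p∤e = zero , p∤e
  ... | yes p∣e with ∤sum⇒∤term es (p∤∑ ∘ Div.∣m∣n⇒∣m+n p∣e)
  ...   | i , p∤ = suc i , p∤

  p^1+k∤ : ∀ k {e} → ¬ p ∣ e → ¬ p ^ suc k ∣ p ^ k * e
  p^1+k∤ k {e} p∤e p^1+k∣ = p∤e (Div.*-cancelˡ-∣ (p ^ k) {{p^k≢0 k}} (subst (_∣ p ^ k * e) (ℕₚ.*-comm p (p ^ k)) p^1+k∣))

  scale∈S : ∀ {m} k (es : Vec ℕ m) → ¬ p ∣ Vec.sum es → S p m (scale (p ^ k) es)
  scale∈S k es p∤∑ = k ,
    ((λ i → subst (p ^ k ∣_) (sym (Vecₚ.lookup-map i (p ^ k *_) es)) (Div.m∣m*n (lookup es i))) ,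
     i , subst (λ d → ¬ p ^ suc k ∣ d) (sym (Vecₚ.lookup-map i (p ^ k *_) es)) (p^1+k∤ k p∤ei)) ,
    subst (λ d → OrdIs p d k) (sym (sum-scale (p ^ k) es)) (Div.m∣m*n (Vec.sum es) , p^1+k∤ k p∤∑)
    where
    i = proj₁ (∤sum⇒∤term es p∤∑)
    p∤ei = proj₂ (∤sum⇒∤term es p∤∑)

  S-move : ∀ {m} (c A B D : Vec ℕ m) → A ≡ B ⊞ D → ∀ k → (∀ i → p ^ k ∣ lookup D i) →
    ∃[ es ] (Differ (p ^ k) es (Vec.zip c A) (Vec.zip c B) × Vec.sum D ≡ p ^ k * Vec.sum es)
  S-move c _ B D refl k p^k∣ with divisible⇒scale (p ^ k) D p^k∣
  ... | es , refl = es , differ-zip (p ^ k) c B es , sum-scale (p ^ k) es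

  -- The colour vector `c` tells which coordinates must be distinct from each other; this treats one
  -- Welter game and a sum of several by the same argument.
  module Game {M Q} (P : Pred M) (c : Vec ℕ M) (c<Q : All (_< Q) c)
    (position⇒unique : ∀ {A} → P A → Unique (Vec.zip c A)) (unique⇒position : ∀ {A} → Unique (Vec.zip c A) → P A) where

    Digits : Vec ℕ M → ℕ → Set
    Digits A = HasDigits (Vec.zip c A)

    reach-option : ∀ {A x n} → P A → Digits A x → n < x → ∃[ B ] (Edge P (S p M) A B × Digits B n)
    reach-option {A} PA digits n<x with reach (Vec.zip c A) (coloured-zip A c<Q) (position⇒unique PA) digits n<x
    ... | v , k , es , D , p∤∑ , distinct , digits′ with differ-unzip {c = c} {A} D
    ...   | B , refl , A≡ = B , (PA , unique⇒position distinct , scale (p ^ k) es , scale∈S k es p∤∑ , A≡) , digits′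

    -- If both values were `x`, `calm` would make `p ^ suc k` divide the sum of the entries of the
    -- move, whose order is `k`.
    option-digits-≢ : ∀ {A B x} → Edge P (S p M) A B → Digits A x → ¬ Digits B x
    option-digits-≢ {A} {B} {x} (_ , _ , D , (k , (p^k∣ , _) , _ , p^1+k∤∑) , A≡) X Y with S-move c A B D A≡ k p^k∣
    ... | es , differ , ∑≡ with calm k differ X Y
    ...   | i , j , eq = p^1+k∤∑ (subst (p ^ suc k ∣_) (sym ∑≡)
      (Div.∣m+n∣m⇒∣n (subst (p ^ suc k ∣_) cancelled (Div.m∣m*n i)) (Div.m∣m*n j)))
      where
      open ≡-Reasoning
      N = p ^ suc k
      vB = val (Vec.zip c B)
      e = p ^ k * Vec.sum es
      cancelled : N * i ≡ N * j + e
      cancelled = ℕₚ.+-cancelˡ-≡ (x + vB) _ _ (begin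
        x + vB + N * i          ≡⟨ eq ⟩
        x + val (Vec.zip c A) + N * j  ≡⟨ cong (λ v → x + v + N * j) (differ-val differ) ⟩
        x + (vB + e) + N * j    ≡⟨ lem x vB e (N * j) ⟩
        x + vB + (N * j + e)    ∎)
        where
        lem : ∀ x v e n → x + (v + e) + n ≡ x + v + (n + e)
        lem = ℕR.solve-∀

    option-smaller : ∀ {A B} → Edge P (S p M) A B → Vec.sum B < Vec.sum A
    option-smaller {A} {B} (_ , _ , D , (k , _ , _ , p^1+k∤∑) , refl) = subst (Vec.sum B <_) (sym (sum-⊞ B D))
      (ℕₚ.m<m+n (Vec.sum B) (ℕₚ.n≢0⇒n>0 λ ∑≡0 → p^1+k∤∑ (subst (p ^ suc k ∣_) (sym ∑≡0) ((p ^ suc k) Div.∣0))))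

    module _ {C : Pred M} (C⊆S : ∀ D → C D → S p M D) {g : Vec ℕ M → ℕ} (sg : IsSG P (C ∪ S p M) g) where

      in-S : ∀ {A B} → Edge P (C ∪ S p M) A B → Edge P (S p M) A B
      in-S (PA , PB , D , D∈ , A≡) = PA , PB , D , [ C⊆S D , id ]′ D∈ , A≡

      in-C∪S : ∀ {A B} → Edge P (S p M) A B → Edge P (C ∪ S p M) A B
      in-C∪S (PA , PB , D , D∈ , A≡) = PA , PB , D , inj₂ D∈ , A≡

      -- Induction on the sum of the entries. If `g A` were below `x`, `reach-option` would give an
      -- option of the same `g`-value; if it were above, some option would have `g`-value `x`, hence
      -- by induction digits `x`, against `option-digits-≢`.
      sg-value : ∀ {A x} → P A → Digits A x → g A ≡ x
      sg-value {A} = go (Vec.sum A) ℕₚ.≤-refl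
        where
        go : ∀ fuel {A x} → Vec.sum A ≤ fuel → P A → Digits A x → g A ≡ x
        option : ∀ fuel {A B x} → Vec.sum A ≤ fuel → Edge P (S p M) A B → Digits B x → g B ≡ x

        option zero ∑≤ edge Y = contradiction (ℕₚ.≤-trans (option-smaller edge) ∑≤) λ ()
        option (suc fuel) ∑≤ edge@(_ , PB , _) Y = go fuel (ℕₚ.≤-pred (ℕₚ.≤-trans (option-smaller edge) ∑≤)) PB Y

        go fuel {A} {x} ∑≤ PA X with ℕₚ.<-cmp (g A) x
        ... | tri≈ _ gA≡x _ = gA≡x
        ... | tri< gA<x _ _ with reach-option PA X gA<x
        ...   | B , edge , Y = contradiction (option fuel ∑≤ edge Y) (proj₁ (sg A PA) B (in-C∪S edge))
        go fuel {A} {x} ∑≤ PA X | tri> _ _ x<gA with proj₂ (sg A PA) x x<gA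
        ... | B , edge , gB≡x with digits-exist (Vec.zip c B) (position⇒unique (proj₁ (proj₂ edge)))
        ...   | y , Y = contradiction (subst (Digits B) (trans (sym (option fuel ∑≤ (in-S edge) Y)) gB≡x) Y)
                                      (option-digits-≢ (in-S edge) X)

      sg-digits : ∀ {A} → P A → Digits A (g A)
      sg-digits {A} PA with digits-exist (Vec.zip c A) (position⇒unique PA)
      ... | x , X = subst (Digits A) (sym (sg-value PA X)) X

      sg-calm : ∀ {A B} → P A → P B → ∀ D → A ≡ B ⊞ D → ∀ k → (∀ i → p ^ k ∣ lookup D i) →
        (ℤ.+ (p ^ suc k)) ℤd.∣ ((ℤ.+ g A ℤ.- ℤ.+ g B) ℤ.- (ℤ.+ Vec.sum A ℤ.- ℤ.+ Vec.sum B))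
      sg-calm {A} {B} PA PB D A≡ k p^k∣ with S-move c A B D A≡ k p^k∣
      ... | es , differ , _ with calm k differ (sg-digits PA) (sg-digits PB)
      ...   | i , j , eq = subst (ℤ.+ N ℤd.∣_) (sym difference)
        (subst (N ∣_) (sym (ℤₚ.abs-* (ℤ.+ N) (ℤ.+ j ℤ.- ℤ.+ i))) (Div.m∣m*n _))
        where
        open ≡-Reasoning
        N = p ^ suc k
        a b sA sB : ℤ.ℤ
        a = ℤ.+ g A
        b = ℤ.+ g B
        sA = ℤ.+ Vec.sum A
        sB = ℤ.+ Vec.sum B
        eqᶻ : a ℤ.+ sB ℤ.+ ℤ.+ N ℤ.* ℤ.+ i ≡ b ℤ.+ sA ℤ.+ ℤ.+ N ℤ.* ℤ.+ j
        eqᶻ = begin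
          a ℤ.+ sB ℤ.+ ℤ.+ N ℤ.* ℤ.+ i      ≡⟨ cong (λ z → a ℤ.+ sB ℤ.+ z) (ℤₚ.pos-* N i) ⟨
          ℤ.+ (g A + Vec.sum B + N * i)     ≡⟨ cong ℤ.+_ (subst₂ (λ x y → g A + x + N * i ≡ g B + y + N * j) (val-zip c B) (val-zip c A) eq) ⟩
          ℤ.+ (g B + Vec.sum A + N * j)     ≡⟨ cong (λ z → b ℤ.+ sA ℤ.+ z) (ℤₚ.pos-* N j) ⟩
          b ℤ.+ sA ℤ.+ ℤ.+ N ℤ.* ℤ.+ j      ∎
        difference : (a ℤ.- b) ℤ.- (sA ℤ.- sB) ≡ ℤ.+ N ℤ.* (ℤ.+ j ℤ.- ℤ.+ i)
        difference = begin
          (a ℤ.- b) ℤ.- (sA ℤ.- sB)                                           ≡⟨ lem₁ a b sA sB (ℤ.+ N) (ℤ.+ i) ⟩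
          a ℤ.+ sB ℤ.+ ℤ.+ N ℤ.* ℤ.+ i ℤ.- (b ℤ.+ sA ℤ.+ ℤ.+ N ℤ.* ℤ.+ i)     ≡⟨ cong (ℤ._- (b ℤ.+ sA ℤ.+ ℤ.+ N ℤ.* ℤ.+ i)) eqᶻ ⟩
          b ℤ.+ sA ℤ.+ ℤ.+ N ℤ.* ℤ.+ j ℤ.- (b ℤ.+ sA ℤ.+ ℤ.+ N ℤ.* ℤ.+ i)     ≡⟨ lem₂ (b ℤ.+ sA) (ℤ.+ N) (ℤ.+ i) (ℤ.+ j) ⟩
          ℤ.+ N ℤ.* (ℤ.+ j ℤ.- ℤ.+ i)                                         ∎
          where
          lem₁ : ∀ a b x y n i → (a ℤ.- b) ℤ.- (x ℤ.- y) ≡ a ℤ.+ y ℤ.+ n ℤ.* i ℤ.- (b ℤ.+ x ℤ.+ n ℤ.* i)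
          lem₁ = ℤR.solve-∀
          lem₂ : ∀ x n i j → x ℤ.+ n ℤ.* j ℤ.- (x ℤ.+ n ℤ.* i) ≡ n ℤ.* (j ℤ.- i)
          lem₂ = ℤR.solve-∀

  -- Descendants, and Welter moves as elements of S

  ⊞-identityʳ : ∀ {m} (A : Vec ℕ m) → A ≡ A ⊞ replicate m 0
  ⊞-identityʳ [] = refl
  ⊞-identityʳ (a ∷ A) = cong₂ _∷_ (sym (ℕₚ.+-identityʳ a)) (⊞-identityʳ A)

  ⊞-assoc : ∀ {m} (A B C : Vec ℕ m) → (A ⊞ B) ⊞ C ≡ A ⊞ (B ⊞ C)
  ⊞-assoc = Vecₚ.zipWith-assoc ℕₚ.+-assoc

  ⊞-∸ : ∀ {m} (B D : Vec ℕ m) → zipWith _∸_ (B ⊞ D) B ≡ D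
  ⊞-∸ [] [] = refl
  ⊞-∸ (b ∷ B) (d ∷ D) = cong₂ _∷_ (ℕₚ.m+n∸m≡n b d) (⊞-∸ B D)

  descendant : ∀ {m} {P C : Pred m} {A B} → P A → Star (Edge P C) A B → P B × ∃[ D ] A ≡ B ⊞ D
  descendant PA ε = PA , replicate _ 0 , ⊞-identityʳ _
  descendant PA ((_ , PA′ , D , _ , refl) ◅ path) with descendant PA′ path
  ... | PB , D′ , refl = PB , D′ ⊞ D , ⊞-assoc _ D′ D

  -- An inductive form of a vector supported in one coordinate. It survives the addition of zero
  -- blocks on either side, so a move in one summand of a sum is handled like a move of a single
  -- game.
  data Single (d : ℕ) : ∀ {m} → Vec ℕ m → Set where
    here  : ∀ {m} → Single d (d ∷ replicate m 0)
    there : ∀ {m} {D : Vec ℕ m} → Single d D → Single d (0 ∷ D)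

  zeros : ∀ {m} (D : Vec ℕ m) → (∀ i → lookup D i ≡ 0) → D ≡ replicate m 0
  zeros [] _ = refl
  zeros (d ∷ D) ≡0 = cong₂ _∷_ (≡0 zero) (zeros D (≡0 ∘ suc))

  welter-single : ∀ {m} (D : Vec ℕ m) → WelterMove m D → ∃[ d ] (d ≢ 0 × Single d D)
  welter-single (d ∷ D) (zero , d≢0 , off) = d , d≢0 , subst (λ E → Single d (d ∷ E)) (sym (zeros D (λ j → off (suc j) (λ ())))) here
  welter-single (d ∷ D) (suc i , Di≢0 , off) with welter-single D (i , Di≢0 , λ j j≢i → off (suc j) (j≢i ∘ suc-injective))
    where
    suc-injective : ∀ {n} {i j : Fin n} → Fin.suc i ≡ suc j → i ≡ j
    suc-injective refl = refl
  ... | e , e≢0 , single rewrite off zero (λ ()) = e , e≢0 , there single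

  ord-exists : ∀ d → d ≢ 0 → ∃ (OrdIs p d)
  ord-exists d d≢0 = go d d ℕₚ.≤-refl d≢0
    where
    go : ∀ fuel d → d ≤ fuel → d ≢ 0 → ∃ (OrdIs p d)
    go zero d d≤0 d≢0 = contradiction (ℕₚ.n≤0⇒n≡0 d≤0) d≢0
    go (suc fuel) d d≤ d≢0 with p ∣? d
    ... | no p∤d = 0 , Div.1∣ d , λ p∣d → p∤d (subst (_∣ d) (ℕₚ.*-identityʳ p) p∣d)
    ... | yes (divides e refl) with go fuel e (ℕₚ.≤-pred (ℕₚ.≤-trans e<d d≤)) e≢0
      where
      e≢0 : e ≢ 0
      e≢0 refl = d≢0 refl
      e<d : e < e * p
      e<d = ℕₚ.m<m*n e p {{ℕ.≢-nonZero e≢0}} 1<p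
    ...   | k , p^k∣e , p^1+k∤e = suc k , subst (p ^ suc k ∣_) (ℕₚ.*-comm p e) (Div.*-monoʳ-∣ p p^k∣e) ,
      λ p^2+k∣ → p^1+k∤e (Div.*-cancelˡ-∣ p (subst (p ^ suc (suc k) ∣_) (ℕₚ.*-comm e p) p^2+k∣))

  sum-zeros : ∀ m → Vec.sum (replicate m 0) ≡ 0
  sum-zeros zero = refl
  sum-zeros (suc m) = sum-zeros m

  single-sum : ∀ {d m} {D : Vec ℕ m} → Single d D → Vec.sum D ≡ d
  single-sum {d} {suc m} here = trans (cong (d +_) (sum-zeros m)) (ℕₚ.+-identityʳ d)
  single-sum (there single) = single-sum single

  single-divisible : ∀ {d m N} {D : Vec ℕ m} → Single d D → N ∣ d → ∀ i → N ∣ lookup D i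
  single-divisible here N∣d zero = N∣d
  single-divisible {N = N} (here {m}) N∣d (suc i) = subst (N ∣_) (sym (Vecₚ.lookup-replicate i 0)) (N Div.∣0)
  single-divisible {N = N} (there single) N∣d zero = N Div.∣0
  single-divisible (there single) N∣d (suc i) = single-divisible single N∣d i

  single-at : ∀ {d m} {D : Vec ℕ m} → Single d D → ∃[ i ] lookup D i ≡ d
  single-at here = zero , refl
  single-at (there single) with single-at single
  ... | i , eq = suc i , eq

  -- The sum of the entries is `d`, and the zero entries are divisible by every power, so both
  -- orders are the order of `d`.
  single∈S : ∀ {d m} {D : Vec ℕ m} → d ≢ 0 → Single d D → S p m D
  single∈S {d} d≢0 single with ord-exists d d≢0 | single-at single
  ... | k , p^k∣d , p^1+k∤d | i , Di≡d = k ,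
    (single-divisible single p^k∣d , i , subst (λ e → ¬ p ^ suc k ∣ e) (sym Di≡d) p^1+k∤d) ,
    (subst (p ^ k ∣_) (sym (single-sum single)) p^k∣d , subst (λ e → ¬ p ^ suc k ∣ e) (sym (single-sum single)) p^1+k∤d)

  welter∈S : ∀ {m} (D : Vec ℕ m) → WelterMove m D → S p m D
  welter∈S D D∈W with welter-single D D∈W
  ... | d , d≢0 , single = single∈S d≢0 single

  replicate-++ : ∀ m n → replicate m 0 Vec.++ replicate n 0 ≡ replicate (m + n) 0
  replicate-++ zero n = refl
  replicate-++ (suc m) n = cong (0 ∷_) (replicate-++ m n)

  single-++ˡ : ∀ {d m n} {D : Vec ℕ m} → Single d D → Single d (D Vec.++ replicate n 0)
  single-++ˡ {d} {n = n} (here {m}) = subst (λ E → Single d (d ∷ E)) (sym (replicate-++ m n)) here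
  single-++ˡ (there single) = there (single-++ˡ single)

  single-++ʳ : ∀ {d n} m {E : Vec ℕ n} → Single d E → Single d (replicate m 0 Vec.++ E)
  single-++ʳ zero single = single
  single-++ʳ (suc m) single = there (single-++ʳ m single)

  one-block-single : ∀ ms (bs : Blocks ms) → OneBlock WelterMove ms bs → ∃[ d ] (d ≢ 0 × Single d (flatten ms bs))
  one-block-single (m ∷ ms) (D , bs) (inj₁ (D∈W , rest≡0)) with welter-single D D∈W
  ... | d , d≢0 , single = d , d≢0 , subst (λ E → Single d (D Vec.++ E)) (sym rest≡0) (single-++ˡ single)
  one-block-single (m ∷ ms) (_ , bs) (inj₂ (refl , one)) with one-block-single ms bs one
  ... | d , d≢0 , single = d , d≢0 , single-++ʳ m single

  sum-moves∈S : ∀ ms D → SumMoves WelterMove ms D → S p (sum ms) D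
  sum-moves∈S ms _ (bs , refl , one) with one-block-single ms bs one
  ... | d , d≢0 , single = single∈S d≢0 single

  welter⇒unique : ∀ {m} (A : Vec ℕ m) → WelterPos m A → Unique A
  welter⇒unique [] _ = []
  welter⇒unique (a ∷ A) distinct = off A (λ j → distinct zero (suc j) (s≤s z≤n)) ∷ welter⇒unique A (λ i j i<j → distinct (suc i) (suc j) (s≤s i<j))
    where
    off : ∀ {m} (A : Vec ℕ m) → (∀ j → a ≢ lookup A j) → All (a ≢_) A
    off [] _ = []
    off (b ∷ A) neq = neq zero ∷ off A (neq ∘ suc)

  unique⇒welter : ∀ {m} (A : Vec ℕ m) → Unique A → WelterPos m A
  unique⇒welter (a ∷ A) (a∉A ∷ distinct) zero (suc j) _ = Allₚ.lookup⁺ a∉A j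
  unique⇒welter (a ∷ A) (a∉A ∷ distinct) (suc i) (suc j) (s≤s i<j) = unique⇒welter A distinct i j i<j

  -- Sums of Welter games

  all-replicate : ∀ {P : ℕ → Set} {x m} → P x → All P (replicate m x)
  all-replicate {m = zero} Px = []
  all-replicate {m = suc m} Px = Px ∷ all-replicate Px

  zip-replicate : ∀ {m} k (A : Vec ℕ m) → Vec.zip (replicate m k) A ≡ block k A
  zip-replicate k A = Vecₚ.zipWith-replicate₁ _,_ k A

  welter⇒unique-block : ∀ {m} k {A : Vec ℕ m} → WelterPos m A → Unique (block k A)
  welter⇒unique-block k {A} distinct = Uniqueₚ.map⁺ (cong proj₂) (welter⇒unique A distinct)

  unique-block⇒welter : ∀ {m} k {A : Vec ℕ m} → Unique (block k A) → WelterPos m A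
  unique-block⇒welter k {A} distinct = unique⇒welter A (strip A distinct)
    where
    off : ∀ {m a} (A : Vec ℕ m) → All ((k , a) ≢_) (block k A) → All (a ≢_) A
    off [] [] = []
    off (b ∷ A) (neq ∷ rest) = neq ∘ cong (k ,_) ∷ off A rest
    strip : ∀ {m} (A : Vec ℕ m) → Unique (block k A) → Unique A
    strip [] [] = []
    strip (a ∷ A) (a∉A ∷ distinct) = off A a∉A ∷ strip A distinct

  module Welter (m : ℕ) = Game {Q = 1} (WelterPos m) (replicate m 0) (all-replicate (s≤s z≤n))
    (λ {A} distinct → subst Unique (sym (zip-replicate 0 A)) (welter⇒unique-block 0 distinct))
    (λ {A} distinct → unique-block⇒welter 0 (subst Unique (zip-replicate 0 A) distinct))

  welter-calm : ∀ m → IsPCalm p (WelterPos m) (WelterMove m)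
  welter-calm m = welter∈S , calmness
    where
    calmness : ∀ C̃ → IsPSaturation p (WelterPos m) (WelterMove m) C̃ → ∀ g → IsSG (WelterPos m) C̃ g →
      ∀ A B → WelterPos m A → Star (Edge (WelterPos m) (WelterMove m)) A B → A ≢ B → ∀ k → MOrdIs p (zipWith _∸_ A B) k →
      (ℤ.+ (p ^ suc k)) ℤd.∣ ((ℤ.+ g A ℤ.- ℤ.+ g B) ℤ.- (ℤ.+ Vec.sum A ℤ.- ℤ.+ Vec.sum B))
    calmness C̃ (_ , same-sg) g sg A B PA path _ k (p^k∣ , _) with descendant PA path
    ... | PB , D , refl = Welter.sg-calm m welter∈S (proj₁ (same-sg g) sg) PA PB D refl k
      (λ i → subst (λ E → p ^ k ∣ lookup E i) (⊞-∸ B D) (p^k∣ i))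

  -- The colour of a coordinate is the index of its summand, so entries of different summands may
  -- coincide and never form a pair.
  block-colours : ∀ ms → ℕ → Vec ℕ (sum ms)
  block-colours [] k = []
  block-colours (m ∷ ms) k = replicate m k Vec.++ block-colours ms (suc k)

  block-colours< : ∀ ms k → All (_< k + length ms) (block-colours ms k)
  block-colours< [] k = []
  block-colours< (m ∷ ms) k = Allₚ.++⁺ (all-replicate (ℕₚ.m<m+n k (s≤s z≤n)))
    (subst (λ b → All (_< b) (block-colours ms (suc k))) (sym (ℕₚ.+-suc k (length ms))) (block-colours< ms (suc k)))

  AllColours≥ : ∀ {M} → ℕ → Forest M → Set
  AllColours≥ b = All (λ t → b ≤ proj₁ t)

  forest : ∀ ms → ℕ → Blocks ms → Forest (sum ms)
  forest [] k tt = []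
  forest (m ∷ ms) k (A , bs) = block k A Vec.++ forest ms (suc k) bs

  zip-++ : ∀ {m n} (c A : Vec ℕ m) (c′ A′ : Vec ℕ n) → Vec.zip (c Vec.++ c′) (A Vec.++ A′) ≡ Vec.zip c A Vec.++ Vec.zip c′ A′
  zip-++ [] [] c′ A′ = refl
  zip-++ (c ∷ cs) (a ∷ A) c′ A′ = cong ((c , a) ∷_) (zip-++ cs A c′ A′)

  zip-flatten : ∀ ms k (bs : Blocks ms) → Vec.zip (block-colours ms k) (flatten ms bs) ≡ forest ms k bs
  zip-flatten [] k tt = refl
  zip-flatten (m ∷ ms) k (A , bs) = trans (zip-++ (replicate m k) A (block-colours ms (suc k)) (flatten ms bs))
    (cong₂ Vec._++_ (zip-replicate k A) (zip-flatten ms (suc k) bs))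

  unflatten : ∀ ms (X : Vec ℕ (sum ms)) → ∃[ bs ] flatten ms bs ≡ X
  unflatten [] [] = tt , refl
  unflatten (m ∷ ms) X with Vec.splitAt m X
  ... | A , Y , refl with unflatten ms Y
  ...   | bs , refl = (A , bs) , refl

  coloured-block : ∀ {m} k (A : Vec ℕ m) → Coloured (suc k) (block k A)
  coloured-block k [] = []
  coloured-block k (a ∷ A) = ℕₚ.≤-refl ∷ coloured-block k A

  forest-colours : ∀ ms k (bs : Blocks ms) → AllColours≥ k (forest ms k bs)
  forest-colours [] k tt = []
  forest-colours (m ∷ ms) k (A , bs) = Allₚ.++⁺ (go A) (All.map ℕₚ.<⇒≤ (forest-colours ms (suc k) bs))
    where
    go : ∀ {m} (A : Vec ℕ m) → AllColours≥ k (block k A)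
    go [] = []
    go (a ∷ A) = ℕₚ.≤-refl ∷ go A

  blocks⇒unique : ∀ ms k (bs : Blocks ms) → AllBlocks WelterPos ms bs → Unique (forest ms k bs)
  blocks⇒unique [] k tt tt = []
  blocks⇒unique (m ∷ ms) k (A , bs) (distinct , rest) = AllPairsₚ.++⁺ (welter⇒unique-block k distinct)
    (blocks⇒unique ms (suc k) bs rest)
    (All.map (λ c≤k → All.map (λ k<c eq → ℕₚ.<⇒≱ k<c (subst (_≤ k) (cong proj₁ eq) (ℕₚ.≤-pred c≤k))) (forest-colours ms (suc k) bs))
      (coloured-block k A))

  unique-++⁻ : ∀ {m n} (u : Forest m) {v : Forest n} → Unique (u Vec.++ v) → Unique u × Unique v
  unique-++⁻ [] distinct = [] , distinct
  unique-++⁻ (t ∷ u) (t∉ ∷ distinct) with unique-++⁻ u distinct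
  ... | distinct-u , distinct-v = Allₚ.++ˡ⁻ u t∉ ∷ distinct-u , distinct-v

  unique⇒blocks : ∀ ms k (bs : Blocks ms) → Unique (forest ms k bs) → AllBlocks WelterPos ms bs
  unique⇒blocks [] k tt _ = tt
  unique⇒blocks (m ∷ ms) k (A , bs) distinct with unique-++⁻ (block k A) distinct
  ... | distinct-A , distinct-rest = unique-block⇒welter k distinct-A , unique⇒blocks ms (suc k) bs distinct-rest

  position⇒unique : ∀ ms X → SumPos WelterPos ms X → Unique (Vec.zip (block-colours ms 0) X)
  position⇒unique ms X (bs , refl , distinct) = subst Unique (sym (zip-flatten ms 0 bs)) (blocks⇒unique ms 0 bs distinct)

  unique⇒position : ∀ ms X → Unique (Vec.zip (block-colours ms 0) X) → ∃[ bs ] flatten ms bs ≡ X → SumPos WelterPos ms X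
  unique⇒position ms X distinct (bs , refl) = bs , refl , unique⇒blocks ms 0 bs (subst Unique (zip-flatten ms 0 bs) distinct)

  module WelterSum (ms : List ℕ) = Game {Q = length ms} (SumPos WelterPos ms) (block-colours ms 0) (block-colours< ms 0)
    (λ {X} → position⇒unique ms X)
    (λ {X} distinct → unique⇒position ms X distinct (unflatten ms X))

  val-++ : ∀ {m n} (u : Forest m) (v : Forest n) → val (u Vec.++ v) ≡ val u + val v
  val-++ [] v = refl
  val-++ (t ∷ u) v = trans (cong (proj₂ t +_) (val-++ u v)) (sym (ℕₚ.+-assoc (proj₂ t) (val u) (val v)))

  cnt-++ : ∀ {m n} z (u : Forest m) (v : Forest n) → cnt z (u Vec.++ v) ≡ cnt z u + cnt z v
  cnt-++ z [] v = refl
  cnt-++ z (t ∷ u) v = trans (cong (ind (proj₁ t) z +_) (cnt-++ z u v)) (sym (ℕₚ.+-assoc (ind (proj₁ t) z) (cnt z u) (cnt z v)))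

  cnt-above : ∀ {n b z} {v : Forest n} → z < b → AllColours≥ b v → cnt z v ≡ 0
  cnt-above z<b [] = refl
  cnt-above z<b (b≤c ∷ b≤v) = cong₂ _+_ (ind-≢ (ℕₚ.<⇒≢ (ℕₚ.≤-trans z<b b≤c) ∘ sym)) (cnt-above z<b b≤v)

  pairs-++ : ∀ {m n b} {u : Forest m} {v : Forest n} → Coloured b u → AllColours≥ b v → pairs (u Vec.++ v) ≡ pairs u + pairs v
  pairs-++ [] b≤v = refl
  pairs-++ {u = t ∷ u} {v} (c<b ∷ u<b) b≤v = trans
    (cong₂ _+_ (trans (cnt-++ (proj₁ t) u v) (trans (cong (cnt (proj₁ t) u +_) (cnt-above c<b b≤v)) (ℕₚ.+-identityʳ _))) (pairs-++ u<b b≤v))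
    (sym (ℕₚ.+-assoc (cnt (proj₁ t) u) (pairs u) (pairs v)))

  colours≥-next : ∀ {n b} {v : Forest n} → AllColours≥ b v → AllColours≥ (b * p) (next v)
  colours≥-next [] = []
  colours≥-next {v = (c , a) ∷ v} (b≤c ∷ b≤v) = ℕₚ.≤-trans (ℕₚ.*-monoˡ-≤ p b≤c) (ℕₚ.m≤m+n (c * p) (a % p)) ∷ colours≥-next b≤v

  nexts-++ : ∀ L {m n} (u : Forest m) (v : Forest n) → nexts L (u Vec.++ v) ≡ nexts L u Vec.++ nexts L v
  nexts-++ zero u v = refl
  nexts-++ (suc L) u v = trans (cong (nexts L) (Vecₚ.map-++ next-token u v)) (nexts-++ L (next u) (next v))

  -- The bound separating the two sets of colours is multiplied by `p` at each passage, so the sets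
  -- stay disjoint and no pair crosses between them.
  nexts-pairs-++ : ∀ L {m n b} {u : Forest m} {v : Forest n} → Coloured b u → AllColours≥ b v →
    pairs (nexts L u Vec.++ nexts L v) ≡ pairs (nexts L u) + pairs (nexts L v)
  nexts-pairs-++ zero u<b b≤v = pairs-++ u<b b≤v
  nexts-pairs-++ (suc L) u<b b≤v = nexts-pairs-++ L (coloured-next u<b) (colours≥-next b≤v)

  -- Values and pairs are additive over the summands on every level, so the digits of the single ψ
  -- add up modulo `p`, which is the p-Nim-sum.
  ψBlocks-digits : ∀ ms k (bs : Blocks ms) → AllBlocks WelterPos ms bs → ∀ L →
    (sum (List.map (shift L) (ψBlocks p ms bs)) + pairs (nexts L (forest ms k bs))) % p ≡ val (nexts L (forest ms k bs)) % p
  ψBlocks-digits [] k tt tt L rewrite nexts-[] L = refl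
  ψBlocks-digits (m ∷ ms) k (A , bs) (distinct , rest) L
    rewrite nexts-++ L (block k A) (forest ms (suc k) bs)
          | nexts-pairs-++ L (coloured-block k A) (forest-colours ms (suc k) bs)
          | val-++ (nexts L (block k A)) (nexts L (forest ms (suc k) bs)) = begin
    (x + xs + (q + r)) % p      ≡⟨ cong (_% p) (lem x xs q r) ⟩
    ((x + q) + (xs + r)) % p    ≡⟨ +-%-congˡ (x + q) (ψBlocks-digits ms (suc k) bs rest L) ⟩
    (x + q + w) % p             ≡⟨ +-%-congʳ w (ψ-digits k A (welter⇒unique A distinct) L) ⟩
    (v + w) % p                 ∎
    where
    open ≡-Reasoning
    x = shift L (ψ p A)
    xs = sum (List.map (shift L) (ψBlocks p ms bs))
    q = pairs (nexts L (block k A))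
    r = pairs (nexts L (forest ms (suc k) bs))
    v = val (nexts L (block k A))
    w = val (nexts L (forest ms (suc k) bs))
    lem : ∀ x xs q r → x + xs + (q + r) ≡ (x + q) + (xs + r)
    lem = ℕR.solve-∀

  welter-sum-value : ∀ ms C̃ → IsPSaturation p (SumPos WelterPos ms) (SumMoves WelterMove ms) C̃ →
    ∀ g → IsSG (SumPos WelterPos ms) C̃ g → ∀ bs → AllBlocks WelterPos ms bs → g (flatten ms bs) ≡ nimSum p (ψBlocks p ms bs)
  welter-sum-value ms C̃ (_ , same-sg) g sg bs distinct =
    WelterSum.sg-value ms (sum-moves∈S ms) (proj₁ (same-sg g) sg) (bs , refl , distinct)
      (subst (λ u → HasDigits u (nimSum p (ψBlocks p ms bs))) (sym (zip-flatten ms 0 bs))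
        (nimSum-digits (ψBlocks p ms bs) (ψBlocks-digits ms 0 bs distinct)))

open import Data.List.Relation.Unary.All using (All)

theorem3p13 : (p : ℕ) → 2 ≤ p →
    ((m : ℕ) → 1 ≤ m → IsPCalm p (WelterPos m) (WelterMove m))
    × ((ms : List ℕ) → All (1 ≤_) ms →
    (C̃ : Vec ℕ (sum ms) → Set) →
    IsPSaturation p (SumPos WelterPos ms) (SumMoves WelterMove ms) C̃ →
    (g : Vec ℕ (sum ms) → ℕ) → IsSG (SumPos WelterPos ms) C̃ g →
    (bs : Blocks ms) → AllBlocks WelterPos ms bs →
    g (flatten ms bs) ≡ nimSum p (ψBlocks p ms bs))
theorem3p13 p 2≤p = (λ m _ → welter-calm m) , λ ms _ → welter-sum-value ms
  where
  instance
    p≢0 : NonZero p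
    p≢0 = ℕ.>-nonZero (ℕₚ.<⇒≤ 2≤p)
  open Saturation p 2≤p
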